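{- Let $(x_n)_{n=1}^{\infty}$ be a sequence on $\mathbb{T}=\mathbb{R}/\mathbb{Z}$. If there exists a sequence $(t_n)_{n=1}^{\infty}$ of positive and bounded real numbers such that $$ \lim_{N \rightarrow \infty} \frac{1}{N^2} \sum_{m,n = 1}^{N} \theta_{t_N}(x_n - x_m) = 1,$$ then $(x_n)_{n=1}^{\infty}$ is uniformly distributed on $\mathbb{T}$.
   Context: $\mathbb{T}$ is the one-dimensional torus normalized to have length $1$. For $t>0$, the Jacobi $\theta$-function is $\theta_t(x) = 1 + 2 \sum_{n=1}^{\infty} e^{ -4 \pi^2 n^2 t}\cos(2 \pi n x)$. A sequence on $\mathbb{T}$ is uniformly distributed if for every interval (arc) $J\subset\mathbb{T}$, $\lim_{N\to\infty}\frac1N\#\{1\le i\le N: x_i\in J\}=|J|$, where $|J|$ is the length of $J$. -}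

module Defs where

open import Algebra.Bundles using (CommutativeRing; Semiring)
import Algebra.Definitions.RawSemiring as RawSemiringDefinitions
import Algebra.Properties.AbelianGroup as AbelianGroupProperties
import Algebra.Properties.Monoid.Mult as MonoidMult
import Algebra.Properties.Monoid.Sum as MonoidSum
open import Axiom.ExcludedMiddle using (ExcludedMiddle)
open import Data.Fin.Base using (toℕ)
open import Data.Integer.Base as ℤ using (ℤ; +_; -[1+_])
import Data.Integer.Properties as ℤ
open import Data.List.Base using (applyUpTo; filter; length)
open import Data.Nat.Base as ℕ using (ℕ; zero; suc; NonZero; _!)
open import Data.Product.Base using (∃; _×_; _,_)
open import Level using (0ℓ)
open import Relation.Binary.Bundles using (Setoid)
import Relation.Binary.Construct.NonStrictToStrict as NonStrictToStrict
open import Relation.Binary.Core using (Rel)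
open import Relation.Binary.PropositionalEquality.Core as ≡ using (_≡_)
import Relation.Binary.Reasoning.Setoid as SetoidReasoning
open import Relation.Binary.Structures using (IsTotalOrder)
open import Relation.Nullary using (¬_; yes; no)

-- Least-upper-bound completeness characterises ℝ up to unique isomorphism
-- (given excluded middle), so a theorem about every such structure is a
-- theorem about the real numbers.  The value 0# ⁻¹ is unconstrained.
record CompleteOrderedField : Set₁ where
  infix 8 _⁻¹
  infix 4 _≤_
  field
    commutativeRing : CommutativeRing 0ℓ 0ℓ

  open CommutativeRing commutativeRing public

  field
    _⁻¹          : Carrier → Carrier
    0≉1          : ¬ (0# ≈ 1#)
    ⁻¹-cong      : ∀ {x y} → x ≈ y → x ⁻¹ ≈ y ⁻¹
    ⁻¹-inverseʳ  : ∀ {x} → ¬ (x ≈ 0#) → x * x ⁻¹ ≈ 1#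
    _≤_          : Rel Carrier 0ℓ
    isTotalOrder : IsTotalOrder _≈_ _≤_
    +-monoˡ-≤    : ∀ {x y} z → x ≤ y → x + z ≤ y + z
    *-nonNeg     : ∀ {x y} → 0# ≤ x → 0# ≤ y → 0# ≤ x * y

  UpperBound : (Carrier → Set) → Carrier → Set
  UpperBound P b = ∀ x → P x → x ≤ b

  field
    complete : (P : Carrier → Set) → ∃ P → ∃ (UpperBound P) →
               ∃ λ s → UpperBound P s × (∀ b → UpperBound P b → s ≤ b)

  open NonStrictToStrict _≈_ _≤_ public using (_<_)

module RealAnalysis (em : ExcludedMiddle 0ℓ) (R : CompleteOrderedField) where

  open CompleteOrderedField R public renaming (Carrier to ℝ)
  open RawSemiringDefinitions (Semiring.rawSemiring semiring) using (_^_) public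
  open MonoidSum +-monoid using (sum-syntax) public

  private module Mult = MonoidMult +-monoid

  infixl 7 _/_
  _/_ : ℝ → ℝ → ℝ
  x / y = x * y ⁻¹

  fromℕ : ℕ → ℝ
  fromℕ n = n Mult.× 1#

  fromℤ : ℤ → ℝ
  fromℤ (+ n)    = fromℕ n
  fromℤ -[1+ n ] = - fromℕ (suc n)

  infix 4 _⟶_
  _⟶_ : (ℕ → ℝ) → ℝ → Set
  s ⟶ L = ∀ ε → 0# < ε → ∃ λ N₀ → ∀ N → N₀ ℕ.≤ N → L - ε < s N × s N < L + ε

  -- Some element of P, or the junk value 0# when P is empty.  It is applied
  -- below only to predicates that determine a real uniquely (up to ≈).
  the : (ℝ → Set) → ℝ
  the P with em {∃ P}
  ... | yes (x , _) = x
  ... | no  _       = 0#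

  lim : (ℕ → ℝ) → ℝ
  lim s = the (s ⟶_)

  -- ∑ₙ f n over n ≥ 0
  series : (ℕ → ℝ) → ℝ
  series f = lim λ N → ∑[ n < N ] f (toℕ n)

  exp : ℝ → ℝ
  exp x = series λ n → x ^ n / fromℕ (n !)

  cos : ℝ → ℝ
  cos x = series λ n → (- 1#) ^ n * x ^ (2 ℕ.* n) / fromℕ ((2 ℕ.* n) !)

  -- π / 2 is the least positive zero of cos.
  π : ℝ
  π = fromℕ 2 * the λ p → 0# < p × cos p ≈ 0# × (∀ q → 0# < q → cos q ≈ 0# → p ≤ q)

  -- 1-periodic in x, so it may be evaluated on representatives of points of ℝ / ℤ.
  θ : ℝ → ℝ → ℝ
  θ t x = 1# + fromℕ 2 * series λ k → term (suc k)
    where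
    term : ℕ → ℝ
    term n = exp (- (fromℕ 4 * π ^ 2 * fromℕ n ^ 2 * t)) * cos (fromℕ 2 * π * fromℕ n * x)

  private
    open AbelianGroupProperties +-abelianGroup
    open SetoidReasoning setoid

    minus-suc : ∀ a b → a - b ≈ (1# + a) - (1# + b)
    minus-suc a b = begin
      a - b                       ≈⟨ +-congʳ (+-identityˡ a) ⟨
      (0# + a) - b                ≈⟨ +-congʳ (+-congʳ (-‿inverseˡ 1#)) ⟨
      ((- 1# + 1#) + a) - b       ≈⟨ +-congʳ (+-assoc (- 1#) 1# a) ⟩
      (- 1# + (1# + a)) - b       ≈⟨ +-congʳ (+-comm (- 1#) (1# + a)) ⟩
      ((1# + a) - 1#) - b         ≈⟨ +-assoc (1# + a) (- 1#) (- b) ⟩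
      (1# + a) + (- 1# - b)       ≈⟨ +-congˡ (⁻¹-∙-comm 1# b) ⟩
      (1# + a) - (1# + b)         ∎

    fromℤ-⊖ : ∀ m n → fromℤ (m ℤ.⊖ n) ≈ fromℕ m - fromℕ n
    fromℤ-⊖ m zero = begin
      fromℕ m             ≈⟨ +-identityʳ (fromℕ m) ⟨
      fromℕ m + 0#        ≈⟨ +-congˡ ε⁻¹≈ε ⟨
      fromℕ m - 0#        ∎
    fromℤ-⊖ zero (suc n) = sym (+-identityˡ _)
    fromℤ-⊖ (suc m) (suc n) = begin
      fromℤ (suc m ℤ.⊖ suc n)     ≡⟨ ≡.cong fromℤ (ℤ.[1+m]⊖[1+n]≡m⊖n m n) ⟩
      fromℤ (m ℤ.⊖ n)             ≈⟨ fromℤ-⊖ m n ⟩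
      fromℕ m - fromℕ n           ≈⟨ minus-suc (fromℕ m) (fromℕ n) ⟩
      fromℕ (suc m) - fromℕ (suc n) ∎

  fromℤ-+ : ∀ i j → fromℤ (i ℤ.+ j) ≈ fromℤ i + fromℤ j
  fromℤ-+ (+ m)    (+ n)    = Mult.×-homo-+ 1# m n
  fromℤ-+ (+ m)    -[1+ n ] = fromℤ-⊖ m (suc n)
  fromℤ-+ -[1+ m ] (+ n)    = trans (fromℤ-⊖ n (suc m)) (+-comm _ _)
  fromℤ-+ -[1+ m ] -[1+ n ] = begin
    - fromℕ (suc (suc (m ℕ.+ n)))        ≈⟨ -‿cong (+-congˡ (Mult.×-homo-+ 1# (suc m) n)) ⟩
    - (1# + (fromℕ (suc m) + fromℕ n))   ≈⟨ -‿cong (+-assoc 1# (fromℕ (suc m)) (fromℕ n)) ⟨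
    - ((1# + fromℕ (suc m)) + fromℕ n)   ≈⟨ -‿cong (+-congʳ (+-comm 1# (fromℕ (suc m)))) ⟩
    - ((fromℕ (suc m) + 1#) + fromℕ n)   ≈⟨ -‿cong (+-assoc (fromℕ (suc m)) 1# (fromℕ n)) ⟩
    - (fromℕ (suc m) + fromℕ (suc n))    ≈⟨ ⁻¹-∙-comm (fromℕ (suc m)) (fromℕ (suc n)) ⟨
    - fromℕ (suc m) - fromℕ (suc n)      ∎

  infix 4 _≈𝕋_
  _≈𝕋_ : ℝ → ℝ → Set
  x ≈𝕋 y = ∃ λ k → x ≈ y + fromℤ k

  -- ℝ / ℤ: points are represented by real numbers, equality is ≈𝕋.
  𝕋 : Setoid 0ℓ 0ℓ
  𝕋 = record
    { Carrier       = ℝ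
    ; _≈_           = _≈𝕋_
    ; isEquivalence = record
      { refl  = λ {x} → + 0 , sym (+-identityʳ x)
      ; sym   = λ {x} {y} (k , x≈y+k) → ℤ.- k , (begin
          y                                  ≈⟨ +-identityʳ y ⟨
          y + fromℤ (+ 0)                    ≡⟨ ≡.cong (λ i → y + fromℤ i) (ℤ.+-inverseʳ k) ⟨
          y + fromℤ (k ℤ.- k)                ≈⟨ shift y k (ℤ.- k) ⟩
          (y + fromℤ k) + fromℤ (ℤ.- k)      ≈⟨ +-congʳ x≈y+k ⟨
          x + fromℤ (ℤ.- k)                  ∎)
      ; trans = λ {x} {y} {z} (k , x≈y+k) (l , y≈z+l) → l ℤ.+ k , (begin
          x                                  ≈⟨ x≈y+k ⟩
          y + fromℤ k                        ≈⟨ +-congʳ y≈z+l ⟩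
          (z + fromℤ l) + fromℤ k            ≈⟨ shift z l k ⟨
          z + fromℤ (l ℤ.+ k)                ∎)
      }
    }
    where
    shift : ∀ x i j → x + fromℤ (i ℤ.+ j) ≈ (x + fromℤ i) + fromℤ j
    shift x i j = trans (+-congˡ (fromℤ-+ i j)) (sym (+-assoc x (fromℤ i) (fromℤ j)))

  data EndpointKind : Set where
    closed open′ : EndpointKind

  below : EndpointKind → ℝ → ℝ → Set
  below closed x y = x ≤ y
  below open′  x y = x < y

  record Arc : Set where
    field
      left right   : ℝ
      leftKind     : EndpointKind
      rightKind    : EndpointKind
      left≤right   : left ≤ right
      right≤left+1 : right ≤ left + 1#

  -- An arc is the image in 𝕋 of a real interval of length at most 1.
  infix 4 _∈_
  _∈_ : Setoid.Carrier 𝕋 → Arc → Set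
  x ∈ J = ∃ λ y → x ≈𝕋 y × below leftKind left y × below rightKind y right
    where open Arc J

  arcLength : Arc → ℝ
  arcLength J = right - left
    where open Arc J

  -- A sequence (aₙ)ₙ≥₁ is a function on ℕ whose value at 0 is ignored.
  Positive : (ℕ → ℝ) → Set
  Positive a = ∀ n → .{{NonZero n}} → 0# < a n

  BoundedAbove : (ℕ → ℝ) → Set
  BoundedAbove a = ∃ λ B → ∀ n → .{{NonZero n}} → a n ≤ B

  -- ∑ f i over 1 ≤ i ≤ N
  sumTo : ℕ → (ℕ → ℝ) → ℝ
  sumTo N f = ∑[ i < N ] f (suc (toℕ i))

  -- #{ 1 ≤ i ≤ N : P i }
  countTo : ℕ → (ℕ → Set) → ℕ
  countTo N P = length (filter (λ i → em {P i}) (applyUpTo suc N))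

  UniformlyDistributed : (ℕ → Setoid.Carrier 𝕋) → Set
  UniformlyDistributed x =
    ∀ (J : Arc) → (λ N → fromℕ (countTo N (λ i → x i ∈ J)) / fromℕ N) ⟶ arcLength J

{-# OPTIONS --safe #-}

-- Expanding θ, the double sum equals N² + 2 ∑ₖ exp(-4π²k²t) |∑ₙ e(k xₙ)|², where e(u) = exp(2πiu).
-- All terms are nonnegative and, since t is bounded above, the k-th weight is bounded below; so the
-- hypothesis forces every exponential mean N⁻¹ ∑ₙ e(k xₙ), k ≥ 1, to tend to 0 (Weyl's criterion).
-- Hence the mean of the Fejér-type kernel D(xₙ - b), D(u) = |∑_{j<M} e(ju)|², tends to M.  The
-- translates of D by multiples of 1/M add up to the constant M², while away from ℤ the kernel D is
-- bounded uniformly in M.  Adding the translates centred well inside an arc (l, r) therefore bounds its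
-- frequency below by r - l - ε; the upper bound comes from the complementary arc.  The functions cos
-- and exp are only given as power series, so their addition theorems are obtained from Cauchy
-- products and the existence and properties of π from the sign change of cos on [0, 2].

module Submission where

open import Defs
import Algebra.Properties.Monoid.Mult as MonoidMult
import Algebra.Properties.Ring as RingProperties
import Algebra.Properties.Semiring.Mult as SemiringMult
import Algebra.Solver.Ring as RingSolver
open import Algebra.Bundles using (RawRing)
open import Algebra.Solver.Ring.AlmostCommutativeRing
  using (AlmostCommutativeRing; fromCommutativeRing; _-Raw-AlmostCommutative⟶_)
open import Axiom.ExcludedMiddle using (ExcludedMiddle)
open import Data.Empty using (⊥; ⊥-elim)
open import Data.Fin.Base using (toℕ)
open import Data.Integer.Base as ℤ using (ℤ; +_; -[1+_])
import Data.Integer.Properties as ℤ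
open import Data.List.Base using (_∷_; applyUpTo; filter; length)
open import Data.Maybe.Base using (Maybe; just; nothing)
open import Data.Nat.Base as ℕ using (ℕ; zero; suc; NonZero; _!)
import Data.Nat.Properties as ℕ
open import Data.Product.Base using (∃; _×_; _,_; proj₁; proj₂)
open import Data.Sum.Base using (_⊎_; inj₁; inj₂; [_,_]′)
open import Function.Base using (_∘_)
open import Level using (0ℓ)
open import Relation.Binary.Bundles using (Setoid)
open import Relation.Binary.Definitions using (tri<; tri≈; tri>)
open import Relation.Binary.PropositionalEquality.Core as ≡ using (_≡_)
import Relation.Binary.Reasoning.Setoid as SetoidReasoning
open import Relation.Binary.Structures using (IsTotalOrder)
open import Relation.Nullary using (¬_; yes; no)

-- The kernel D takes the place of integrals and of trigonometric approximation of an indicator. Its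
-- translates by a/M, a < M, add up to exactly M² because sums over M-th roots of unity vanish, and
-- D is bounded off ℤ because a geometric sum telescopes against a sine. About M(r - l) of these
-- translates have total mean about M²(r - l), never exceed M² together, and contribute only O(M)
-- off the arc; dividing by M² leaves an error O(1/M). Given ε, the order M is fixed first. D is
-- then a single trigonometric polynomial, so only finitely many exponential means enter and no rate
-- uniform in k is involved. Everything stays real: |∑ e(ju)|² is written as a cosine sum squared
-- plus a sine sum squared.

module Equidistribution (em : ExcludedMiddle 0ℓ) (R : CompleteOrderedField) where

  open RealAnalysis em R

  module Mult = MonoidMult +-monoid
  module RP = RingProperties ring

  -- Integer constants and the ring solver

  fromℕ-+ : ∀ m n → fromℕ (m ℕ.+ n) ≈ fromℕ m + fromℕ n
  fromℕ-+ = Mult.×-homo-+ 1#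

  fromℕ-* : ∀ m n → fromℕ (m ℕ.* n) ≈ fromℕ m * fromℕ n
  fromℕ-* = SemiringMult.×1-homo-* semiring

  -- Unlike fromℤ, this sends + 1 to 1# definitionally, so that solver
  -- constants match the literals of a goal.
  ⌊_⌋ℤ : ℤ → ℝ
  ⌊ + 1 ⌋ℤ = 1#
  ⌊ i   ⌋ℤ = fromℤ i

  ⌊⌋ℤ≈fromℤ : ∀ i → ⌊ i ⌋ℤ ≈ fromℤ i
  ⌊⌋ℤ≈fromℤ (+ zero)        = refl
  ⌊⌋ℤ≈fromℤ (+ suc zero)    = sym (+-identityʳ 1#)
  ⌊⌋ℤ≈fromℤ (+ suc (suc n)) = refl
  ⌊⌋ℤ≈fromℤ -[1+ n ]        = refl

  fromℤ-neg : ∀ i → fromℤ (ℤ.- i) ≈ - fromℤ i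
  fromℤ-neg (+ zero)  = sym RP.-0#≈0#
  fromℤ-neg (+ suc n) = refl
  fromℤ-neg -[1+ n ]  = sym (RP.-‿involutive _)

  fromℤ-* : ∀ i j → fromℤ (i ℤ.* j) ≈ fromℤ i * fromℤ j
  fromℤ-* (+ m) (+ n) = trans (reflexive (≡.cong fromℤ (≡.sym (ℤ.pos-* m n)))) (fromℕ-* m n)
  fromℤ-* (+ m) -[1+ n ] =
    trans (reflexive (≡.cong fromℤ
      (≡.trans (≡.sym (ℤ.neg-distribʳ-* (+ m) (+ suc n)))
        (≡.cong ℤ.-_ (≡.sym (ℤ.pos-* m (suc n)))))))
    (trans (fromℤ-neg (+ (m ℕ.* suc n)))
    (trans (-‿cong (fromℕ-* m (suc n))) (RP.-‿distribʳ-* _ _)))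
  fromℤ-* -[1+ m ] (+ n) =
    trans (reflexive (≡.cong fromℤ
      (≡.trans (≡.sym (ℤ.neg-distribˡ-* (+ suc m) (+ n)))
        (≡.cong ℤ.-_ (≡.sym (ℤ.pos-* (suc m) n))))))
    (trans (fromℤ-neg (+ (suc m ℕ.* n)))
    (trans (-‿cong (fromℕ-* (suc m) n)) (RP.-‿distribˡ-* _ _)))
  fromℤ-* -[1+ m ] -[1+ n ] =
    trans (fromℕ-* (suc m) (suc n))
    (trans (sym (RP.-‿involutive _))
    (trans (-‿cong (RP.-‿distribˡ-* _ _)) (RP.-‿distribʳ-* _ _)))

  -- Equality of reals does not compute, so coefficients are integers: their equality decides, and
  -- `⌊_⌋ℤ` carries the normal forms to ℝ. Numerical constants then cancel inside the solver.
  module Solver where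
    private
      ℤ-rawRing : RawRing 0ℓ 0ℓ
      ℤ-rawRing = record
        { Carrier = ℤ ; _≈_ = _≡_ ; _+_ = ℤ._+_ ; _*_ = ℤ._*_ ; -_ = ℤ.-_ ; 0# = + 0 ; 1# = + 1 }

      ℝ-acr : AlmostCommutativeRing 0ℓ 0ℓ
      ℝ-acr = fromCommutativeRing commutativeRing

      hom₂ : ∀ {f : ℤ → ℤ → ℤ} {g : ℝ → ℝ → ℝ} →
             (∀ {x y u v} → x ≈ y → u ≈ v → g x u ≈ g y v) →
             (∀ i j → fromℤ (f i j) ≈ g (fromℤ i) (fromℤ j)) →
             ∀ i j → ⌊ f i j ⌋ℤ ≈ g ⌊ i ⌋ℤ ⌊ j ⌋ℤ
      hom₂ {f} c h i j =
        trans (⌊⌋ℤ≈fromℤ (f i j)) (trans (h i j) (sym (c (⌊⌋ℤ≈fromℤ i) (⌊⌋ℤ≈fromℤ j))))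

      morphism : ℤ-rawRing -Raw-AlmostCommutative⟶ ℝ-acr
      morphism = record
        { ⟦_⟧    = ⌊_⌋ℤ
        ; +-homo = hom₂ {ℤ._+_} +-cong fromℤ-+
        ; *-homo = hom₂ {ℤ._*_} *-cong fromℤ-*
        ; -‿homo = λ i → trans (⌊⌋ℤ≈fromℤ (ℤ.- i))
          (trans (fromℤ-neg i) (-‿cong (sym (⌊⌋ℤ≈fromℤ i))))
        ; 0-homo = refl
        ; 1-homo = refl
        }

      coeff≟ : ∀ i j → Maybe (⌊ i ⌋ℤ ≈ ⌊ j ⌋ℤ)
      coeff≟ i j with i ℤ.≟ j
      ... | yes i≡j = just (reflexive (≡.cong ⌊_⌋ℤ i≡j))
      ... | no  _   = nothing

    open RingSolver ℤ-rawRing ℝ-acr morphism coeff≟ public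
      using (Polynomial; solve; _:=_; _:+_; _:*_; _:-_; :-_; con)

    infix 12 ♯_
    ♯_ : ∀ {n} → ℕ → Polynomial n
    ♯ n = con (+ n)

  open Solver

  -- Ordered field

  open IsTotalOrder isTotalOrder
    using () renaming (refl to ≤-refl; reflexive to ≤-reflexive; trans to ≤-trans; antisym to
      ≤-antisym; total to ≤-total)

  ≤-respʳ : ∀ {x y z} → y ≈ z → x ≤ y → x ≤ z
  ≤-respʳ y≈z x≤y = ≤-trans x≤y (≤-reflexive y≈z)

  ≤-respˡ : ∀ {x y z} → x ≈ y → x ≤ z → y ≤ z
  ≤-respˡ x≈y x≤z = ≤-trans (≤-reflexive (sym x≈y)) x≤z

  <⇒≤ : ∀ {x y} → x < y → x ≤ y
  <⇒≤ = proj₁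

  <-≤-trans : ∀ {x y z} → x < y → y ≤ z → x < z
  <-≤-trans (x≤y , x≉y) y≤z =
    ≤-trans x≤y y≤z , λ x≈z → x≉y (≤-antisym x≤y (≤-respʳ (sym x≈z) y≤z))

  ≤-<-trans : ∀ {x y z} → x ≤ y → y < z → x < z
  ≤-<-trans x≤y (y≤z , y≉z) =
    ≤-trans x≤y y≤z , λ x≈z → y≉z (≤-antisym y≤z (≤-respˡ x≈z x≤y))

  <-trans : ∀ {x y z} → x < y → y < z → x < z
  <-trans x<y y<z = <-≤-trans x<y (<⇒≤ y<z)

  <-respʳ : ∀ {x y z} → y ≈ z → x < y → x < z
  <-respʳ y≈z x<y = <-≤-trans x<y (≤-reflexive y≈z)

  <-respˡ : ∀ {x y z} → x ≈ y → x < z → y < z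
  <-respˡ x≈y x<z = ≤-<-trans (≤-reflexive (sym x≈y)) x<z

  <⇒≱ : ∀ {x y} → x < y → ¬ y ≤ x
  <⇒≱ (x≤y , x≉y) y≤x = x≉y (≤-antisym x≤y y≤x)

  ≤⊎> : ∀ x y → x ≤ y ⊎ y < x
  ≤⊎> x y with em {x ≤ y}
  ... | yes x≤y = inj₁ x≤y
  ... | no  x≰y with ≤-total x y
  ...   | inj₁ x≤y = ⊥-elim (x≰y x≤y)
  ...   | inj₂ y≤x = inj₂ (y≤x , λ y≈x → x≰y (≤-reflexive (sym y≈x)))

  ≮⇒≥ : ∀ {x y} → ¬ x < y → y ≤ x
  ≮⇒≥ {x} {y} x≮y with ≤⊎> y x
  ... | inj₁ y≤x = y≤x
  ... | inj₂ x<y = ⊥-elim (x≮y x<y)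

  ≤⇒0≤ : ∀ {x y} → x ≤ y → 0# ≤ y - x
  ≤⇒0≤ {x} x≤y = ≤-respˡ (-‿inverseʳ x) (+-monoˡ-≤ (- x) x≤y)

  -- Linear arithmetic is done by writing y - x as a combination d of nonnegative quantities, which
  -- leaves the solver a ring identity.
  diff-≤ : ∀ {x y d} → 0# ≤ d → y - x ≈ d → x ≤ y
  diff-≤ {x} {y} {d} 0≤d y-x≈d =
    ≤-respˡ (+-identityˡ x) (≤-respʳ
      (trans (+-congʳ (sym y-x≈d)) (solve 2 (λ x y → y :- x :+ x := y) refl x y))
      (+-monoˡ-≤ x 0≤d))

  diff-< : ∀ {x y d} → 0# < d → y - x ≈ d → x < y
  diff-< {x} {y} (0≤d , 0≉d) y-x≈d =
    diff-≤ 0≤d y-x≈d ,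
    λ x≈y → 0≉d (trans (sym (-‿inverseʳ y)) (trans (+-congˡ (-‿cong (sym x≈y))) y-x≈d))

  <⇒0< : ∀ {x y} → x < y → 0# < y - x
  <⇒0< {x} {y} (x≤y , x≉y) = ≤⇒0≤ x≤y , λ 0≈y-x → x≉y
    (trans (sym (+-identityˡ x)) (trans (+-congʳ 0≈y-x)
      (solve 2 (λ x y → y :- x :+ x := y) refl x y)))

  +-mono-≤ : ∀ {x y u v} → x ≤ y → u ≤ v → x + u ≤ y + v
  +-mono-≤ {x} {y} {u} {v} x≤y u≤v = ≤-trans (+-monoˡ-≤ u x≤y)
    (≤-respˡ (+-comm u y) (≤-respʳ (+-comm v y) (+-monoˡ-≤ y u≤v)))

  0≤+ : ∀ {x y} → 0# ≤ x → 0# ≤ y → 0# ≤ x + y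
  0≤+ 0≤x 0≤y = ≤-respˡ (+-identityˡ 0#) (+-mono-≤ 0≤x 0≤y)

  0<+0≤ : ∀ {x y} → 0# < x → 0# ≤ y → 0# < x + y
  0<+0≤ {x} {y} 0<x 0≤y = <-≤-trans 0<x (diff-≤ 0≤y (solve 2 (λ x y → x :+ y :- x := y) refl x y))

  0≤+0< : ∀ {x y} → 0# ≤ x → 0# < y → 0# < x + y
  0≤+0< {x} {y} 0≤x 0<y = <-≤-trans 0<y (diff-≤ 0≤x (solve 2 (λ x y → x :+ y :- y := x) refl x y))

  neg-mono-≤ : ∀ {x y} → x ≤ y → - y ≤ - x
  neg-mono-≤ {x} {y} x≤y = diff-≤ (≤⇒0≤ x≤y) (solve 2 (λ x y → :- x :- :- y := y :- x) refl x y)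

  *-monoˡ-≤ : ∀ {x y} z → 0# ≤ z → x ≤ y → z * x ≤ z * y
  *-monoˡ-≤ {x} {y} z 0≤z x≤y = diff-≤ (*-nonNeg 0≤z (≤⇒0≤ x≤y))
    (solve 3 (λ x y z → z :* y :- z :* x := z :* (y :- x)) refl x y z)

  *-mono-≤ : ∀ {x y u v} → 0# ≤ x → 0# ≤ u → x ≤ y → u ≤ v → x * u ≤ y * v
  *-mono-≤ {x} {y} {u} {v} 0≤x 0≤u x≤y u≤v =
    diff-≤ (0≤+ (*-nonNeg 0≤x (≤⇒0≤ u≤v)) (*-nonNeg (≤⇒0≤ x≤y) (≤-trans 0≤u u≤v)))
    (solve 4 (λ x y u v → y :* v :- x :* u := x :* (v :- u) :+ (y :- x) :* v) refl x y u v)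

  0≤sq : ∀ x → 0# ≤ x * x
  0≤sq x with ≤-total 0# x
  ... | inj₁ 0≤x = *-nonNeg 0≤x 0≤x
  ... | inj₂ x≤0 = ≤-respʳ (solve 1 (λ x → (♯ 0 :- x) :* (♯ 0 :- x) := x :* x) refl x)
                           (*-nonNeg (≤⇒0≤ x≤0) (≤⇒0≤ x≤0))

  0≤1 : 0# ≤ 1#
  0≤1 = ≤-respʳ (*-identityˡ 1#) (0≤sq 1#)

  0<1 : 0# < 1#
  0<1 = 0≤1 , 0≉1

  0≤fromℕ : ∀ n → 0# ≤ fromℕ n
  0≤fromℕ zero    = ≤-refl
  0≤fromℕ (suc n) = 0≤+ 0≤1 (0≤fromℕ n)

  0<fromℕ : ∀ n → .{{NonZero n}} → 0# < fromℕ n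
  0<fromℕ (suc n) = 0<+0≤ 0<1 (0≤fromℕ n)

  fromℕ-mono : ∀ {m n} → m ℕ.≤ n → fromℕ m ≤ fromℕ n
  fromℕ-mono {n = n} ℕ.z≤n = 0≤fromℕ n
  fromℕ-mono (ℕ.s≤s m≤n)   = +-mono-≤ ≤-refl (fromℕ-mono m≤n)

  <-irrefl : ∀ {x} → ¬ x < x
  <-irrefl (_ , x≉x) = x≉x refl

  0<⇒≉0 : ∀ {x} → 0# < x → ¬ x ≈ 0#
  0<⇒≉0 (_ , 0≉x) x≈0 = 0≉x (sym x≈0)

  inverseʳ : ∀ {x} → 0# < x → x * x ⁻¹ ≈ 1#
  inverseʳ 0<x = ⁻¹-inverseʳ (0<⇒≉0 0<x)

  *-cancelˡ : ∀ {x y z} → ¬ x ≈ 0# → x * y ≈ x * z → y ≈ z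
  *-cancelˡ {x} {y} {z} x≉0 xy≈xz = trans (lemma y) (trans (*-congˡ xy≈xz) (sym (lemma z)))
    where
    lemma : ∀ w → w ≈ x ⁻¹ * (x * w)
    lemma w = trans (sym (*-identityˡ w)) (trans (*-congʳ (sym (⁻¹-inverseʳ x≉0)))
      (solve 3 (λ x i w → x :* i :* w := i :* (x :* w)) refl x (x ⁻¹) w))

  0<* : ∀ {x y} → 0# < x → 0# < y → 0# < x * y
  0<* {x} {y} 0<x 0<y = *-nonNeg (<⇒≤ 0<x) (<⇒≤ 0<y) ,
    λ 0≈xy → proj₂ 0<y (*-cancelˡ (0<⇒≉0 0<x) (trans (zeroʳ x) 0≈xy))

  *-cancel-≤ : ∀ {x y z} → 0# < x → x * y ≤ x * z → y ≤ z
  *-cancel-≤ {x} {y} {z} 0<x xy≤xz with ≤⊎> y z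
  ... | inj₁ y≤z = y≤z
  ... | inj₂ z<y = ⊥-elim (<⇒≱ (diff-< (0<* 0<x (<⇒0< z<y))
    (solve 3 (λ x y z → x :* y :- x :* z := x :* (y :- z)) refl x y z)) xy≤xz)

  *-cancel-0< : ∀ {x y} → 0# < x → 0# < x * y → 0# < y
  *-cancel-0< {x} {y} 0<x 0<xy with ≤⊎> y 0#
  ... | inj₂ 0<y = 0<y
  ... | inj₁ y≤0 = ⊥-elim (<⇒≱ 0<xy (≤-respʳ (zeroʳ x) (*-monoˡ-≤ x (<⇒≤ 0<x) y≤0)))

  0<⁻¹ : ∀ {x} → 0# < x → 0# < x ⁻¹
  0<⁻¹ 0<x = *-cancel-0< 0<x (<-respʳ (sym (inverseʳ 0<x)) 0<1)

  0</ : ∀ {x y} → 0# < x → 0# < y → 0# < x / y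
  0</ 0<x 0<y = 0<* 0<x (0<⁻¹ 0<y)

  0≤/ : ∀ {x y} → 0# ≤ x → 0# < y → 0# ≤ x / y
  0≤/ 0≤x 0<y = *-nonNeg 0≤x (<⇒≤ (0<⁻¹ 0<y))

  *-/-cancel : ∀ x {y} → 0# < y → y * (x / y) ≈ x
  *-/-cancel x {y} 0<y = trans (solve 3 (λ x y i → y :* (x :* i) := y :* i :* x) refl x y (y ⁻¹))
    (trans (*-congʳ (inverseʳ 0<y)) (*-identityˡ x))

  /-intro : ∀ {x y z} → 0# < y → y * z ≈ x → z ≈ x / y
  /-intro {x} 0<y yz≈x = *-cancelˡ (0<⇒≉0 0<y) (trans yz≈x (sym (*-/-cancel x 0<y)))

  ≤-/ : ∀ {x y z} → 0# < y → y * z ≤ x → z ≤ x / y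
  ≤-/ {x} 0<y yz≤x = *-cancel-≤ 0<y (≤-respʳ (sym (*-/-cancel x 0<y)) yz≤x)

  /-≤ : ∀ {x y z} → 0# < y → x ≤ y * z → x / y ≤ z
  /-≤ {x} 0<y x≤yz = *-cancel-≤ 0<y (≤-respˡ (sym (*-/-cancel x 0<y)) x≤yz)

  0<2 : 0# < fromℕ 2
  0<2 = 0<fromℕ 2

  half : ℝ → ℝ
  half x = x / fromℕ 2

  half+half : ∀ x → half x + half x ≈ x
  half+half x = trans (solve 2 (λ x i → x :* i :+ x :* i := ♯ 2 :* (x :* i)) refl x (fromℕ 2 ⁻¹))
                      (*-/-cancel x 0<2)

  0<half : ∀ {x} → 0# < x → 0# < half x
  0<half 0<x = 0</ 0<x 0<2

  -- Were every natural at most x, their supremum s would satisfy n + 1 ≤ s for all n, which makes s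
  -- - 1 a smaller upper bound.
  archimedean : ∀ x → ∃ λ n → x < fromℕ n
  archimedean x with em {∃ λ n → x < fromℕ n}
  ... | yes p = p
  ... | no ¬p = ⊥-elim (<⇒≱ (diff-< 0<1 (solve 1 (λ s → s :- (s :- ♯ 1) := ♯ 1) refl s))
                            (s-least (s - 1#) s-1-bound))
    where
    P : ℝ → Set
    P y = ∃ λ n → y ≈ fromℕ n

    ub : UpperBound P x
    ub y (n , y≈n) = ≤-respˡ (sym y≈n) (≮⇒≥ λ x<n → ¬p (n , x<n))

    sup = complete P (0# , 0 , refl) (x , ub)
    s = proj₁ sup
    s-upper = proj₁ (proj₂ sup)
    s-least = proj₂ (proj₂ sup)

    s-1-bound : UpperBound P (s - 1#)
    s-1-bound y (n , y≈n) = diff-≤ (≤⇒0≤ (s-upper (1# + y) (suc n , +-congˡ y≈n)))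
      (solve 2 (λ s y → s :- ♯ 1 :- y := s :- (♯ 1 :+ y)) refl s y)

  floorℕ : ∀ x → 0# ≤ x → ∃ λ n → fromℕ n ≤ x × x < fromℕ n + 1#
  floorℕ x 0≤x = search (proj₁ (archimedean x)) (proj₂ (archimedean x))
    where
    search : ∀ n → x < fromℕ n → ∃ λ n → fromℕ n ≤ x × x < fromℕ n + 1#
    search zero    x<0 = ⊥-elim (<⇒≱ x<0 0≤x)
    search (suc n) x<n with ≤⊎> (fromℕ n) x
    ... | inj₁ n≤x = n , n≤x , <-respʳ (+-comm _ _) x<n
    ... | inj₂ x<n = search n x<n

  -- Adding a natural m > -x makes the argument nonnegative; the floor of x + m is then lowered by
  -- m.
  floorℤ : ∀ x → ∃ λ k → fromℤ k ≤ x × x < fromℤ k + 1#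
  floorℤ x with archimedean (- x)
  ... | m , -x<m with floorℕ (x + fromℕ m)
    (≤-respʳ (solve 2 (λ x m → m :- :- x := x :+ m) refl x (fromℕ m)) (≤⇒0≤ (<⇒≤ -x<m)))
  ... | n , n≤ , <n+1 = + n ℤ.- + m , ≤-respˡ (sym k≈) (diff-≤ (≤⇒0≤ n≤)
          (solve 3 (λ x m n → x :- (n :- m) := x :+ m :- n) refl x (fromℕ m) (fromℕ n))) ,
        diff-< (<⇒0< <n+1) (trans (+-congʳ (+-congʳ k≈))
          (solve 3 (λ x m n → (n :- m) :+ ♯ 1 :- x := n :+ ♯ 1 :- (x :+ m)) refl x (fromℕ m)
            (fromℕ n)))
    where
    k≈ : fromℤ (+ n ℤ.- + m) ≈ fromℕ n - fromℕ m
    k≈ = trans (fromℤ-+ (+ n) (ℤ.- + m)) (+-congˡ (fromℤ-neg (+ m)))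

  infix 4 ∣_∣≤_
  -- Absolute values occur only through bounds on them, so a pair of inequalities replaces an
  -- absolute value function.
  ∣_∣≤_ : ℝ → ℝ → Set
  ∣ x ∣≤ b = - b ≤ x × x ≤ b

  abs-bound : ∀ x → ∃ λ b → 0# ≤ b × ∣ x ∣≤ b × (x ≈ b ⊎ x ≈ - b)
  abs-bound x with ≤-total 0# x
  ... | inj₁ 0≤x = x , 0≤x , (≤-trans (diff-≤ 0≤x (solve 1 (λ x → ♯ 0 :- :- x := x) refl x)) 0≤x ,
    ≤-refl) , inj₁ refl
  ... | inj₂ x≤0 = - x , 0≤-x , (≤-reflexive (RP.-‿involutive x) , ≤-trans x≤0 0≤-x) , inj₂
    (sym (RP.-‿involutive x))
    where 0≤-x = ≤-respʳ (+-identityˡ (- x)) (≤⇒0≤ x≤0)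

  ∣∣≤-0≤ : ∀ {x b} → ∣ x ∣≤ b → 0# ≤ b
  ∣∣≤-0≤ {x} {b} (-b≤x , x≤b) = *-cancel-≤ 0<2 (≤-respˡ (sym (zeroʳ _))
    (≤-respʳ (solve 1 (λ b → b :- :- b := ♯ 2 :* b) refl b) (≤⇒0≤ (≤-trans -b≤x x≤b))))

  ∣∣≤-resp : ∀ {x y b c} → x ≈ y → b ≤ c → ∣ x ∣≤ b → ∣ y ∣≤ c
  ∣∣≤-resp x≈y b≤c (l , u) = ≤-respʳ x≈y (≤-trans (neg-mono-≤ b≤c) l) , ≤-respˡ x≈y (≤-trans u b≤c)

  ∣∣≤-+ : ∀ {x y a b} → ∣ x ∣≤ a → ∣ y ∣≤ b → ∣ x + y ∣≤ a + b
  ∣∣≤-+ {a = a} {b} (l₁ , u₁) (l₂ , u₂) =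
    ≤-respˡ (solve 2 (λ a b → :- a :+ :- b := :- (a :+ b)) refl a b) (+-mono-≤ l₁ l₂) , +-mono-≤ u₁
      u₂

  ∣∣≤-neg : ∀ {x b} → ∣ x ∣≤ b → ∣ - x ∣≤ b
  ∣∣≤-neg {x} {b} (l , u) = neg-mono-≤ u , ≤-respʳ (RP.-‿involutive b) (neg-mono-≤ l)

  -- No split on signs: 2(ab ± xy) is a sum of two products of the nonnegative quantities a - x, a +
  -- x, b - y, b + y.
  ∣∣≤-* : ∀ {x y a b} → ∣ x ∣≤ a → ∣ y ∣≤ b → ∣ x * y ∣≤ a * b
  ∣∣≤-* {x} {y} {a} {b} (l₁ , u₁) (l₂ , u₂) =
    *-cancel-≤ 0<2 (diff-≤ (0≤+ (*-nonNeg (≤⇒0≤ u₁) (≤⇒0≤ u₂)) (*-nonNeg (≤⇒0≤ l₁) (≤⇒0≤ l₂)))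
      (solve 4 (λ x y a b → ♯ 2 :* (x :* y) :- ♯ 2 :* :- (a :* b)
                          := (a :- x) :* (b :- y) :+ (x :- :- a) :* (y :- :- b)) refl x y a b)) ,
    *-cancel-≤ 0<2 (diff-≤ (0≤+ (*-nonNeg (≤⇒0≤ u₁) (≤⇒0≤ l₂)) (*-nonNeg (≤⇒0≤ l₁) (≤⇒0≤ u₂)))
      (solve 4 (λ x y a b → ♯ 2 :* (a :* b) :- ♯ 2 :* (x :* y)
                          := (a :- x) :* (y :- :- b) :+ (x :- :- a) :* (b :- y)) refl x y a b))

  0≤⇒∣∣≤ : ∀ {x} → 0# ≤ x → ∣ x ∣≤ x
  0≤⇒∣∣≤ {x} 0≤x = ≤-trans (diff-≤ 0≤x (solve 1 (λ x → ♯ 0 :- :- x := x) refl x)) 0≤x , ≤-refl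

  sq≤⇒∣∣≤ : ∀ {x b} → 0# ≤ b → x * x ≤ b * b → ∣ x ∣≤ b
  sq≤⇒∣∣≤ {x} {b} 0≤b x²≤b² =
    ≮⇒≥ (λ x<-b → <⇒≱ (lemma (- x) (<-respˡ (RP.-‿involutive b) (diff-< (<⇒0< x<-b)
      (solve 2 (λ x b → :- x :- :- :- b := :- b :- x) refl x b))))
      (≤-respˡ (solve 1 (λ x → x :* x := :- x :* :- x) refl x) x²≤b²)) ,
    ≮⇒≥ (λ b<x → <⇒≱ (lemma x b<x) x²≤b²)
    where
    lemma : ∀ y → b < y → b * b < y * y
    lemma y b<y = diff-< (0<* (<⇒0< b<y) (0<+0≤ (≤-<-trans 0≤b b<y) 0≤b))
      (solve 2 (λ y b → y :* y :- b :* b := (y :- b) :* (y :+ b)) refl y b)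

  -- Finite sums

  -- Unlike `∑[ i < N ]`, which peels off the first term, this recursion appends the last one.
  -- Passing from N to N + 1 in a sequence of partial sums is then definitional.
  Σ< : ℕ → (ℕ → ℝ) → ℝ
  Σ< zero    f = 0#
  Σ< (suc N) f = Σ< N f + f N

  Σ-cong : ∀ N {f g} → (∀ i → f i ≈ g i) → Σ< N f ≈ Σ< N g
  Σ-cong zero    f≈g = refl
  Σ-cong (suc N) f≈g = +-cong (Σ-cong N f≈g) (f≈g N)

  Σ-front : ∀ N f → Σ< (suc N) f ≈ f 0 + Σ< N (f ∘ suc)
  Σ-front zero    f = +-comm 0# (f 0)
  Σ-front (suc N) f = trans (+-congʳ (Σ-front N f)) (+-assoc _ _ _)

  ∑≈Σ< : ∀ N f → ∑[ i < N ] f (toℕ i) ≈ Σ< N f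
  ∑≈Σ< zero    f = refl
  ∑≈Σ< (suc N) f = trans (+-congˡ (∑≈Σ< N (f ∘ suc))) (sym (Σ-front N f))

  Σ-+ : ∀ N f g → Σ< N (λ i → f i + g i) ≈ Σ< N f + Σ< N g
  Σ-+ zero    f g = sym (+-identityˡ 0#)
  Σ-+ (suc N) f g = trans (+-congʳ (Σ-+ N f g))
    (solve 4 (λ a b c d → a :+ b :+ (c :+ d) := a :+ c :+ (b :+ d)) refl _ _ (f N) (g N))

  Σ-*ˡ : ∀ N c f → Σ< N (λ i → c * f i) ≈ c * Σ< N f
  Σ-*ˡ zero    c f = sym (zeroʳ c)
  Σ-*ˡ (suc N) c f = trans (+-congʳ (Σ-*ˡ N c f)) (sym (distribˡ c _ _))

  Σ-*ʳ : ∀ N c f → Σ< N (λ i → f i * c) ≈ Σ< N f * c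
  Σ-*ʳ N c f = trans (Σ-cong N (λ i → *-comm (f i) c)) (trans (Σ-*ˡ N c f) (*-comm c _))

  Σ-neg : ∀ N f → Σ< N (λ i → - f i) ≈ - Σ< N f
  Σ-neg zero    f = sym RP.-0#≈0#
  Σ-neg (suc N) f = trans (+-congʳ (Σ-neg N f))
    (solve 2 (λ a b → :- a :+ :- b := :- (a :+ b)) refl _ (f N))

  Σ-const : ∀ N c → Σ< N (λ _ → c) ≈ fromℕ N * c
  Σ-const zero    c = sym (zeroˡ c)
  Σ-const (suc N) c = trans (+-congʳ (Σ-const N c))
    (solve 2 (λ n c → n :* c :+ c := (♯ 1 :+ n) :* c) refl _ c)

  Σ-0 : ∀ N → Σ< N (λ _ → 0#) ≈ 0#
  Σ-0 N = trans (Σ-const N 0#) (zeroʳ _)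

  Σ-swap : ∀ M N (f : ℕ → ℕ → ℝ) → Σ< M (λ i → Σ< N (λ j → f i j)) ≈ Σ< N (λ j → Σ< M (λ i → f i j))
  Σ-swap zero    N f = sym (Σ-0 N)
  Σ-swap (suc M) N f = trans (+-congʳ (Σ-swap M N f)) (sym (Σ-+ N _ _))

  Σ-*-Σ : ∀ M N f g → Σ< M f * Σ< N g ≈ Σ< M (λ i → Σ< N (λ j → f i * g j))
  Σ-*-Σ M N f g = trans (sym (Σ-*ʳ M _ f)) (Σ-cong M λ i → sym (Σ-*ˡ N (f i) g))

  Σ-mono< : ∀ N {f g} → (∀ i → i ℕ.< N → f i ≤ g i) → Σ< N f ≤ Σ< N g
  Σ-mono< zero    f≤g = ≤-refl
  Σ-mono< (suc N) f≤g = +-mono-≤ (Σ-mono< N λ i i<N → f≤g i (ℕ.m<n⇒m<1+n i<N)) (f≤g N ℕ.≤-refl)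

  Σ-cong< : ∀ N {f g} → (∀ i → i ℕ.< N → f i ≈ g i) → Σ< N f ≈ Σ< N g
  Σ-cong< zero    f≈g = refl
  Σ-cong< (suc N) f≈g = +-cong (Σ-cong< N λ i i<N → f≈g i (ℕ.m<n⇒m<1+n i<N)) (f≈g N ℕ.≤-refl)

  Σ-mono : ∀ N {f g} → (∀ i → f i ≤ g i) → Σ< N f ≤ Σ< N g
  Σ-mono N f≤g = Σ-mono< N λ i _ → f≤g i

  0≤Σ : ∀ N {f} → (∀ i → 0# ≤ f i) → 0# ≤ Σ< N f
  0≤Σ N 0≤f = ≤-respˡ (Σ-0 N) (Σ-mono N 0≤f)

  ∣Σ∣≤ : ∀ N {f g} → (∀ i → ∣ f i ∣≤ g i) → ∣ Σ< N f ∣≤ Σ< N g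
  ∣Σ∣≤ N {g = g} f≤g = ≤-respˡ (Σ-neg N g) (Σ-mono N (proj₁ ∘ f≤g)) , Σ-mono N (proj₂ ∘ f≤g)

  Σ-monoˡ : ∀ {M N f} → (∀ i → 0# ≤ f i) → M ℕ.≤ N → Σ< M f ≤ Σ< N f
  Σ-monoˡ {f = f} 0≤f M≤N = go (ℕ.≤⇒≤′ M≤N)
    where
    go : ∀ {M N} → M ℕ.≤′ N → Σ< M f ≤ Σ< N f
    go (ℕ.≤′-reflexive ≡.refl) = ≤-refl
    go {N = suc N} (ℕ.≤′-step M≤N) = ≤-trans (go M≤N)
      (diff-≤ (0≤f N) (solve 2 (λ a b → a :+ b :- a := b) refl _ (f N)))

  Σ-single : ∀ {N f k} → (∀ i → 0# ≤ f i) → k ℕ.< N → f k ≤ Σ< N f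
  Σ-single {f = f} {k} 0≤f k<N = ≤-trans
    (diff-≤ (0≤Σ k 0≤f) (solve 2 (λ a b → a :+ b :- b := a) refl _ (f k))) (Σ-monoˡ 0≤f k<N)

  Σ-telescope : ∀ N (f : ℕ → ℝ) → Σ< N (λ i → f (suc i) - f i) ≈ f N - f 0
  Σ-telescope zero    f = sym (-‿inverseʳ (f 0))
  Σ-telescope (suc N) f = trans (+-congʳ (Σ-telescope N f))
    (solve 3 (λ a b c → a :- c :+ (b :- a) := b :- c) refl (f N) (f (suc N)) (f 0))

  Σ-split : ∀ m n f → Σ< (m ℕ.+ n) f ≈ Σ< m f + Σ< n (λ i → f (m ℕ.+ i))
  Σ-split m zero    f = trans (reflexive (≡.cong (λ k → Σ< k f) (ℕ.+-identityʳ m)))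
    (sym (+-identityʳ _))
  Σ-split m (suc n) f = trans (reflexive (≡.cong (λ k → Σ< k f) (ℕ.+-suc m n)))
    (trans (+-congʳ (Σ-split m n f)) (+-assoc _ _ _))

  -- Limits and series

  -- Whichever element the choice made by `the` produces, uniqueness identifies it with x.
  the-≈ : ∀ {P : ℝ → Set} {x} → P x → (∀ y → P y → y ≈ x) → the P ≈ x
  the-≈ {P} {x} Px uniq with em {∃ P}
  ... | yes (y , Py) = uniq y Py
  ... | no ¬∃        = ⊥-elim (¬∃ (x , Px))

  ⟶-elim : ∀ {s L} → s ⟶ L → ∀ ε → 0# < ε → ∃ λ N₀ → ∀ N → N₀ ℕ.≤ N → ∣ s N - L ∣≤ ε
  ⟶-elim {s} {L} s⟶L ε 0<ε with s⟶L ε 0<ε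
  ... | N₀ , h = N₀ , λ N N₀≤N →
    diff-≤ (≤⇒0≤ (<⇒≤ (proj₁ (h N N₀≤N))))
      (solve 3 (λ s l e → s :- l :- :- e := s :- (l :- e)) refl (s N) L ε) ,
    diff-≤ (≤⇒0≤ (<⇒≤ (proj₂ (h N N₀≤N))))
      (solve 3 (λ s l e → e :- (s :- l) := l :+ e :- s) refl (s N) L ε)

  half<self : ∀ {ε} → 0# < ε → half ε < ε
  half<self {ε} 0<ε = diff-< (0<half 0<ε) (trans (+-congʳ (sym (half+half ε)))
    (solve 1 (λ h → h :+ h :- h := h) refl (half ε)))

  -- Limits are handled with non-strict bounds; applying the hypothesis at ε/2 recovers the strict
  -- inequalities of the definition.
  ⟶-intro : ∀ {s L} → (∀ ε → 0# < ε → ∃ λ N₀ → ∀ N → N₀ ℕ.≤ N → ∣ s N - L ∣≤ ε) → s ⟶ L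
  ⟶-intro {s} {L} h ε 0<ε with h (half ε) (0<half 0<ε)
  ... | N₀ , h′ = N₀ , λ N N₀≤N →
    diff-< (0≤+0< (≤⇒0≤ (proj₁ (h′ N N₀≤N))) (<⇒0< (half<self 0<ε)))
      (solve 4 (λ s l e h → s :- (l :- e) := s :- l :- :- h :+ (e :- h)) refl (s N) L ε (half ε)) ,
    diff-< (0≤+0< (≤⇒0≤ (proj₂ (h′ N N₀≤N))) (<⇒0< (half<self 0<ε)))
      (solve 4 (λ s l e h → l :+ e :- s := h :- (s :- l) :+ (e :- h)) refl (s N) L ε (half ε))

  ⟶-cong : ∀ {s t L M} → (∀ N → s N ≈ t N) → L ≈ M → s ⟶ L → t ⟶ M
  ⟶-cong s≈t L≈M s⟶L ε 0<ε with s⟶L ε 0<ε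
  ... | N₀ , h = N₀ , λ N N₀≤N →
    <-respʳ (s≈t N) (<-respˡ (+-congʳ L≈M) (proj₁ (h N N₀≤N))) ,
    <-respˡ (s≈t N) (<-respʳ (+-congʳ L≈M) (proj₂ (h N N₀≤N)))

  ⟶-const : ∀ c → (λ _ → c) ⟶ c
  ⟶-const c = ⟶-intro λ ε 0<ε → 0 , λ N _ →
    ∣∣≤-resp (sym (-‿inverseʳ c)) (<⇒≤ 0<ε) (0≤⇒∣∣≤ ≤-refl)

  ⟶-+ : ∀ {s t L M} → s ⟶ L → t ⟶ M → (λ N → s N + t N) ⟶ L + M
  ⟶-+ {s} {t} {L} {M} s⟶L t⟶M = ⟶-intro λ ε 0<ε →
    let N₁ , h₁ = ⟶-elim s⟶L (half ε) (0<half 0<ε)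
        N₂ , h₂ = ⟶-elim t⟶M (half ε) (0<half 0<ε)
    in N₁ ℕ.⊔ N₂ , λ N N₀≤N → ∣∣≤-resp
         (solve 4 (λ s t l m → s :- l :+ (t :- m) := s :+ t :- (l :+ m)) refl (s N) (t N) L M)
         (≤-reflexive (half+half ε))
         (∣∣≤-+ (h₁ N (ℕ.≤-trans (ℕ.m≤m⊔n N₁ N₂) N₀≤N)) (h₂ N (ℕ.≤-trans (ℕ.m≤n⊔m N₁ N₂) N₀≤N)))

  ⟶-*ˡ : ∀ {s L} c → s ⟶ L → (λ N → c * s N) ⟶ c * L
  ⟶-*ˡ {s} {L} c s⟶L = ⟶-intro λ ε 0<ε →
    -- Dividing by 1 + b instead of b also covers c = 0.
    let N₀ , h = ⟶-elim s⟶L (ε / (1# + b)) (0</ 0<ε 0<1+b)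
    in N₀ , λ N N₀≤N → ∣∣≤-resp (solve 3 (λ c s l → c :* (s :- l) := c :* s :- c :* l) refl c (s N) L)
         (≤-respʳ (*-/-cancel ε 0<1+b)
           (diff-≤ (<⇒≤ (0</ 0<ε 0<1+b)) (solve 2 (λ b e → (♯ 1 :+ b) :* e :- b :* e := e) refl b
             (ε / (1# + b)))))
         (∣∣≤-* ∣c∣≤b (h N N₀≤N))
    where
    b = proj₁ (abs-bound c)
    0≤b = proj₁ (proj₂ (abs-bound c))
    ∣c∣≤b = proj₁ (proj₂ (proj₂ (abs-bound c)))
    0<1+b : 0# < 1# + b
    0<1+b = 0<+0≤ 0<1 0≤b

  ⟶-neg : ∀ {s L} → s ⟶ L → (λ N → - s N) ⟶ - L
  ⟶-neg s⟶L = ⟶-cong (λ N → RP.-1*x≈-x _) (RP.-1*x≈-x _) (⟶-*ˡ (- 1#) s⟶L)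

  ⟶-minus : ∀ {s t L M} → s ⟶ L → t ⟶ M → (λ N → s N - t N) ⟶ L - M
  ⟶-minus s⟶L t⟶M = ⟶-+ s⟶L (⟶-neg t⟶M)

  ⟶-null-* : ∀ {s t} → s ⟶ 0# → t ⟶ 0# → (λ N → s N * t N) ⟶ 0#
  ⟶-null-* {s} {t} s⟶0 t⟶0 = ⟶-intro λ ε 0<ε →
    let N₁ , h₁ = ⟶-elim s⟶0 1# 0<1
        N₂ , h₂ = ⟶-elim t⟶0 ε 0<ε
    in N₁ ℕ.⊔ N₂ , λ N N₀≤N → ∣∣≤-resp
         (solve 2 (λ s t → (s :- ♯ 0) :* (t :- ♯ 0) := s :* t :- ♯ 0) refl (s N) (t N))
         (≤-reflexive (*-identityˡ ε))
         (∣∣≤-* (h₁ N (ℕ.≤-trans (ℕ.m≤m⊔n N₁ N₂) N₀≤N)) (h₂ N (ℕ.≤-trans (ℕ.m≤n⊔m N₁ N₂) N₀≤N)))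

  ⟶-shift0 : ∀ {s L} → s ⟶ L → (λ N → s N - L) ⟶ 0#
  ⟶-shift0 {L = L} s⟶L = ⟶-cong (λ _ → refl) (-‿inverseʳ L) (⟶-minus s⟶L (⟶-const L))

  -- Reduction to null sequences through st = (s - L)(t - M) + Lt + Ms - LM.
  ⟶-* : ∀ {s t L M} → s ⟶ L → t ⟶ M → (λ N → s N * t N) ⟶ L * M
  ⟶-* {s} {t} {L} {M} s⟶L t⟶M = ⟶-cong
    (λ N → solve 4 (λ s t l m → (s :- l) :* (t :- m) :+ (l :* t :+ (m :* s :+ :- (l :* m))) 
             := s :* t)
             refl (s N) (t N) L M)
    (solve 2 (λ l m → ♯ 0 :+ (l :* m :+ (m :* l :+ :- (l :* m))) := l :* m) refl L M)
    (⟶-+ (⟶-null-* (⟶-shift0 s⟶L) (⟶-shift0 t⟶M))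
      (⟶-+ (⟶-*ˡ L t⟶M) (⟶-+ (⟶-*ˡ M s⟶L) (⟶-const (- (L * M))))))

  ⟶-Σ : ∀ K {s : ℕ → ℕ → ℝ} {L} → (∀ i → s i ⟶ L i) → (λ N → Σ< K (λ i → s i N)) ⟶ Σ< K L
  ⟶-Σ zero    s⟶L = ⟶-const 0#
  ⟶-Σ (suc K) s⟶L = ⟶-+ (⟶-Σ K s⟶L) (s⟶L K)

  ⟶-lower : ∀ {s L b} → s ⟶ L → ∀ N₁ → (∀ N → N₁ ℕ.≤ N → b ≤ s N) → b ≤ L
  ⟶-lower {s} {L} {b} s⟶L N₁ b≤s = ≮⇒≥ λ L<b →
    let N₀ , h = s⟶L (b - L) (<⇒0< L<b)
        N = N₀ ℕ.⊔ N₁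
    in <⇒≱ (<-respʳ (solve 2 (λ l b → l :+ (b :- l) := b) refl L b) (proj₂ (h N (ℕ.m≤m⊔n N₀ N₁))))
           (b≤s N (ℕ.m≤n⊔m N₀ N₁))

  ⟶-0≤ : ∀ {s L} → s ⟶ L → (∀ N → 0# ≤ s N) → 0# ≤ L
  ⟶-0≤ s⟶L 0≤s = ⟶-lower s⟶L 0 λ N _ → 0≤s N

  ⟶-≤ : ∀ {s t L M} → s ⟶ L → t ⟶ M → (∀ N → s N ≤ t N) → L ≤ M
  ⟶-≤ s⟶L t⟶M s≤t = diff-≤ (⟶-0≤ (⟶-minus t⟶M s⟶L) (λ N → ≤⇒0≤ (s≤t N))) refl

  ⟶-unique : ∀ {s L M} → s ⟶ L → s ⟶ M → L ≈ M
  ⟶-unique s⟶L s⟶M = ≤-antisym (⟶-≤ s⟶L s⟶M (λ _ → ≤-refl)) (⟶-≤ s⟶M s⟶L (λ _ → ≤-refl))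

  ⟶-∣∣≤ : ∀ {s t L M} → s ⟶ L → t ⟶ M → (∀ N → ∣ s N ∣≤ t N) → ∣ L ∣≤ M
  ⟶-∣∣≤ s⟶L t⟶M h = ⟶-≤ (⟶-neg t⟶M) s⟶L (proj₁ ∘ h) , ⟶-≤ s⟶L t⟶M (proj₂ ∘ h)

  ⟶-squeeze : ∀ {s b} → b ⟶ 0# → (∀ N → ∣ s N ∣≤ b N) → s ⟶ 0#
  ⟶-squeeze {s} {b} b⟶0 s≤b = ⟶-intro λ ε 0<ε →
    let N₀ , h = ⟶-elim b⟶0 ε 0<ε
        s-0 = λ N → solve 1 (λ s → s := s :- ♯ 0) refl (s N)
    in N₀ , λ N N₀≤N →
         ∣∣≤-resp (s-0 N) (≤-respˡ (solve 1 (λ b → b :- ♯ 0 := b) refl (b N)) (proj₂ (h N N₀≤N))) (s≤b N)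

  ⟶-∘ : ∀ {s L} (φ : ℕ → ℕ) → (∀ N → N ℕ.≤ φ N) → s ⟶ L → (s ∘ φ) ⟶ L
  ⟶-∘ φ N≤φN s⟶L ε 0<ε with s⟶L ε 0<ε
  ... | N₀ , h = N₀ , λ N N₀≤N → h (φ N) (ℕ.≤-trans N₀≤N (N≤φN N))

  lim-≈ : ∀ {s L} → s ⟶ L → lim s ≈ L
  lim-≈ s⟶L = the-≈ s⟶L λ M s⟶M → ⟶-unique s⟶M s⟶L

  monotone-convergence : ∀ {s} b → (∀ {M N} → M ℕ.≤ N → s M ≤ s N) → (∀ N → s N ≤ b) → ∃ λ L → s ⟶ L
  monotone-convergence {s} b mono s≤b = L , conv
    where
    P : ℝ → Set
    P y = ∃ λ n → y ≤ s n
    sup = complete P (s 0 , 0 , ≤-refl) (b , λ y (n , y≤sn) → ≤-trans y≤sn (s≤b n))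
    L = proj₁ sup
    conv : s ⟶ L
    conv ε 0<ε with em {∃ λ n → L - ε < s n}
    ... | yes (n , L-ε<sn) = n , λ N n≤N → <-≤-trans L-ε<sn (mono n≤N) ,
          diff-< (0≤+0< (≤⇒0≤ (proj₁ (proj₂ sup) (s N) (N , ≤-refl))) 0<ε)
            (solve 3 (λ l e s → l :+ e :- s := (l :- s) :+ e) refl L ε (s N))
    ... | no ¬∃ = ⊥-elim (<⇒≱ (diff-< 0<ε (solve 2 (λ l e → l :- (l :- e) := e) refl L ε))
          (proj₂ (proj₂ sup) (L - ε) λ y (n , y≤sn) → ≤-trans y≤sn (≮⇒≥ λ lt → ¬∃ (n , lt))))

  infix 4 _SumsTo_
  _SumsTo_ : (ℕ → ℝ) → ℝ → Set
  f SumsTo L = (λ N → Σ< N f) ⟶ L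

  series-≈ : ∀ {f L} → f SumsTo L → series f ≈ L
  series-≈ {f} f⇒L = lim-≈ (⟶-cong (λ N → sym (∑≈Σ< N f)) refl f⇒L)

  nonneg-summable : ∀ {f} b → (∀ i → 0# ≤ f i) → (∀ N → Σ< N f ≤ b) → ∃ (f SumsTo_)
  nonneg-summable b 0≤f = monotone-convergence b (Σ-monoˡ 0≤f)

  partial≤ : ∀ {f L} → (∀ i → 0# ≤ f i) → f SumsTo L → ∀ N → Σ< N f ≤ L
  partial≤ 0≤f f⇒L N = ⟶-lower f⇒L N λ M N≤M → Σ-monoˡ 0≤f N≤M

  SumsTo-cong : ∀ {f g L M} → (∀ i → f i ≈ g i) → L ≈ M → f SumsTo L → g SumsTo M
  SumsTo-cong f≈g = ⟶-cong λ N → Σ-cong N f≈g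

  SumsTo-*ˡ : ∀ {f L} c → f SumsTo L → (λ i → c * f i) SumsTo c * L
  SumsTo-*ˡ {f} c f⇒L = ⟶-cong (λ N → sym (Σ-*ˡ N c f)) refl (⟶-*ˡ c f⇒L)

  -- Absolute convergence without absolute values: f + g has nonnegative terms and partial sums at
  -- most 2B, so it converges, and the sum of g is subtracted again.
  comparison : ∀ {f g B} → (∀ i → ∣ f i ∣≤ g i) → g SumsTo B → ∃ (f SumsTo_)
  comparison {f} {g} {B} f≤g g⇒B = proj₁ f+g - B , ⟶-cong
    (λ N → trans (+-congʳ (Σ-+ N f g)) (solve 2 (λ f g → f :+ g :- g := f) refl (Σ< N f) (Σ< N g)))
      refl
    (⟶-minus (proj₂ f+g) g⇒B)
    where
    0≤g : ∀ i → 0# ≤ g i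
    0≤g i = ∣∣≤-0≤ (f≤g i)
    0≤f+g : ∀ i → 0# ≤ f i + g i
    0≤f+g i = ≤-respʳ (solve 2 (λ f g → f :- :- g := f :+ g) refl (f i) (g i))
      (≤⇒0≤ (proj₁ (f≤g i)))
    f+g = nonneg-summable (B + B) 0≤f+g λ N → ≤-respˡ (sym (Σ-+ N f g))
      (+-mono-≤ (≤-trans (Σ-mono N (proj₂ ∘ f≤g)) (partial≤ 0≤g g⇒B N)) (partial≤ 0≤g g⇒B N))

  tail-bound : ∀ {f g A B} → (∀ i → ∣ f i ∣≤ g i) → f SumsTo A → g SumsTo B →
               ∀ m → ∣ A - Σ< m f ∣≤ B - Σ< m g
  tail-bound {f} {g} {A} {B} f≤g f⇒A g⇒B m =
    ⟶-∣∣≤ (tail f⇒A) (tail g⇒B) λ n → ∣Σ∣≤ n λ i → f≤g (m ℕ.+ i)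
    where
    tail : ∀ {h L} → h SumsTo L → (λ n → Σ< n (λ i → h (m ℕ.+ i))) ⟶ L - Σ< m h
    tail {h} h⇒L = ⟶-cong
      (λ n → trans (+-congʳ (Σ-split m n h))
        (solve 2 (λ a b → a :+ b :- a := b) refl (Σ< m h) (Σ< n (λ i → h (m ℕ.+ i)))))
      refl
      (⟶-minus (⟶-∘ (m ℕ.+_) (λ n → ℕ.m≤n+m n m) h⇒L) (⟶-const (Σ< m h)))

  -- Divided powers and Cauchy products

  infix 10 _^[_]
  -- The divided power xⁿ / n!.
  _^[_] : ℝ → ℕ → ℝ
  x ^[ zero  ] = 1#
  x ^[ suc n ] = x * x ^[ n ] / fromℕ (suc n)

  ^[suc] : ∀ x n → fromℕ (suc n) * x ^[ suc n ] ≈ x * x ^[ n ]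
  ^[suc] x n = *-/-cancel _ (0<fromℕ (suc n))

  ^[]-cong : ∀ n {x y} → x ≈ y → x ^[ n ] ≈ y ^[ n ]
  ^[]-cong zero    x≈y = refl
  ^[]-cong (suc n) x≈y = *-congʳ (*-cong x≈y (^[]-cong n x≈y))

  ^/!≈^[] : ∀ x n → x ^ n / fromℕ (n !) ≈ x ^[ n ]
  ^/!≈^[] x n = sym (/-intro (0<fromℕ (n !) {{n ℕ.!≢0}}) (lemma n))
    where
    lemma : ∀ n → fromℕ (n !) * x ^[ n ] ≈ x ^ n
    lemma zero    = solve 0 ((♯ 1 :+ ♯ 0) :* ♯ 1 := ♯ 1) refl
    lemma (suc n) = trans (*-congʳ (fromℕ-* (suc n) (n !)))
      (trans (solve 3 (λ s f q → s :* f :* q := f :* (s :* q)) refl (fromℕ (suc n)) (fromℕ (n !))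
        (x ^[ suc n ]))
      (trans (*-congˡ (^[suc] x n))
      (trans (solve 3 (λ f x q → f :* (x :* q) := x :* (f :* q)) refl (fromℕ (n !)) x (x ^[ n ]))
             (*-congˡ (lemma n)))))

  0≤^[] : ∀ n {x} → 0# ≤ x → 0# ≤ x ^[ n ]
  0≤^[] zero    0≤x = 0≤1
  0≤^[] (suc n) 0≤x = 0≤/ (*-nonNeg 0≤x (0≤^[] n 0≤x)) (0<fromℕ (suc n))

  ∣^[]∣≤ : ∀ n {x y} → ∣ x ∣≤ y → ∣ x ^[ n ] ∣≤ y ^[ n ]
  ∣^[]∣≤ zero    h = 0≤⇒∣∣≤ 0≤1
  ∣^[]∣≤ (suc n) h = ∣∣≤-* (∣∣≤-* h (∣^[]∣≤ n h)) (0≤⇒∣∣≤ (<⇒≤ (0<⁻¹ (0<fromℕ (suc n)))))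

  ^[]-neg : ∀ n x → (- x) ^[ n ] ≈ (- 1#) ^ n * x ^[ n ]
  ^[]-neg zero    x = sym (*-identityˡ 1#)
  ^[]-neg (suc n) x = trans (*-congʳ (*-congˡ (^[]-neg n x)))
    (solve 4 (λ x s q i → :- x :* (s :* q) :* i := (:- ♯ 1 :* s) :* (x :* q :* i)) refl
      x ((- 1#) ^ n) (x ^[ n ]) (fromℕ (suc n) ⁻¹))

  -- The halving condition says precisely that Σ< n f + 2 f(n) does not increase from n = m on.
  geometric-bound : ∀ {f} m → (∀ i → 0# ≤ f i) → (∀ k → fromℕ 2 * f (suc (m ℕ.+ k)) ≤ f (m ℕ.+ k)) →
                    ∀ N → Σ< N f ≤ Σ< m f + fromℕ 2 * f m
  geometric-bound {f} m 0≤f halving N =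
    ≤-trans (Σ-monoˡ 0≤f (ℕ.m≤n+m N m)) (≤-trans
      (diff-≤ (*-nonNeg (<⇒≤ 0<2) (0≤f (m ℕ.+ N)))
        (solve 2 (λ s q → s :+ ♯ 2 :* q :- s := ♯ 2 :* q) refl (Σ< (m ℕ.+ N) f) (f (m ℕ.+ N))))
      (go N))
    where
    at : ℕ → ℝ
    at n = Σ< n f + fromℕ 2 * f n
    go : ∀ k → at (m ℕ.+ k) ≤ at m
    go zero    = ≤-reflexive (reflexive (≡.cong at (ℕ.+-identityʳ m)))
    go (suc k) = ≤-trans (≤-reflexive (reflexive (≡.cong at (ℕ.+-suc m k))))
      (≤-trans (diff-≤ (≤⇒0≤ (halving k))
        (solve 3 (λ s a b → s :+ ♯ 2 :* a :- (s :+ a :+ ♯ 2 :* b) := a :- ♯ 2 :* b) refl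
          (Σ< (m ℕ.+ k) f) (f (m ℕ.+ k)) (f (suc (m ℕ.+ k))))) (go k))

  ^[]-halving : ∀ x m → 0# ≤ x → fromℕ 2 * x ≤ fromℕ (suc m) →
                ∀ k → fromℕ 2 * x ^[ suc (m ℕ.+ k) ] ≤ x ^[ m ℕ.+ k ]
  ^[]-halving x m 0≤x 2x≤m k = *-cancel-≤ (0<fromℕ (suc n))
    (≤-trans (≤-reflexive (trans
        (solve 2 (λ s q → s :* (♯ 2 :* q) := ♯ 2 :* (s :* q)) refl (fromℕ (suc n)) (x ^[ suc n ]))
        (trans (*-congˡ (^[suc] x n)) (sym (*-assoc _ _ _)))))
      (*-mono-≤ (*-nonNeg (<⇒≤ 0<2) 0≤x) (0≤^[] n 0≤x)
        (≤-trans 2x≤m (fromℕ-mono (ℕ.s≤s (ℕ.m≤m+n m k)))) ≤-refl))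
    where n = m ℕ.+ k

  ^[]-summable : ∀ x → 0# ≤ x → ∃ λ L → (x ^[_]) SumsTo L
  ^[]-summable x 0≤x with archimedean (fromℕ 2 * x)
  ... | m , 2x<m = nonneg-summable _ (λ i → 0≤^[] i 0≤x)
    (geometric-bound m (λ i → 0≤^[] i 0≤x) (^[]-halving x m 0≤x
      (≤-trans (<⇒≤ 2x<m) (fromℕ-mono (ℕ.n≤1+n m)))))

  ∣_∣≤1 : (ℕ → ℝ) → Set
  ∣ c ∣≤1 = ∀ n → ∣ c n ∣≤ 1#

  term-bound : ∀ {c x y} → ∣ c ∣≤1 → ∣ x ∣≤ y → ∀ n → ∣ c n * x ^[ n ] ∣≤ y ^[ n ]
  term-bound {y = y} c≤1 h n = ∣∣≤-resp refl (≤-reflexive (*-identityˡ _))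
    (∣∣≤-* (c≤1 n) (∣^[]∣≤ n h))

  power-series : ∀ {c} → ∣ c ∣≤1 → ∀ x → ∃ λ L → (λ n → c n * x ^[ n ]) SumsTo L
  power-series c≤1 x with abs-bound x
  ... | y , 0≤y , ∣x∣≤y , _ = comparison (term-bound c≤1 ∣x∣≤y) (proj₂ (^[]-summable y 0≤y))

  -- On [-1, 1] the tail is dominated by a geometric series of ratio 1/2.
  power-series-tail : ∀ {c x y L} → ∣ c ∣≤1 → ∣ x ∣≤ y → y ≤ 1# → (λ n → c n * x ^[ n ]) SumsTo L →
                      ∀ m → .{{NonZero m}} → ∣ L - Σ< m (λ n → c n * x ^[ n ]) ∣≤ fromℕ 2 * y ^[ m ]
  power-series-tail {c} {x} {y} {L} c≤1 ∣x∣≤y y≤1 sums m@(suc m′) =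
    ∣∣≤-resp refl tail≤ (tail-bound (term-bound c≤1 ∣x∣≤y) sums sumsE m)
    where
    0≤y : 0# ≤ y
    0≤y = ∣∣≤-0≤ ∣x∣≤y
    E = proj₁ (^[]-summable y 0≤y)
    sumsE = proj₂ (^[]-summable y 0≤y)
    -- Here m ≥ 1 enters: 2y ≤ 2 ≤ m + 1, so each ratio y/(n + 1) with n ≥ m is at most 1/2.
    2y≤1+m : fromℕ 2 * y ≤ fromℕ (suc m)
    2y≤1+m = ≤-trans (*-monoˡ-≤ (fromℕ 2) (<⇒≤ 0<2) y≤1)
      (≤-respˡ (sym (*-identityʳ (fromℕ 2))) (fromℕ-mono {2} {suc m} (ℕ.s≤s (ℕ.s≤s ℕ.z≤n))))
    partial : ∀ N → Σ< N (y ^[_]) ≤ Σ< m (y ^[_]) + fromℕ 2 * y ^[ m ]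
    partial = geometric-bound m (λ i → 0≤^[] i 0≤y) (^[]-halving y m 0≤y 2y≤1+m)
    E≤ : E ≤ Σ< m (y ^[_]) + fromℕ 2 * y ^[ m ]
    E≤ = ⟶-≤ sumsE (⟶-const (Σ< m (y ^[_]) + fromℕ 2 * y ^[ m ])) partial
    tail≤ : E - Σ< m (y ^[_]) ≤ fromℕ 2 * y ^[ m ]
    tail≤ = diff-≤ (≤⇒0≤ E≤)
      (solve 3 (λ e s q → q :- (e :- s) := s :+ q :- e) refl E (Σ< m (y ^[_])) (fromℕ 2 * y ^[ m ]))

  -- The antidiagonal sum over i + j = n; `triangle` is the sum over i + j < N, taken row by row.
  -- Both recurse by dropping row 0.
  diag : ℕ → (ℕ → ℕ → ℝ) → ℝ
  diag zero    f = f 0 0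
  diag (suc n) f = f 0 (suc n) + diag n (f ∘ suc)

  triangle : ℕ → (ℕ → ℕ → ℝ) → ℝ
  triangle zero    f = 0#
  triangle (suc N) f = Σ< (suc N) (f 0) + triangle N (f ∘ suc)

  box : ℕ → ℕ → (ℕ → ℕ → ℝ) → ℝ
  box M N f = Σ< M λ i → Σ< N (f i)

  triangle-suc : ∀ N f → triangle (suc N) f ≈ triangle N f + diag N f
  triangle-suc zero    f = solve 1 (λ a → ♯ 0 :+ a :+ ♯ 0 := ♯ 0 :+ a) refl (f 0 0)
  triangle-suc (suc N) f = trans (+-congˡ (triangle-suc N (f ∘ suc)))
    (solve 5 (λ s a b t d → s :+ a :+ b :+ (t :+ d) := s :+ a :+ t :+ (b :+ d)) refl
      (Σ< N (f 0)) (f 0 N) (f 0 (suc N)) (triangle N (f ∘ suc)) (diag N (f ∘ suc)))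

  Σdiag≈triangle : ∀ N f → Σ< N (λ n → diag n f) ≈ triangle N f
  Σdiag≈triangle zero    f = refl
  Σdiag≈triangle (suc N) f = trans (+-congʳ (Σdiag≈triangle N f)) (sym (triangle-suc N f))

  ∣Σ-Σ∣≤ : ∀ {f g m N} → (∀ i → ∣ f i ∣≤ g i) → m ℕ.≤ N → ∣ Σ< N f - Σ< m f ∣≤ Σ< N g - Σ< m g
  ∣Σ-Σ∣≤ {f} {g} {m} {N} f≤g m≤N = ∣∣≤-resp (sym (diff f)) (≤-reflexive (sym (diff g)))
    (∣Σ∣≤ (N ℕ.∸ m) λ i → f≤g (m ℕ.+ i))
    where
    diff : ∀ h → Σ< N h - Σ< m h ≈ Σ< (N ℕ.∸ m) (λ i → h (m ℕ.+ i))
    diff h = trans (+-congʳ (trans (reflexive (≡.cong (λ k → Σ< k h) (≡.sym (ℕ.m+[n∸m]≡n m≤N))))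
                                   (Σ-split m (N ℕ.∸ m) h)))
      (solve 2 (λ a b → a :+ b :- a := b) refl (Σ< m h) (Σ< (N ℕ.∸ m) (λ i → h (m ℕ.+ i))))

  -- The rectangle M × N is there for the induction: dropping row 0 shortens the triangle but leaves
  -- the width N of the box unchanged.
  ∣box-triangle∣≤ : ∀ M {N f g} → (∀ i j → ∣ f i j ∣≤ g i j) → M ℕ.≤ N →
                    ∣ box M N f - triangle M f ∣≤ box M N g - triangle M g
  ∣box-triangle∣≤ zero    f≤g M≤N = ∣∣≤-resp (sym (-‿inverseʳ 0#))
    (≤-reflexive (sym (-‿inverseʳ 0#))) (0≤⇒∣∣≤ ≤-refl)
  ∣box-triangle∣≤ (suc M) {N} {f} {g} f≤g M<N = ∣∣≤-resp (sym (split f))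
    (≤-reflexive (sym (split g)))
    (∣∣≤-+ (∣Σ-Σ∣≤ (f≤g 0) M<N) (∣box-triangle∣≤ M (λ i → f≤g (suc i)) (ℕ.<⇒≤ M<N)))
    where
    split : ∀ h → box (suc M) N h - triangle (suc M) h ≈
                  Σ< N (h 0) - Σ< (suc M) (h 0) + (box M N (h ∘ suc) - triangle M (h ∘ suc))
    split h = trans (+-congʳ (Σ-front M (λ i → Σ< N (h i))))
      (solve 4 (λ a b c d → a :+ b :- (c :+ d) := a :- c :+ (b :- d)) refl
        (Σ< N (h 0)) (box M N (h ∘ suc)) (Σ< (suc M) (h 0)) (triangle M (h ∘ suc)))

  box≤triangle : ∀ M N {g} → (∀ i j → 0# ≤ g i j) → box M N g ≤ triangle (M ℕ.+ N) g
  box≤triangle zero    N       0≤g = 0≤triangle N 0≤g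
    where
    0≤triangle : ∀ N {g} → (∀ i j → 0# ≤ g i j) → 0# ≤ triangle N g
    0≤triangle zero    0≤g = ≤-refl
    0≤triangle (suc N) 0≤g = 0≤+ (0≤Σ (suc N) (0≤g 0)) (0≤triangle N (λ i → 0≤g (suc i)))
  box≤triangle (suc M) N {g} 0≤g = ≤-respˡ (sym (Σ-front M (λ i → Σ< N (g i))))
    (+-mono-≤ (Σ-monoˡ (0≤g 0) (ℕ.m≤n+m N (suc M))) (box≤triangle M N (λ i → 0≤g (suc i))))

  -- Mertens: the box and triangle sums differ by terms with N ≤ i + j ≤ 2N, which a Cauchy tail of
  -- the majorant controls.
  cauchy-product : ∀ {f g L G} → (∀ i j → ∣ f i j ∣≤ g i j) → (λ N → box N N f) ⟶ L →
                   (λ n → diag n g) SumsTo G → (λ n → diag n f) SumsTo L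
  cauchy-product {f} {g} {L} {G} f≤g box⟶L g⇒G = ⟶-cong
    (λ N → trans (solve 2 (λ b t → b :- (b :- t) := t) refl (box N N f) (triangle N f))
      (sym (Σdiag≈triangle N f)))
    (solve 1 (λ l → l :- ♯ 0 := l) refl L)
    (⟶-minus box⟶L (⟶-squeeze
      (⟶-cong (λ _ → refl) (-‿inverseʳ G)
        (⟶-minus (⟶-∘ (λ N → N ℕ.+ N) (λ N → ℕ.m≤m+n N N) tri⟶G) tri⟶G))
      λ N → ∣∣≤-resp refl (+-monoˡ-≤ _ (box≤triangle N N λ i j → ∣∣≤-0≤ (f≤g i j)))
        (∣box-triangle∣≤ N f≤g ℕ.≤-refl)))
    where
    tri⟶G : (λ N → triangle N g) ⟶ G
    tri⟶G = ⟶-cong (λ N → Σdiag≈triangle N g) refl g⇒G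

  diag-cong : ∀ n {f g} → (∀ i j → i ℕ.+ j ≡ n → f i j ≈ g i j) → diag n f ≈ diag n g
  diag-cong zero    f≈g = f≈g 0 0 ≡.refl
  diag-cong (suc n) f≈g = +-cong (f≈g 0 (suc n) ≡.refl)
    (diag-cong n λ i j eq → f≈g (suc i) j (≡.cong suc eq))

  diag-*ˡ : ∀ n c f → diag n (λ i j → c * f i j) ≈ c * diag n f
  diag-*ˡ zero    c f = refl
  diag-*ˡ (suc n) c f = trans (+-congˡ (diag-*ˡ n c (f ∘ suc))) (sym (distribˡ c _ _))

  diag-+ : ∀ n f g → diag n (λ i j → f i j + g i j) ≈ diag n f + diag n g
  diag-+ zero    f g = refl
  diag-+ (suc n) f g = trans (+-congˡ (diag-+ n (f ∘ suc) (g ∘ suc)))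
    (solve 4 (λ a b c d → a :+ b :+ (c :+ d) := a :+ c :+ (b :+ d)) refl _ _ (diag n (f ∘ suc))
      (diag n (g ∘ suc)))

  diag-back : ∀ n f → diag (suc n) f ≈ diag n (λ i j → f i (suc j)) + f (suc n) 0
  diag-back zero    f = refl
  diag-back (suc n) f = trans (+-congˡ (diag-back n (f ∘ suc))) (sym (+-assoc _ _ _))

  -- The binomial theorem for divided powers. Multiplication by n + 1 = i + j splits the
  -- antidiagonal sum in two; in each half the factor i or j lowers one index and releases an x or a
  -- y.
  ^[]-+ : ∀ n x y → diag n (λ i j → x ^[ i ] * y ^[ j ]) ≈ (x + y) ^[ n ]
  ^[]-+ zero    x y = *-identityˡ 1#
  ^[]-+ (suc n) x y = /-intro (0<fromℕ (suc n)) (begin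
    fromℕ (suc n) * diag (suc n) f
      ≈⟨ diag-*ˡ (suc n) _ f ⟨
    diag (suc n) (λ i j → fromℕ (suc n) * f i j)
      ≈⟨ diag-cong (suc n) (λ i j i+j≡n → trans
        (*-congʳ (trans (reflexive (≡.cong fromℕ (≡.sym i+j≡n))) (fromℕ-+ i j)))
        (distribʳ (f i j) _ _)) ⟩
    diag (suc n) (λ i j → fromℕ i * f i j + fromℕ j * f i j)
      ≈⟨ diag-+ (suc n) (λ i j → fromℕ i * f i j) (λ i j → fromℕ j * f i j) ⟩
    diag (suc n) (λ i j → fromℕ i * f i j) + diag (suc n) (λ i j → fromℕ j * f i j)
      ≈⟨ +-cong
           (trans (+-cong (zeroˡ _) (diag-cong n λ i j _ → trans (sym (*-assoc _ _ _))
             (trans (*-congʳ (^[suc] x i)) (*-assoc _ _ _))))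
                  (+-identityˡ _))
           (trans (diag-back n (λ i j → fromℕ j * f i j)) (trans (+-cong (diag-cong n λ i j _ →
               trans (solve 3 (λ s p q → s :* (p :* q) := p :* (s :* q)) refl (fromℕ (suc j))
                 (x ^[ i ]) (y ^[ suc j ]))
               (trans (*-congˡ (^[suc] y j)) (solve 3 (λ p y q → p :* (y :* q) := y :* (p :* q))
                 refl (x ^[ i ]) y (y ^[ j ]))))
             (zeroˡ _)) (+-identityʳ _))) ⟩
    diag n (λ i j → x * f i j) + diag n (λ i j → y * f i j)
      ≈⟨ +-cong (diag-*ˡ n x f) (diag-*ˡ n y f) ⟩
    x * diag n f + y * diag n f
      ≈⟨ distribʳ _ x y ⟨
    (x + y) * diag n f
      ≈⟨ *-congˡ (^[]-+ n x y) ⟩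
    (x + y) * (x + y) ^[ n ] ∎)
    where
    open SetoidReasoning setoid
    f : ℕ → ℕ → ℝ
    f i j = x ^[ i ] * y ^[ j ]

  -- The coefficient c (i + j) is constant on antidiagonals, where the binomial theorem applies. It
  -- applies equally to the majorant `X ^[ i ] * Y ^[ j ]`, whose antidiagonal sums are therefore
  -- summable.
  power-series-+ : ∀ {c x y L} → ∣ c ∣≤1 →
                   (λ N → box N N (λ i j → c (i ℕ.+ j) * (x ^[ i ] * y ^[ j ]))) ⟶ L →
                   (λ n → c n * (x + y) ^[ n ]) SumsTo L
  power-series-+ {c} {x} {y} c≤1 box⟶L with abs-bound x | abs-bound y
  ... | X , 0≤X , ∣x∣≤X , _ | Y , 0≤Y , ∣y∣≤Y , _ = SumsTo-cong
    (λ n → trans (diag-cong n λ i j i+j≡n → *-congʳ (reflexive (≡.cong c i+j≡n)))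
                 (trans (diag-*ˡ n (c n) _) (*-congˡ (^[]-+ n x y))))
    refl
    (cauchy-product
      (λ i j → ∣∣≤-resp refl (≤-reflexive (*-identityˡ _))
        (∣∣≤-* (c≤1 (i ℕ.+ j)) (∣∣≤-* (∣^[]∣≤ i ∣x∣≤X) (∣^[]∣≤ j ∣y∣≤Y))))
      box⟶L
      (SumsTo-cong (λ n → sym (^[]-+ n X Y)) refl (proj₂ (^[]-summable (X + Y) (0≤+ 0≤X 0≤Y)))))

  -- exp, cos and sin

  -- Taylor coefficients, up to the factor 1 / n!, of cos and sin.
  γ σ : ℕ → ℝ
  γ zero    = 1#
  γ (suc n) = - σ n
  σ zero    = 0#
  σ (suc n) = γ n

  ∣γ∣≤1 : ∣ γ ∣≤1
  ∣σ∣≤1 : ∣ σ ∣≤1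
  ∣γ∣≤1 zero    = 0≤⇒∣∣≤ 0≤1
  ∣γ∣≤1 (suc n) = ∣∣≤-neg (∣σ∣≤1 n)
  ∣σ∣≤1 zero    = ∣∣≤-resp refl 0≤1 (0≤⇒∣∣≤ ≤-refl)
  ∣σ∣≤1 (suc n) = ∣γ∣≤1 n

  -- `γ n` and `σ n` are the cosine and sine of n quarter turns. Their addition formulas are the
  -- coefficientwise form of those of cos and sin, and only a Cauchy product separates the two.
  γ-+ : ∀ i j → γ (i ℕ.+ j) ≈ γ i * γ j - σ i * σ j
  σ-+ : ∀ i j → σ (i ℕ.+ j) ≈ σ i * γ j + γ i * σ j
  γ-+ zero    j = solve 2 (λ c s → c := ♯ 1 :* c :- ♯ 0 :* s) refl (γ j) (σ j)
  γ-+ (suc i) j = trans (-‿cong (σ-+ i j))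
    (solve 4 (λ a b c d → :- (b :* c :+ a :* d) := :- b :* c :- a :* d) refl (γ i) (σ i) (γ j)
      (σ j))
  σ-+ zero    j = solve 2 (λ c s → s := ♯ 0 :* c :+ ♯ 1 :* s) refl (γ j) (σ j)
  σ-+ (suc i) j = trans (γ-+ i j)
    (solve 4 (λ a b c d → a :* c :- b :* d := a :* c :+ :- b :* d) refl (γ i) (σ i) (γ j) (σ j))

  -- Says that `γ` vanishes at odd and `σ` at even indices, without a parity split; it makes cos
  -- even and sin odd.
  γ-parity : ∀ n → γ n * (- 1#) ^ n ≈ γ n
  σ-parity : ∀ n → σ n * (- 1#) ^ n ≈ - σ n
  γ-parity zero    = *-identityˡ 1#
  γ-parity (suc n) = trans (solve 2 (λ s e → :- s :* (:- ♯ 1 :* e) := s :* e) refl (σ n)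
    ((- 1#) ^ n)) (σ-parity n)
  σ-parity zero    = solve 0 (♯ 0 :* ♯ 1 := :- ♯ 0) refl
  σ-parity (suc n) = trans (solve 2 (λ s e → s :* (:- ♯ 1 :* e) := :- (s :* e)) refl (γ n)
    ((- 1#) ^ n)) (-‿cong (γ-parity n))

  γσ-even : ∀ n → γ (2 ℕ.* n) ≈ (- 1#) ^ n × σ (2 ℕ.* n) ≈ 0#
  γσ-even zero    = refl , refl
  γσ-even (suc n) with γσ-even n
  ... | γ≈ , σ≈ rewrite ℕ.+-suc n (n ℕ.+ 0) =
    trans (-‿cong γ≈) (sym (RP.-1*x≈-x _)) , trans (-‿cong σ≈) RP.-0#≈0#

  exp-sums : ∀ x → (x ^[_]) SumsTo exp x
  exp-sums x = SumsTo-cong (λ n → refl) (sym exp≈) sums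
    where
    E = proj₁ (power-series {λ _ → 1#} (λ _ → 0≤⇒∣∣≤ 0≤1) x)
    sums : (x ^[_]) SumsTo E
    sums = SumsTo-cong (λ n → *-identityˡ (x ^[ n ])) refl
      (proj₂ (power-series {λ _ → 1#} (λ _ → 0≤⇒∣∣≤ 0≤1) x))
    exp≈ : exp x ≈ E
    exp≈ = series-≈ (SumsTo-cong (λ n → sym (^/!≈^[] x n)) refl sums)

  cos-sums : ∀ x → (λ n → γ n * x ^[ n ]) SumsTo cos x
  cos-sums x = SumsTo-cong (λ _ → refl) (sym cos≈) sums
    where
    sums = proj₂ (power-series ∣γ∣≤1 x)
    f g : ℕ → ℝ
    f n = γ n * x ^[ n ]
    g n = (- 1#) ^ n * x ^ (2 ℕ.* n) / fromℕ ((2 ℕ.* n) !)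
    -- The defining series of cos lists even powers only, so its N-th partial sum is the 2N-th one
    -- of the full series.
    even : ∀ N → Σ< N g ≈ Σ< (2 ℕ.* N) f
    even zero = refl
    even (suc N) = begin
      Σ< N g + g N                                  ≈⟨ +-cong (even N)
        (trans (*-assoc _ _ _) (*-cong (sym (proj₁ (γσ-even N))) (^/!≈^[] x (2 ℕ.* N)))) ⟩
      Σ< (2 ℕ.* N) f + f (2 ℕ.* N)                  ≈⟨ +-identityʳ _ ⟨
      Σ< (2 ℕ.* N) f + f (2 ℕ.* N) + 0#             ≈⟨ +-congˡ
        (trans (*-congʳ (trans (-‿cong (proj₂ (γσ-even N))) RP.-0#≈0#)) (zeroˡ _)) ⟨
      Σ< (suc (suc (2 ℕ.* N))) f                    ≡⟨ ≡.cong (λ k → Σ< k f) (ℕ.*-suc 2 N) ⟨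
      Σ< (2 ℕ.* suc N) f                            ∎
      where open SetoidReasoning setoid
    cos≈ : cos x ≈ proj₁ (power-series ∣γ∣≤1 x)
    cos≈ = series-≈ (⟶-cong (λ N → sym (even N)) refl
      (⟶-∘ (2 ℕ.*_) (λ N → ℕ.m≤m+n N (N ℕ.+ 0)) sums))

  abstract
    -- The companion of cos in the addition theorems; `sin-sums` is the only access to its value.
    sin : ℝ → ℝ
    sin x = proj₁ (power-series ∣σ∣≤1 x)

    sin-sums : ∀ x → (λ n → σ n * x ^[ n ]) SumsTo sin x
    sin-sums x = proj₂ (power-series ∣σ∣≤1 x)

  exp-cong : ∀ {x y} → x ≈ y → exp x ≈ exp y
  exp-cong {x} {y} x≈y = ⟶-unique (SumsTo-cong (λ n → ^[]-cong n x≈y) refl (exp-sums x))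
    (exp-sums y)

  cos-cong : ∀ {x y} → x ≈ y → cos x ≈ cos y
  cos-cong {x} {y} x≈y = ⟶-unique (SumsTo-cong (λ n → *-congˡ (^[]-cong n x≈y)) refl (cos-sums x))
    (cos-sums y)

  sin-cong : ∀ {x y} → x ≈ y → sin x ≈ sin y
  sin-cong {x} {y} x≈y = ⟶-unique (SumsTo-cong (λ n → *-congˡ (^[]-cong n x≈y)) refl (sin-sums x))
    (sin-sums y)

  cos-neg : ∀ x → cos (- x) ≈ cos x
  cos-neg x = ⟶-unique (cos-sums (- x)) (SumsTo-cong
    (λ n → trans (*-congʳ (sym (γ-parity n))) (trans (*-assoc _ _ _) (*-congˡ (sym (^[]-neg n x)))))
      refl (cos-sums x))

  sin-neg : ∀ x → sin (- x) ≈ - sin x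
  sin-neg x = ⟶-unique (sin-sums (- x)) (SumsTo-cong
    (λ n → trans (solve 2 (λ s p → :- ♯ 1 :* (s :* p) := :- s :* p) refl (σ n) (x ^[ n ]))
      (trans (*-congʳ (sym (σ-parity n))) (trans (*-assoc _ _ _) (*-congˡ (sym (^[]-neg n x))))))
    (RP.-1*x≈-x _) (SumsTo-*ˡ (- 1#) (sin-sums x)))

  box-products : ∀ M N f g h k → Σ< M f * Σ< N g + Σ< M h * Σ< N k ≈
                 box M N (λ i j → f i * g j + h i * k j)
  box-products M N f g h k = trans (+-cong (Σ-*-Σ M N f g) (Σ-*-Σ M N h k))
    (trans (sym (Σ-+ M _ _)) (Σ-cong M λ i → sym (Σ-+ N _ _)))

  exp-+ : ∀ x y → exp (x + y) ≈ exp x * exp y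
  exp-+ x y = ⟶-unique (exp-sums (x + y)) (SumsTo-cong (λ _ → *-identityˡ _) refl
    (power-series-+ {λ _ → 1#} (λ _ → 0≤⇒∣∣≤ 0≤1) (⟶-cong
      (λ N → trans (Σ-*-Σ N N (x ^[_]) (y ^[_]))
        (Σ-cong N λ i → Σ-cong N λ j → sym (*-identityˡ _))) refl
      (⟶-* (exp-sums x) (exp-sums y)))))

  cos-+ : ∀ x y → cos (x + y) ≈ cos x * cos y - sin x * sin y
  cos-+ x y = ⟶-unique (cos-sums (x + y)) (power-series-+ ∣γ∣≤1 (⟶-cong
    (λ N → trans (box-products N N (λ n → γ n * x ^[ n ]) (λ n → γ n * y ^[ n ])
      (λ n → - 1# * (σ n * x ^[ n ])) (λ n → σ n * y ^[ n ]))
      (Σ-cong N λ i → Σ-cong N λ j →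
        trans (solve 6 (λ a b c d p q → a :* p :* (c :* q) :+ :- ♯ 1 :* (b :* p) :* (d :* q) :=
          (a :* c :- b :* d) :* (p :* q)) refl
                (γ i) (σ i) (γ j) (σ j) (x ^[ i ]) (y ^[ j ]))
              (*-congʳ (sym (γ-+ i j)))))
    (+-congˡ (solve 2 (λ a b → :- ♯ 1 :* a :* b := :- (a :* b)) refl (sin x) (sin y)))
    (⟶-+ (⟶-* (cos-sums x) (cos-sums y)) (⟶-* (SumsTo-*ˡ (- 1#) (sin-sums x)) (sin-sums y)))))

  sin-+ : ∀ x y → sin (x + y) ≈ sin x * cos y + cos x * sin y
  sin-+ x y = ⟶-unique (sin-sums (x + y)) (power-series-+ ∣σ∣≤1 (⟶-cong
    (λ N → trans (box-products N N (λ n → σ n * x ^[ n ]) (λ n → γ n * y ^[ n ])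
      (λ n → γ n * x ^[ n ]) (λ n → σ n * y ^[ n ]))
      (Σ-cong N λ i → Σ-cong N λ j →
        trans (solve 6 (λ a b c d p q → b :* p :* (c :* q) :+ a :* p :* (d :* q) :=
          (b :* c :+ a :* d) :* (p :* q)) refl
                (γ i) (σ i) (γ j) (σ j) (x ^[ i ]) (y ^[ j ]))
              (*-congʳ (sym (σ-+ i j)))))
    refl
    (⟶-+ (⟶-* (sin-sums x) (cos-sums y)) (⟶-* (cos-sums x) (sin-sums y)))))

  ^[1] : ∀ y → y ^[ 1 ] ≈ y
  ^[1] y = trans (solve 1 (λ a → a := (♯ 1 :+ ♯ 0) :* a) refl (y ^[ 1 ]))
    (trans (^[suc] y 0) (*-identityʳ y))

  ^[2] : ∀ y → fromℕ 2 * y ^[ 2 ] ≈ y * y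
  ^[2] y = trans (^[suc] y 1) (*-congˡ (^[1] y))

  ^[3] : ∀ y → fromℕ 3 * (fromℕ 2 * y ^[ 3 ]) ≈ y * y * y
  ^[3] y = trans (solve 1 (λ a → ♯ 3 :* (♯ 2 :* a) := ♯ 2 :* (♯ 3 :* a)) refl (y ^[ 3 ]))
    (trans (*-congˡ (^[suc] y 2)) (trans
      (solve 2 (λ y a → ♯ 2 :* (y :* a) := y :* (♯ 2 :* a)) refl y (y ^[ 2 ]))
    (trans (*-congˡ (^[2] y)) (sym (*-assoc y y y)))))

  -- The tail after two terms, the second of which is zero: its bound is 2 y²/2! = y². For sin the
  -- next lemma cuts after three terms and gets 2 y³/3!.
  ∣cos-1∣≤ : ∀ {x y} → ∣ x ∣≤ y → y ≤ 1# → ∣ cos x - 1# ∣≤ y * y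
  ∣cos-1∣≤ {x} {y} ∣x∣≤y y≤1 = ∣∣≤-resp
    (solve 2 (λ c p → c :- (♯ 0 :+ ♯ 1 :* ♯ 1 :+ :- ♯ 0 :* p) := c :- ♯ 1) refl (cos x) (x ^[ 1 ]))
    (≤-reflexive (^[2] y))
    (power-series-tail ∣γ∣≤1 ∣x∣≤y y≤1 (cos-sums x) 2)

  ∣sin-x∣≤ : ∀ {x y} → ∣ x ∣≤ y → y ≤ 1# → ∣ sin x - x ∣≤ fromℕ 2 * y ^[ 3 ]
  ∣sin-x∣≤ {x} {y} ∣x∣≤y y≤1 = ∣∣≤-resp
    (trans (solve 3 (λ s p q → s :- (♯ 0 :+ ♯ 0 :* ♯ 1 :+ ♯ 1 :* p :+ :- ♯ 0 :* q) := s :- p) refl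
      (sin x) (x ^[ 1 ]) (x ^[ 2 ]))
           (+-congˡ (-‿cong (^[1] x))))
    ≤-refl
    (power-series-tail ∣σ∣≤1 ∣x∣≤y y≤1 (sin-sums x) 3)

  cube≤ : ∀ {y} → 0# ≤ y → y ≤ 1# → y * y * y ≤ y
  cube≤ {y} 0≤y y≤1 = ≤-trans
    (*-mono-≤ (0≤sq y) 0≤y (≤-trans (*-mono-≤ 0≤y 0≤y y≤1 y≤1) (≤-reflexive (*-identityˡ 1#)))
      ≤-refl)
    (≤-reflexive (*-identityˡ y))

  0<3 : 0# < fromℕ 3
  0<3 = 0<fromℕ 3

  ∣sin∣≤2y : ∀ {x y} → ∣ x ∣≤ y → y ≤ 1# → ∣ sin x ∣≤ fromℕ 2 * y
  ∣sin∣≤2y {x} {y} ∣x∣≤y y≤1 = ∣∣≤-resp (solve 2 (λ s x → s :- x :+ x := s) refl (sin x) x)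
    (diff-≤ (≤⇒0≤ b≤y) (solve 2 (λ b y → ♯ 2 :* y :- (b :+ y) := y :- b) refl (fromℕ 2 * y ^[ 3 ])
      y))
    (∣∣≤-+ (∣sin-x∣≤ ∣x∣≤y y≤1) ∣x∣≤y)
    where
    0≤y = ∣∣≤-0≤ ∣x∣≤y
    b≤y : fromℕ 2 * y ^[ 3 ] ≤ y
    b≤y = *-cancel-≤ 0<3 (≤-respˡ (sym (^[3] y)) (≤-trans (cube≤ 0≤y y≤1)
      (diff-≤ (*-nonNeg (<⇒≤ 0<2) 0≤y) (solve 1 (λ y → ♯ 3 :* y :- y := ♯ 2 :* y) refl y))))

  -- The tail bound gives 3 sin x ≥ 3x - x³ ≥ 2x on (0, 1].
  0<sin-small : ∀ {x} → 0# < x → x ≤ 1# → 0# < sin x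
  0<sin-small {x} 0<x x≤1 = *-cancel-0< 0<3 (<-≤-trans (0<* 0<2 0<x)
    (diff-≤ (0≤+ (*-nonNeg (<⇒≤ 0<3) (≤⇒0≤ (proj₁ (∣sin-x∣≤ (0≤⇒∣∣≤ 0≤x) x≤1))))
      (≤⇒0≤ (≤-respˡ (sym (^[3] x)) (cube≤ 0≤x x≤1))))
      (solve 3 (λ s x b → ♯ 3 :* s :- ♯ 2 :* x := ♯ 3 :* (s :- x :- :- b) :+ (x :- ♯ 3 :* b)) refl
        (sin x) x (fromℕ 2 * x ^[ 3 ]))))
    where 0≤x = <⇒≤ 0<x

  ∣∣≤0⇒≈0 : ∀ {x b} → ∣ x ∣≤ b → b ≈ 0# → x ≈ 0#
  ∣∣≤0⇒≈0 (l , u) b≈0 = ≤-antisym (≤-respʳ b≈0 u) (≤-respˡ (trans (-‿cong b≈0) RP.-0#≈0#) l)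

  cos-0 : cos 0# ≈ 1#
  cos-0 = trans (solve 1 (λ c → c := c :- ♯ 1 :+ ♯ 1) refl (cos 0#))
    (trans (+-congʳ (∣∣≤0⇒≈0 (∣cos-1∣≤ (0≤⇒∣∣≤ ≤-refl) 0≤1) (zeroˡ 0#))) (+-identityˡ 1#))

  sin-0 : sin 0# ≈ 0#
  sin-0 = ∣∣≤0⇒≈0 (∣sin∣≤2y (0≤⇒∣∣≤ ≤-refl) 0≤1) (zeroʳ _)

  pythagoras : ∀ x → cos x * cos x + sin x * sin x ≈ 1#
  pythagoras x = begin
    cos x * cos x + sin x * sin x          ≈⟨ solve 2
      (λ c s → c :* c :+ s :* s := c :* c :- s :* :- s) refl (cos x) (sin x) ⟩
    cos x * cos x - sin x * - sin x        ≈⟨ +-cong (*-congˡ (cos-neg x))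
      (-‿cong (*-congˡ (sin-neg x))) ⟨
    cos x * cos (- x) - sin x * sin (- x)  ≈⟨ cos-+ x (- x) ⟨
    cos (x - x)                            ≈⟨ cos-cong (-‿inverseʳ x) ⟩
    cos 0#                                 ≈⟨ cos-0 ⟩
    1#                                     ∎
    where open SetoidReasoning setoid

  ∣cos∣≤1 : ∀ x → ∣ cos x ∣≤ 1#
  ∣cos∣≤1 x = sq≤⇒∣∣≤ 0≤1 (diff-≤ (0≤sq (sin x))
    (trans (+-congʳ (trans (*-identityˡ 1#) (sym (pythagoras x))))
    (solve 2 (λ c s → c :* c :+ s :* s :- c :* c := s :* s) refl (cos x) (sin x))))

  ∣sin∣≤1 : ∀ x → ∣ sin x ∣≤ 1#
  ∣sin∣≤1 x = sq≤⇒∣∣≤ 0≤1 (diff-≤ (0≤sq (cos x))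
    (trans (+-congʳ (trans (*-identityˡ 1#) (sym (pythagoras x))))
    (solve 2 (λ c s → c :* c :+ s :* s :- s :* s := c :* c) refl (cos x) (sin x))))

  exp-0 : exp 0# ≈ 1#
  exp-0 = ⟶-unique (exp-sums 0#) (⟶-intro λ ε 0<ε → 1 , λ { (suc N) _ →
    ∣∣≤-resp (sym (trans (+-congʳ (partial N)) (-‿inverseʳ 1#))) (<⇒≤ 0<ε) (0≤⇒∣∣≤ ≤-refl) })
    where
    partial : ∀ N → Σ< (suc N) (0# ^[_]) ≈ 1#
    partial zero    = +-identityˡ 1#
    partial (suc N) = trans (+-cong (partial N) (trans (*-congʳ (zeroˡ _)) (zeroˡ _)))
      (+-identityʳ 1#)

  1+x≤exp : ∀ {x} → 0# ≤ x → 1# + x ≤ exp x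
  1+x≤exp {x} 0≤x = ≤-respˡ (+-cong (+-identityˡ 1#) (^[1] x))
    (partial≤ (λ i → 0≤^[] i 0≤x) (exp-sums x) 2)

  exp-inverse : ∀ x → exp x * exp (- x) ≈ 1#
  exp-inverse x = trans (sym (exp-+ x (- x))) (trans (exp-cong (-‿inverseʳ x)) exp-0)

  1≤exp : ∀ {x} → 0# ≤ x → 1# ≤ exp x
  1≤exp {x} 0≤x = ≤-trans (diff-≤ 0≤x (solve 1 (λ x → ♯ 1 :+ x :- ♯ 1 := x) refl x)) (1+x≤exp 0≤x)

  0<exp : ∀ x → 0# < exp x
  0<exp x with ≤-total 0# x
  ... | inj₁ 0≤x = <-≤-trans 0<1 (1≤exp 0≤x)
  ... | inj₂ x≤0 = *-cancel-0< (<-≤-trans 0<1 (1≤exp (≤-respʳ (+-identityˡ (- x)) (≤⇒0≤ x≤0))))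
                   (<-respʳ (sym (trans (*-comm _ _) (exp-inverse x))) 0<1)

  exp-mono : ∀ {x y} → x ≤ y → exp x ≤ exp y
  exp-mono {x} {y} x≤y = ≤-respˡ (*-identityʳ _) (≤-respʳ
    (trans (sym (exp-+ x (y - x))) (exp-cong (solve 2 (λ x y → x :+ (y :- x) := y) refl x y)))
    (*-monoˡ-≤ (exp x) (<⇒≤ (0<exp x)) (1≤exp (≤⇒0≤ x≤y))))

  *exp-neg≤1 : ∀ {y} → 0# ≤ y → y * exp (- y) ≤ 1#
  *exp-neg≤1 {y} 0≤y = ≤-respʳ (exp-inverse y)
    (*-mono-≤ 0≤y (<⇒≤ (0<exp (- y)))
      (≤-trans (diff-≤ 0≤1 (solve 1 (λ y → ♯ 1 :+ y :- y := ♯ 1) refl y)) (1+x≤exp 0≤y)) ≤-refl)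

  -- The number π

  -- Continuity of cos: the difference is cos x (cos h - 1) - sin x sin h, at most y² + 2y ≤ 3y.
  ∣cos-cos∣≤ : ∀ x {h y} → ∣ h ∣≤ y → y ≤ 1# → ∣ cos (x + h) - cos x ∣≤ fromℕ 3 * y
  ∣cos-cos∣≤ x {h} {y} ∣h∣≤y y≤1 = ∣∣≤-resp
    (trans (solve 4 (λ c s a b → c :* (a :- ♯ 1) :+ :- (s :* b) := c :* a :- s :* b :- c) refl
      (cos x) (sin x) (cos h) (sin h))
           (+-congʳ (sym (cos-+ x h))))
    (≤-trans (+-mono-≤ (≤-respˡ (sym (*-identityˡ _))
      (≤-respʳ (*-identityˡ y) (*-mono-≤ 0≤y 0≤y y≤1 ≤-refl))) (≤-reflexive (*-identityˡ _)))
             (≤-reflexive (solve 1 (λ y → y :+ ♯ 2 :* y := ♯ 3 :* y) refl y)))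
    (∣∣≤-+ (∣∣≤-* (∣cos∣≤1 x) (∣cos-1∣≤ ∣h∣≤y y≤1))
      (∣∣≤-neg (∣∣≤-* (∣sin∣≤1 x) (∣sin∣≤2y ∣h∣≤y y≤1))))
    where 0≤y = ∣∣≤-0≤ ∣h∣≤y

  min-pos : ∀ {x y} → 0# < x → 0# < y → ∃ λ z → 0# < z × z ≤ x × z ≤ y
  min-pos {x} {y} 0<x 0<y with ≤-total x y
  ... | inj₁ x≤y = x , 0<x , ≤-refl , x≤y
  ... | inj₂ y≤x = y , 0<y , y≤x , ≤-refl

  cos-near : ∀ x {c} → 0# < c → ∃ λ y → 0# < y ×
    (∀ h → ∣ h ∣≤ y → cos x - c < cos (x + h) × cos (x + h) < cos x + c)
  cos-near x {c} 0<c = y , 0<y , near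
    where
    m = min-pos (0</ (0<half 0<c) 0<3) 0<1
    y = proj₁ m
    0<y = proj₁ (proj₂ m)
    3y≤c/2 : fromℕ 3 * y ≤ half c
    3y≤c/2 = ≤-respʳ (*-/-cancel (half c) 0<3)
      (*-monoˡ-≤ (fromℕ 3) (<⇒≤ 0<3) (proj₁ (proj₂ (proj₂ m))))
    near : ∀ h → ∣ h ∣≤ y → cos x - c < cos (x + h) × cos (x + h) < cos x + c
    near h ∣h∣≤y =
      diff-< (0≤+0< (≤⇒0≤ (proj₁ bound)) (<⇒0< (half<self 0<c)))
        (solve 4 (λ a b c d → b :- (a :- c) := b :- a :- :- d :+ (c :- d)) refl (cos x)
          (cos (x + h)) c (half c)) ,
      diff-< (0≤+0< (≤⇒0≤ (proj₂ bound)) (<⇒0< (half<self 0<c)))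
        (solve 4 (λ a b c d → a :+ c :- b := d :- (b :- a) :+ (c :- d)) refl (cos x) (cos (x + h)) c
          (half c))
      where
      bound : ∣ cos (x + h) - cos x ∣≤ half c
      bound = ∣∣≤-resp refl 3y≤c/2 (∣cos-cos∣≤ x ∣h∣≤y (proj₂ (proj₂ (proj₂ m))))

  cos-double : ∀ x → cos (x + x) ≈ fromℕ 2 * (cos x * cos x) - 1#
  cos-double x = trans (cos-+ x x) (trans
    (solve 2 (λ c s → c :* c :- s :* s := ♯ 2 :* (c :* c) :- (c :* c :+ s :* s)) refl (cos x)
      (sin x))
    (+-congˡ (-‿cong (pythagoras x))))

  -- The tail estimate reaches only up to 1, so cos 1 is bounded first: it is 1 - 1/2 up to 2/4! =
  -- 1/12, hence |cos 1| ≤ 7/12. Doubling gives cos 2 ≤ 2 · 49/144 - 1 = -23/72.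
  cos2<0 : cos (1# + 1#) < 0#
  cos2<0 = diff-< (*-cancel-0< (0<fromℕ 72) (<-≤-trans (0<fromℕ 23) (diff-≤ (≤⇒0≤ 144c²≤49)
      (solve 1 (λ c → ♯ 72 :* (♯ 1 :- ♯ 2 :* (c :* c)) :- ♯ 23 := ♯ 7 :* ♯ 7 :- (♯ 12 :* c) :*
        (♯ 12 :* c)) refl c))))
    (trans (+-congˡ (-‿cong (cos-double 1#)))
      (solve 1 (λ c → ♯ 0 :- (♯ 2 :* (c :* c) :- ♯ 1) := ♯ 1 :- ♯ 2 :* (c :* c)) refl c))
    where
    c = cos 1#
    q r : ℝ
    q = 1# ^[ 2 ]
    r = 1# ^[ 4 ]
    2q≈1 : fromℕ 2 * q ≈ 1#
    2q≈1 = trans (^[2] 1#) (*-identityˡ 1#)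
    24r≈1 : fromℕ 24 * r ≈ 1#
    24r≈1 = trans (solve 1 (λ r → ♯ 24 :* r := ♯ 6 :* (♯ 4 :* r)) refl r)
      (trans (*-congˡ (^[suc] 1# 3))
        (trans (solve 1 (λ p → ♯ 6 :* (♯ 1 :* p) := ♯ 3 :* (♯ 2 :* p)) refl (1# ^[ 3 ]))
      (trans (^[3] 1#) (solve 0 (♯ 1 :* ♯ 1 :* ♯ 1 := ♯ 1) refl))))
    c-1+q : ∣ c - (1# - q) ∣≤ fromℕ 2 * r
    c-1+q = ∣∣≤-resp
      (solve 4 (λ c p q s → c :- (♯ 0 :+ ♯ 1 :* ♯ 1 :+ :- ♯ 0 :* p :+ :- ♯ 1 :* q :+ :- :- ♯ 0 :*
        s) := c :- (♯ 1 :- q)) refl c (1# ^[ 1 ]) q (1# ^[ 3 ]))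
      ≤-refl (power-series-tail ∣γ∣≤1 (0≤⇒∣∣≤ 0≤1) ≤-refl (cos-sums 1#) 4)
    12c : ∣ fromℕ 12 * (c - (1# - q)) + fromℕ 6 ∣≤ 1# + fromℕ 6
    12c = ∣∣≤-+ (∣∣≤-resp refl (≤-reflexive
      (trans (solve 1 (λ r → ♯ 12 :* (♯ 2 :* r) := ♯ 24 :* r) refl r) 24r≈1))
      (∣∣≤-* (0≤⇒∣∣≤ (0≤fromℕ 12)) c-1+q)) (0≤⇒∣∣≤ (0≤fromℕ 6))
    ∣12c∣≤7 : ∣ fromℕ 12 * c ∣≤ fromℕ 7
    ∣12c∣≤7 = ∣∣≤-resp
      (trans (solve 2 (λ c q → ♯ 12 :* (c :- (♯ 1 :- q)) :+ ♯ 6 := ♯ 12 :* c :+ ♯ 6 :*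
        (♯ 2 :* q :- ♯ 1)) refl c q)
        (trans (+-congˡ (*-congˡ (trans (+-congʳ 2q≈1) (-‿inverseʳ 1#))))
          (solve 1 (λ c → ♯ 12 :* c :+ ♯ 6 :* ♯ 0 := ♯ 12 :* c) refl c)))
      ≤-refl 12c
    144c²≤49 : (fromℕ 12 * c) * (fromℕ 12 * c) ≤ fromℕ 7 * fromℕ 7
    144c²≤49 = proj₂ (∣∣≤-* ∣12c∣≤7 ∣12c∣≤7)

  -- Positivity on [0, s) yields leastness of the zero and is also what `0<sin` uses. The bound by 2
  -- keeps a quarter of any angle below π within range of `0<sin-small`.
  record IsHalfπ (s : ℝ) : Set where
    field
      positive : 0# < s
      ≤2       : s ≤ 1# + 1#
      cos≈0    : cos s ≈ 0#
      0<cos    : ∀ {q} → 0# ≤ q → q < s → 0# < cos q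

  halfπ-exists : ∃ IsHalfπ
  halfπ-exists = s , record { positive = 0<s ; ≤2 = s≤2 ; cos≈0 = cos≈0 ; 0<cos = before }
    where
    P : ℝ → Set
    -- Positivity is required on all of [0, x], not only at x, so that cos is positive everywhere
    -- before the supremum.
    P x = 0# ≤ x × (∀ q → 0# ≤ q → q ≤ x → 0# < cos q)
    P0 : P 0#
    P0 = ≤-refl , λ q 0≤q q≤0 → <-respʳ (trans (sym cos-0) (cos-cong (≤-antisym 0≤q q≤0))) 0<1
    ub2 : UpperBound P (1# + 1#)
    ub2 x (0≤x , pos) = ≮⇒≥ λ 2<x → <⇒≱ (pos (1# + 1#) (0≤+ 0≤1 0≤1) (<⇒≤ 2<x)) (<⇒≤ cos2<0)
    sup = complete P (0# , P0) (1# + 1# , ub2)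
    s = proj₁ sup
    upper = proj₁ (proj₂ sup)
    least = proj₂ (proj₂ sup)
    s≤2 : s ≤ 1# + 1#
    s≤2 = least (1# + 1#) ub2
    0≤s : 0# ≤ s
    0≤s = upper 0# P0
    before : ∀ {q} → 0# ≤ q → q < s → 0# < cos q
    before {q} 0≤q q<s = [ (λ cos≤0 → ⊥-elim (<⇒≱ q<s (least q λ x (0≤x , pos) →
      ≮⇒≥ λ q<x → <⇒≱ (pos q 0≤q (<⇒≤ q<x)) cos≤0))) , (λ 0<c → 0<c) ]′ (≤⊎> (cos q) 0#)
    -- Otherwise continuity keeps cos positive up to s + y, past the supremum.
    ¬0<cos : ¬ 0# < cos s
    ¬0<cos 0<c = <⇒≱ (diff-< 0<y (solve 2 (λ s y → s :+ y :- s := y) refl s y))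
      (upper (s + y) (0≤+ 0≤s (<⇒≤ 0<y) , pos))
      where
      near = cos-near s 0<c
      y = proj₁ near
      0<y = proj₁ (proj₂ near)
      pos : ∀ q → 0# ≤ q → q ≤ s + y → 0# < cos q
      pos q 0≤q q≤s+y = [ (λ s≤q → <-respʳ
        (cos-cong (solve 2 (λ s q → s :+ (q :- s) := q) refl s q))
          (<-respˡ (-‿inverseʳ (cos s)) (proj₁ (proj₂ (proj₂ near) (q - s)
            (∣∣≤-resp refl (diff-≤ (≤⇒0≤ q≤s+y)
              (solve 3 (λ q s y → y :- (q :- s) := s :+ y :- q) refl q s y))
              (0≤⇒∣∣≤ (≤⇒0≤ s≤q)))))))
        , before 0≤q ]′ (≤⊎> s q)
    -- Otherwise cos is negative on all of [s - y, s], although it is positive before s; if s < y,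
    -- this interval contains 0, where cos is 1.
    ¬cos<0 : ¬ cos s < 0#
    ¬cos<0 c<0 = <⇒≱ c<0 (≮⇒≥ λ _ → contra)
      where
      near = cos-near s (<⇒0< c<0)
      y = proj₁ near
      0<y = proj₁ (proj₂ near)
      neg : ∀ q → ∣ q - s ∣≤ y → cos q < 0#
      neg q h = <-respˡ (cos-cong (solve 2 (λ s q → s :+ (q :- s) := q) refl s q))
        (<-respʳ (solve 1 (λ c → c :+ (♯ 0 :- c) := ♯ 0) refl (cos s))
          (proj₂ (proj₂ (proj₂ near) (q - s) h)))
      contra : ⊥
      contra = [ (λ y≤s → <⇒≱ (neg (s - y)
        (∣∣≤-resp (solve 2 (λ s y → :- y := s :- y :- s) refl s y) ≤-refl
        (∣∣≤-neg (0≤⇒∣∣≤ (<⇒≤ 0<y)))))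
            (<⇒≤ (before (≤⇒0≤ y≤s) (diff-< 0<y (solve 2 (λ s y → s :- (s :- y) := y) refl s y)))))
        , (λ s<y → <⇒≱ (neg 0# (∣∣≤-resp (sym (+-identityˡ (- s))) (<⇒≤ s<y)
          (∣∣≤-neg (0≤⇒∣∣≤ 0≤s))))
            (≤-respʳ (sym cos-0) 0≤1)) ]′ (≤⊎> y s)
    cos≈0 : cos s ≈ 0#
    cos≈0 = ≤-antisym (≮⇒≥ ¬0<cos) (≮⇒≥ ¬cos<0)
    0<s : 0# < s
    0<s = 0≤s , λ 0≈s → 0≉1 (trans (sym cos≈0) (trans (cos-cong (sym 0≈s)) cos-0))

  abstract
    halfπ : ℝ
    halfπ = proj₁ halfπ-exists

    isHalfπ : IsHalfπ halfπ
    isHalfπ = proj₂ halfπ-exists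

  open IsHalfπ isHalfπ

  -- Positivity before `halfπ` makes it a least positive zero, and two least positive zeros bound
  -- each other.
  π≈ : π ≈ fromℕ 2 * halfπ
  π≈ = *-congˡ (the-≈ (positive , cos≈0 , least) λ y (0<y , cosy≈0 , y-least) →
    ≤-antisym (y-least halfπ positive cos≈0) (least y 0<y cosy≈0))
    where
    least : ∀ q → 0# < q → cos q ≈ 0# → halfπ ≤ q
    least q 0<q cosq≈0 = ≮⇒≥ λ q<s → proj₂ (0<cos (<⇒≤ 0<q) q<s) (sym cosq≈0)

  0<π : 0# < π
  0<π = <-respʳ (sym π≈) (0<* 0<2 positive)

  sin-double : ∀ x → sin (x + x) ≈ fromℕ 2 * (sin x * cos x)
  sin-double x = trans (sin-+ x x)
    (solve 2 (λ s c → s :* c :+ c :* s := ♯ 2 :* (s :* c)) refl (sin x) (cos x))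

  π≈+ : π ≈ halfπ + halfπ
  π≈+ = trans π≈ (solve 1 (λ h → ♯ 2 :* h := h :+ h) refl halfπ)

  half< : ∀ {x y} → x < y + y → half x < y
  half< {x} {y} x<2y = diff-< (0<half (<⇒0< x<2y)) (trans (+-congʳ (sym (half+half y)))
    (solve 3 (λ x y i → y :* i :+ y :* i :- x :* i := (y :+ y :- x) :* i) refl x y (fromℕ 2 ⁻¹)))

  -- The double-angle formula is used twice, down to x/4 < 1, where the small-angle estimate holds;
  -- the cosines that appear are taken before `halfπ`.
  0<sin : ∀ {x} → 0# < x → x < π → 0# < sin x
  0<sin {x} 0<x x<π = <-respʳ (trans (sym (sin-double h)) (sin-cong (half+half x)))
    (0<* 0<2 (0<* 0<sin-h (0<cos (<⇒≤ 0<h) h<halfπ)))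
    where
    h = half x
    0<h = 0<half 0<x
    h<halfπ : h < halfπ
    h<halfπ = half< (<-respʳ π≈+ x<π)
    h/2<1 : half h < 1#
    h/2<1 = half< (<-≤-trans h<halfπ ≤2)
    0<sin-h : 0# < sin h
    0<sin-h = <-respʳ (trans (sym (sin-double (half h))) (sin-cong (half+half h)))
      (0<* 0<2 (0<* (0<sin-small (0<half 0<h) (<⇒≤ h/2<1))
                    (0<cos (<⇒≤ (0<half 0<h)) (<-trans (half<self 0<h) h<halfπ))))

  sinπ : sin π ≈ 0#
  sinπ = trans (sin-cong π≈+) (trans (sin-double halfπ)
    (trans (*-congˡ (trans (*-congˡ cos≈0) (zeroʳ _))) (zeroʳ _)))

  cosπ : cos π ≈ - 1#
  cosπ = trans (cos-cong π≈+) (trans (cos-double halfπ)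
    (trans (+-congʳ (trans (*-congˡ (trans (*-congˡ cos≈0) (zeroʳ _))) (zeroʳ _))) (+-identityˡ _)))

  2π : ℝ
  2π = fromℕ 2 * π

  2π≈ : 2π ≈ π + π
  2π≈ = solve 1 (λ p → ♯ 2 :* p := p :+ p) refl π

  cos2π : cos 2π ≈ 1#
  cos2π = trans (cos-cong 2π≈) (trans (cos-double π)
    (trans (+-congʳ (*-congˡ (*-cong cosπ cosπ)))
    (solve 0 (♯ 2 :* (:- ♯ 1 :* :- ♯ 1) :- ♯ 1 := ♯ 1) refl)))

  sin2π : sin 2π ≈ 0#
  sin2π = trans (sin-cong 2π≈) (trans (sin-double π)
    (trans (*-congˡ (*-congʳ sinπ)) (solve 1 (λ c → ♯ 2 :* (♯ 0 :* c) := ♯ 0) refl (cos π))))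

  cos-periodic : ∀ x → cos (x + 2π) ≈ cos x
  cos-periodic x = trans (cos-+ x 2π) (trans (+-cong (*-congˡ cos2π) (-‿cong (*-congˡ sin2π)))
    (solve 2 (λ c s → c :* ♯ 1 :- s :* ♯ 0 := c) refl (cos x) (sin x)))

  sin-periodic : ∀ x → sin (x + 2π) ≈ sin x
  sin-periodic x = trans (sin-+ x 2π) (trans (+-cong (*-congˡ cos2π) (*-congˡ sin2π))
    (solve 2 (λ c s → s :* ♯ 1 :+ c :* ♯ 0 := s) refl (cos x) (sin x)))

  periodicℕ : ∀ {f : ℝ → ℝ} {p} → (∀ {x y} → x ≈ y → f x ≈ f y) → (∀ x → f (x + p) ≈ f x) →
              ∀ n x → f (x + fromℕ n * p) ≈ f x
  periodicℕ {p = p} cong-f per zero    x = cong-f (solve 2 (λ x p → x :+ ♯ 0 :* p := x) refl x p)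
  periodicℕ {p = p} cong-f per (suc n) x = trans
    (cong-f (solve 3 (λ x n p → x :+ (♯ 1 :+ n) :* p := x :+ n :* p :+ p) refl x (fromℕ n) p))
    (trans (per (x + fromℕ n * p)) (periodicℕ cong-f per n x))

  periodicℤ : ∀ {f : ℝ → ℝ} {p} → (∀ {x y} → x ≈ y → f x ≈ f y) → (∀ x → f (x + p) ≈ f x) →
              ∀ k x → f (x + fromℤ k * p) ≈ f x
  periodicℤ cong-f per (+ n)    x = periodicℕ cong-f per n x
  periodicℤ {p = p} cong-f per -[1+ n ] x = trans
    (sym (periodicℕ cong-f per (suc n) (x + fromℤ -[1+ n ] * p)))
    (cong-f (solve 3 (λ x n p → x :+ :- n :* p :+ n :* p := x) refl x (fromℕ (suc n)) p))

  0≤sin : ∀ {x} → 0# ≤ x → x ≤ halfπ → 0# ≤ sin x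
  0≤sin {x} 0≤x x≤h = [ (λ x≤0 → ≤-reflexive (trans (sym sin-0) (sin-cong (≤-antisym 0≤x x≤0)))) ,
    (λ 0<x → <⇒≤ (0<sin 0<x (≤-<-trans x≤h (<-respʳ (sym π≈+)
      (diff-< positive (solve 1 (λ h → h :+ h :- h := h) refl halfπ)))))) ]′ (≤⊎> x 0#)

  0≤cos : ∀ {x} → 0# ≤ x → x ≤ halfπ → 0# ≤ cos x
  0≤cos {x} 0≤x x≤h = [ (λ h≤x → ≤-reflexive (sym (trans (cos-cong (≤-antisym x≤h h≤x)) cos≈0))) ,
    (λ x<h → <⇒≤ (0<cos 0≤x x<h)) ]′ (≤⊎> halfπ x)

  half-mono : ∀ {x y} → x ≤ y → half x ≤ half y
  half-mono {x} {y} x≤y = diff-≤ (0≤/ (≤⇒0≤ x≤y) 0<2)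
    (solve 3 (λ x y i → y :* i :- x :* i := (y :- x) :* i) refl x y (fromℕ 2 ⁻¹))

  0≤half : ∀ {x} → 0# ≤ x → 0# ≤ half x
  0≤half 0≤x = 0≤/ 0≤x 0<2

  half≤halfπ : ∀ {x} → x ≤ π → half x ≤ halfπ
  half≤halfπ {x} x≤π = ≤-trans (half-mono x≤π) (≤-reflexive
    (sym (/-intro 0<2 (sym π≈))))

  -- sin x - sin a = 2 cos ((x + a) / 2) sin ((x - a) / 2)
  sin-≥ : ∀ {a x} → 0# ≤ a → a ≤ x → x ≤ π - a → sin a ≤ sin x
  sin-≥ {a} {x} 0≤a a≤x x≤π-a = diff-≤
    (*-nonNeg (<⇒≤ 0<2) (*-nonNeg (0≤cos 0≤u (half≤halfπ x+a≤π)) (0≤sin 0≤v (half≤halfπ x-a≤π))))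
    (begin
      sin x - sin a          ≈⟨ +-cong (sin-cong x≈) (-‿cong (sin-cong a≈)) ⟩
      sin (u + v) - sin (u - v)
        ≈⟨ +-cong (sin-+ u v) (-‿cong (trans (sin-+ u (- v))
          (+-cong (*-congˡ (cos-neg v)) (*-congˡ (sin-neg v))))) ⟩
      sin u * cos v + cos u * sin v - (sin u * cos v + cos u * - sin v)
        ≈⟨ solve 4 (λ a b c d → a :* d :+ b :* c :- (a :* d :+ b :* :- c) := ♯ 2 :* (b :* c)) refl
          (sin u) (cos u) (sin v) (cos v) ⟩
      fromℕ 2 * (cos u * sin v) ∎)
    where
    open SetoidReasoning setoid
    u = half (x + a)
    v = half (x - a)
    0≤u : 0# ≤ u
    0≤u = 0≤half (0≤+ (≤-trans 0≤a a≤x) 0≤a)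
    0≤v : 0# ≤ v
    0≤v = 0≤half (≤⇒0≤ a≤x)
    x≈ : x ≈ u + v
    x≈ = trans (sym (half+half x))
      (solve 3 (λ x a i → x :* i :+ x :* i := (x :+ a) :* i :+ (x :- a) :* i) refl x a (fromℕ 2 ⁻¹))
    a≈ : a ≈ u - v
    a≈ = trans (sym (half+half a))
      (solve 3 (λ x a i → a :* i :+ a :* i := (x :+ a) :* i :- (x :- a) :* i) refl x a (fromℕ 2 ⁻¹))
    x+a≤π : x + a ≤ π
    x+a≤π = diff-≤ (≤⇒0≤ x≤π-a) (solve 3 (λ p x a → p :- (x :+ a) := p :- a :- x) refl π x a)
    x-a≤π : x - a ≤ π
    x-a≤π = ≤-trans (diff-≤ (0≤+ 0≤a 0≤a) (solve 2 (λ x a → x :+ a :- (x :- a) := a :+ a) refl x a))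
      x+a≤π

  -- Energy and exponential sums

  recip : ℕ → ℝ
  recip k = fromℕ (suc k) ⁻¹

  -- Telescoping majorant: 1/(k+1)² ≤ 2(1/(k+1) - 1/(k+2)), because 1/(k+1) ≤ 2/(k+2).
  recip-sq-summable : ∃ ((λ k → recip k * recip k) SumsTo_)
  recip-sq-summable = nonneg-summable _ (λ k → 0≤sq (recip k)) λ N →
    ≤-trans (Σ-mono N step) (≤-trans
      (≤-reflexive (trans (Σ-*ˡ N (fromℕ 2) _) (*-congˡ (Σ-telescope N (λ k → - recip k)))))
      (*-monoˡ-≤ (fromℕ 2) (<⇒≤ 0<2) (diff-≤ (<⇒≤ (0<⁻¹ (0<fromℕ (suc N))))
        (solve 2 (λ a b → b :- (:- a :- :- b) := a) refl (recip N) (recip 0)))))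
    where
    step : ∀ k → recip k * recip k ≤ fromℕ 2 * (- recip (suc k) - - recip k)
    step k = diff-≤ (*-nonNeg 0≤i (≤⇒0≤ i≤2j))
      (trans (+-congʳ (*-congˡ i-j≈))
        (solve 2 (λ i j → ♯ 2 :* (i :* j) :- i :* i := i :* (♯ 2 :* j :- i)) refl i j))
      where
      a = fromℕ (suc k)
      i = recip k
      j = recip (suc k)
      0≤i = <⇒≤ (0<⁻¹ (0<fromℕ (suc k)))
      0≤j = <⇒≤ (0<⁻¹ (0<fromℕ (suc (suc k))))
      ai≈1 : a * i ≈ 1#
      ai≈1 = inverseʳ (0<fromℕ (suc k))
      bj≈1 : (1# + a) * j ≈ 1#
      bj≈1 = inverseʳ (0<fromℕ (suc (suc k)))
      i≈ : i ≈ i * j + j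
      i≈ = trans (sym (*-identityʳ i)) (trans (*-congˡ (sym bj≈1))
        (trans (solve 3 (λ a i j → i :* ((♯ 1 :+ a) :* j) := i :* j :+ a :* i :* j) refl a i j)
               (+-congˡ (trans (*-congʳ ai≈1) (*-identityˡ j)))))
      i-j≈ : - j - - i ≈ i * j
      i-j≈ = trans (+-congˡ (-‿cong (-‿cong i≈)))
        (solve 2 (λ i j → :- j :- :- (i :* j :+ j) := i :* j) refl i j)
      i≤1 : i ≤ 1#
      i≤1 = ≤-respʳ ai≈1 (≤-respˡ (*-identityˡ i) (*-mono-≤ 0≤1 0≤i
        (diff-≤ (0≤fromℕ k) (solve 1 (λ k → ♯ 1 :+ k :- ♯ 1 := k) refl (fromℕ k))) ≤-refl))
      i≤2j : i ≤ fromℕ 2 * j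
      i≤2j = ≤-respˡ (sym i≈) (diff-≤ (*-nonNeg (≤⇒0≤ i≤1) 0≤j)
        (solve 2 (λ i j → ♯ 2 :* j :- (i :* j :+ j) := (♯ 1 :- i) :* j) refl i j))

  heat-exponent : ℝ → ℕ → ℝ
  heat-exponent t n = fromℕ 4 * π ^ 2 * fromℕ n ^ 2 * t

  heat : ℝ → ℕ → ℝ
  heat t n = exp (- heat-exponent t n)

  0≤4π²n² : ∀ n → 0# ≤ fromℕ 4 * π ^ 2 * fromℕ n ^ 2
  0≤4π²n² n = ≤-respʳ (solve 3 (λ f p n → f :* (p :* p) :* (n :* n) := f :* (p :* (p :* ♯ 1)) :*
    (n :* (n :* ♯ 1))) refl (fromℕ 4) π (fromℕ n))
    (*-nonNeg (*-nonNeg (0≤fromℕ 4) (0≤sq π)) (0≤sq (fromℕ n)))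

  -- Turns an upper bound on the times into a lower bound on the weights that is the same for all N.
  heat-antitone : ∀ {s t} n → s ≤ t → heat t n ≤ heat s n
  heat-antitone n s≤t = exp-mono (neg-mono-≤ (*-monoˡ-≤ _ (0≤4π²n² n) s≤t))

  -- From y exp(-y) ≤ 1 with y = 4π²n²t and n = k + 1: a crude decay in 1/n², enough to sum the
  -- series.
  heat-bound : ∀ {t} → 0# < t → ∀ k → heat t (suc k) ≤ (fromℕ 4 * (π * π) * t) ⁻¹ *
    (recip k * recip k)
  heat-bound {t} 0<t k = *-cancel-≤ 0<y (≤-respʳ (sym y*≈1) (*exp-neg≤1 (<⇒≤ 0<y)))
    where
    c = fromℕ 4 * (π * π) * t
    n = fromℕ (suc k)
    y = heat-exponent t (suc k)
    0<c : 0# < c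
    0<c = 0<* (0<* (0<fromℕ 4) (0<* 0<π 0<π)) 0<t
    y≈ : y ≈ c * (n * n)
    y≈ = solve 4 (λ f p n t → f :* (p :* (p :* ♯ 1)) :* (n :* (n :* ♯ 1)) :* t := f :* (p :* p) :* t
      :* (n :* n)) refl (fromℕ 4) π n t
    0<y : 0# < y
    0<y = <-respʳ (sym y≈) (0<* 0<c (0<* (0<fromℕ (suc k)) (0<fromℕ (suc k))))
    y*≈1 : y * (c ⁻¹ * (recip k * recip k)) ≈ 1#
    y*≈1 = trans (*-congʳ y≈) (trans
      (solve 4 (λ c n i r → c :* (n :* n) :* (i :* (r :* r)) := c :* i :* ((n :* r) :* (n :* r)))
        refl c n (c ⁻¹) (recip k))
      (trans (*-cong (inverseʳ 0<c) (*-cong nr nr)) (solve 0 (♯ 1 :* (♯ 1 :* ♯ 1) := ♯ 1) refl)))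
      where nr = inverseʳ (0<fromℕ (suc k))

  freq : ℕ → ℝ
  freq n = 2π * fromℕ n

  θ-term : ℝ → ℝ → ℕ → ℝ
  θ-term t x n = heat t n * cos (freq n * x)

  θ-summable : ∀ {t} → 0# < t → ∀ x → ∃ ((λ k → θ-term t x (suc k)) SumsTo_)
  θ-summable {t} 0<t x = comparison bound
    (SumsTo-*ˡ ((fromℕ 4 * (π * π) * t) ⁻¹) (proj₂ recip-sq-summable))
    where
    bound : ∀ k → ∣ θ-term t x (suc k) ∣≤ (fromℕ 4 * (π * π) * t) ⁻¹ * (recip k * recip k)
    bound k = ∣∣≤-resp refl (≤-trans (≤-reflexive (*-identityʳ (heat t (suc k))))
      (heat-bound 0<t k))
      (∣∣≤-* (0≤⇒∣∣≤ (<⇒≤ (0<exp (- heat-exponent t (suc k))))) (∣cos∣≤1 (freq (suc k) * x)))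

  abstract
    -- `θ` is built on `lim`, which returns the sum of a series only once convergence is known; T is
    -- that sum.
    θ-series : ∀ {t} → 0# < t → ∀ x → ∃ λ T →
               ((λ k → θ-term t x (suc k)) SumsTo T) × θ t x ≈ 1# + fromℕ 2 * T
    θ-series {t} 0<t x = proj₁ (θ-summable 0<t x) , proj₂ (θ-summable 0<t x) ,
      +-congˡ (*-congˡ (series-≈ {λ k → θ-term t x (suc k)} (proj₂ (θ-summable 0<t x))))

  cos-minus : ∀ x y → cos (x - y) ≈ cos y * cos x + sin y * sin x
  cos-minus x y = trans (cos-+ x (- y))
    (trans (+-cong (*-congˡ (cos-neg y)) (-‿cong (*-congˡ (sin-neg y))))
    (solve 4 (λ a b c d → a :* c :- b :* :- d := c :* a :+ d :* b) refl (cos x) (sin x) (cos y)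
      (sin y)))

  -- Serves two families of points: the given sequence, and 0, 1, 2, ..., for which the same
  -- identity writes the Fejér kernel as a square.
  module Energy (y : ℕ → ℝ) where
    Σcos Σsin : ℝ → ℕ → ℝ
    Σcos ω N = Σ< N λ i → cos (ω * y i)
    Σsin ω N = Σ< N λ i → sin (ω * y i)

    -- |∑_{i<N} e^{iω yᵢ}|²
    ∣S∣² : ℝ → ℕ → ℝ
    ∣S∣² ω N = Σcos ω N * Σcos ω N + Σsin ω N * Σsin ω N

    0≤∣S∣² : ∀ ω N → 0# ≤ ∣S∣² ω N
    0≤∣S∣² ω N = 0≤+ (0≤sq (Σcos ω N)) (0≤sq (Σsin ω N))

    exponential-sum : ∀ ω N → (Σ< N λ m → Σ< N λ n → cos (ω * (y n - y m))) ≈ ∣S∣² ω N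
    exponential-sum ω N = trans
      (Σ-cong N λ m → Σ-cong N λ n → trans
        (cos-cong (solve 3 (λ w a b → w :* (a :- b) := w :* a :- w :* b) refl ω (y n) (y m)))
        (cos-minus (ω * y n) (ω * y m)))
      (sym (box-products N N c c s s))
      where
      c s : ℕ → ℝ
      c i = cos (ω * y i)
      s i = sin (ω * y i)

    -- The constant terms of θ contribute N². The finite double sum passes inside the series, whose
    -- terms become nonnegative multiples of `∣S∣²`, so that the k-th alone is at most the whole.
    energy-lower : ∀ {t} → 0# < t → ∀ k N →
      fromℕ N * fromℕ N + fromℕ 2 * (heat t (suc k) * ∣S∣² (freq (suc k)) N)
        ≤ Σ< N λ m → Σ< N λ n → θ t (y n - y m)
    energy-lower {t} 0<t k N = ≤-respʳ (sym total≈) (+-mono-≤ ≤-refl (*-monoˡ-≤ (fromℕ 2) (<⇒≤ 0<2)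
        (≤-trans (Σ-single {suc k} {F} {k} 0≤F (ℕ.n<1+n k)) (partial≤ 0≤F F-sums (suc k)))))
      where
      F : ℕ → ℝ
      F k = heat t (suc k) * ∣S∣² (freq (suc k)) N
      0≤F : ∀ k → 0# ≤ F k
      0≤F k = *-nonNeg (<⇒≤ (0<exp (- heat-exponent t (suc k)))) (0≤∣S∣² (freq (suc k)) N)
      T : ℕ → ℕ → ℝ
      T m n = proj₁ (θ-series 0<t (y n - y m))
      G : ℕ → ℕ → ℕ → ℝ
      G m n k = heat t (suc k) * cos (freq (suc k) * (y n - y m))
      sums : ∀ m n → G m n SumsTo T m n
      sums m n = proj₁ (proj₂ (θ-series 0<t (y n - y m)))
      F-sums : F SumsTo (Σ< N λ m → Σ< N λ n → T m n)
      F-sums = ⟶-cong (λ K → trans (Σ-cong N λ m → Σ-swap N K (λ n → G m n))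
        (trans (Σ-swap N K (λ m k → Σ< N (λ n → G m n k)))
          (Σ-cong K λ k → trans (Σ-cong N λ m → Σ-*ˡ N (heat t (suc k))
            (λ n → cos (freq (suc k) * (y n - y m))))
            (trans (Σ-*ˡ N (heat t (suc k)) (λ m → Σ< N λ n → cos (freq (suc k) * (y n - y m))))
              (*-congˡ (exponential-sum (freq (suc k)) N))))))
        refl (⟶-Σ N λ m → ⟶-Σ N λ n → sums m n)
      total≈ : (Σ< N λ m → Σ< N λ n → θ t (y n - y m)) ≈ fromℕ N * fromℕ N + fromℕ 2 *
        (Σ< N λ m → Σ< N λ n → T m n)
      total≈ = trans
        (Σ-cong N λ m → trans (Σ-cong N λ n → proj₂ (proj₂ (θ-series 0<t (y n - y m))))
          (trans (Σ-+ N (λ _ → 1#) (λ n → fromℕ 2 * T m n))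
            (+-cong (trans (Σ-const N 1#) (*-identityʳ _)) (Σ-*ˡ N (fromℕ 2) (T m)))))
        (trans (Σ-+ N (λ _ → fromℕ N) (λ m → fromℕ 2 * Σ< N (T m)))
          (+-cong (Σ-const N (fromℕ N)) (Σ-*ˡ N (fromℕ 2) (λ m → Σ< N (T m)))))

  -- Once r - 1 ≤ e ε², the hypothesis reads z² ≤ (εN)²; the tolerance is chosen to make this a
  -- perfect square.
  mean-null : ∀ {z r : ℕ → ℝ} {e} → 0# < e → r ⟶ 1# →
              (∀ N → .{{NonZero N}} → e * (z N * z N) ≤ (r N - 1#) * (fromℕ N * fromℕ N)) →
              (λ N → z N / fromℕ N) ⟶ 0#
  mean-null {z} {r} {e} 0<e r⟶1 h = ⟶-intro λ ε 0<ε →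
    let N₀ , close = ⟶-elim r⟶1 (e * (ε * ε)) (0<* 0<e (0<* 0<ε 0<ε))
    -- Starting at `suc N₀` excludes N = 0, so that the reciprocal of N is a genuine inverse.
    in suc N₀ , λ { N@(suc _) N₀<N → bound N 0<ε (proj₂ (close N (ℕ.<⇒≤ N₀<N))) }
    where
    bound : ∀ N → .{{_ : NonZero N}} → ∀ {ε} → 0# < ε → r N - 1# ≤ e * (ε * ε) →
            ∣ z N / fromℕ N - 0# ∣≤ ε
    bound N {ε} 0<ε r-1≤ = ∣∣≤-resp
      (solve 2 (λ z i → z :* i := z :* i :- ♯ 0) refl (z N) (fromℕ N ⁻¹))
      (≤-reflexive (trans (solve 3 (λ e n i → e :* n :* i := e :* (n :* i)) refl ε n (n ⁻¹))
        (trans (*-congˡ (inverseʳ 0<n)) (*-identityʳ ε))))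
      (∣∣≤-* ∣z∣≤ (0≤⇒∣∣≤ (<⇒≤ (0<⁻¹ 0<n))))
      where
      n = fromℕ N
      0<n = 0<fromℕ N
      ∣z∣≤ : ∣ z N ∣≤ ε * n
      ∣z∣≤ = sq≤⇒∣∣≤ (*-nonNeg (<⇒≤ 0<ε) (<⇒≤ 0<n)) (*-cancel-≤ 0<e (≤-trans (h N)
        (≤-trans (≤-reflexive (*-comm _ _)) (≤-trans (*-monoˡ-≤ (n * n) (0≤sq n) r-1≤)
          (≤-reflexive (solve 3 (λ e n x → n :* n :* (e :* (x :* x)) := e :* (x :* n :* (x :* n)))
            refl e n ε))))))

  mean : (ℕ → ℝ) → ℕ → ℝ
  mean f N = Σ< N f / fromℕ N

  module ExponentialSums (x t : ℕ → ℝ) (0<t : Positive t) (t-bounded : BoundedAbove t)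
    (energy⟶1 : (λ N → sumTo N (λ m → sumTo N (λ n → θ (t N) (x n - x m))) / fromℕ N ^ 2) ⟶ 1#) where

    y : ℕ → ℝ
    y i = x (suc i)

    open Energy y

    B = proj₁ t-bounded

    ratio : ℕ → ℝ
    ratio N = sumTo N (λ m → sumTo N (λ n → θ (t N) (x n - x m))) / fromℕ N ^ 2

    -- The weight is evaluated at the bound B instead of at t N, which makes it independent of N.
    c : ℕ → ℝ
    c k = fromℕ 2 * heat B (suc k)

    0<c : ∀ k → 0# < c k
    0<c k = 0<* 0<2 (0<exp (- heat-exponent B (suc k)))

    energy-bound : ∀ k N → .{{NonZero N}} →
      c k * ∣S∣² (freq (suc k)) N ≤ (ratio N - 1#) * (fromℕ N * fromℕ N)
    energy-bound k N@(suc _) = ≤-trans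
      (≤-trans (≤-reflexive (*-assoc _ _ _)) (*-monoˡ-≤ (fromℕ 2) (<⇒≤ 0<2)
        (*-mono-≤ (<⇒≤ (0<exp (- heat-exponent B (suc k)))) (0≤∣S∣² (freq (suc k)) N)
          (heat-antitone (suc k) (proj₂ t-bounded N)) ≤-refl)))
      (diff-≤ (≤⇒0≤ (energy-lower (0<t N) k N)) (trans (+-congʳ (trans
          (solve 2 (λ r n → (r :- ♯ 1) :* (n :* n) := n :* (n :* ♯ 1) :* r :- n :* n) refl (ratio N)
            (fromℕ N))
          (+-congʳ (trans (*-/-cancel _ 0<n²) double-sum))))
        (solve 3 (λ s n w → s :- n :- w := s :- (n :+ w)) refl _ (fromℕ N * fromℕ N) _)))
      where
      0<n² : 0# < fromℕ N ^ 2
      0<n² = <-respʳ (*-congˡ (sym (*-identityʳ _))) (0<* (0<fromℕ N) (0<fromℕ N))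
      double-sum : sumTo N (λ m → sumTo N (λ n → θ (t N) (x n - x m))) ≈
        (Σ< N λ m → Σ< N λ n → θ (t N) (y n - y m))
      double-sum = trans (∑≈Σ< N (λ m → sumTo N (λ n → θ (t N) (x n - y m))))
        (Σ-cong N λ m → ∑≈Σ< N (λ n → θ (t N) (y n - y m)))

    mean-cos : ∀ k → mean (λ i → cos (freq (suc k) * y i)) ⟶ 0#
    mean-cos k = mean-null {Σcos (freq (suc k))} {ratio} (0<c k) energy⟶1 λ N → ≤-trans
      (*-monoˡ-≤ (c k) (<⇒≤ (0<c k))
        (diff-≤ (0≤sq (Σsin (freq (suc k)) N))
        (solve 2 (λ a b → a :+ b :- a := b) refl (Σcos (freq (suc k)) N * Σcos (freq (suc k)) N)
        (Σsin (freq (suc k)) N * Σsin (freq (suc k)) N)))) (energy-bound k N)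

    mean-sin : ∀ k → mean (λ i → sin (freq (suc k) * y i)) ⟶ 0#
    mean-sin k = mean-null {Σsin (freq (suc k))} {ratio} (0<c k) energy⟶1 λ N → ≤-trans
      (*-monoˡ-≤ (c k) (<⇒≤ (0<c k))
        (diff-≤ (0≤sq (Σcos (freq (suc k)) N))
        (solve 2 (λ a b → a :+ b :- b := a) refl (Σcos (freq (suc k)) N * Σcos (freq (suc k)) N)
        (Σsin (freq (suc k)) N * Σsin (freq (suc k)) N)))) (energy-bound k N)

  -- Fejér kernels

  0<*-lt : ∀ {x y z} → 0# < x → y < z → x * y < x * z
  0<*-lt {x} {y} {z} 0<x y<z = diff-< (0<* 0<x (<⇒0< y<z))
    (solve 3 (λ x y z → x :* z :- x :* y := x :* (z :- y)) refl x y z)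

  2sin*cos : ∀ h v → fromℕ 2 * sin h * cos v ≈ sin (v + h) - sin (v - h)
  2sin*cos h v = sym (trans
    (+-cong (sin-+ v h) (-‿cong (trans (sin-+ v (- h))
      (+-cong (*-congˡ (cos-neg h)) (*-congˡ (sin-neg h))))))
    (solve 4 (λ a b c d → b :* c :+ a :* d :- (b :* c :+ a :* :- d) := ♯ 2 :* d :* a) refl (cos v)
      (sin v) (cos h) (sin h)))

  2sin*sin : ∀ h v → fromℕ 2 * sin h * sin v ≈ - cos (v + h) - - cos (v - h)
  2sin*sin h v = sym (trans
    (+-cong (-‿cong (cos-+ v h)) (-‿cong (-‿cong (cos-minus v h))))
    (solve 4 (λ a b c d → :- (a :* c :- b :* d) :- :- (c :* a :+ d :* b) := ♯ 2 :* d :* b) refl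
      (cos v) (sin v) (cos h) (sin h)))

  step-up : ∀ w h n → w + n * (h + h) + h ≈ w - h + (1# + n) * (h + h)
  step-up = solve 3 (λ w h n → w :+ n :* (h :+ h) :+ h := w :- h :+ (♯ 1 :+ n) :* (h :+ h)) refl

  step-down : ∀ w h n → w + n * (h + h) - h ≈ w - h + n * (h + h)
  step-down = solve 3 (λ w h n → w :+ n :* (h :+ h) :- h := w :- h :+ n :* (h :+ h)) refl

  -- The closed form of the Dirichlet kernel: multiplied by 2 sin h, each cosine is a difference of
  -- sines at points 2h apart.
  Σcos-telescope : ∀ M w h → fromℕ 2 * sin h * Σ< M (λ i → cos (w + fromℕ i * (h + h))) ≈
                   sin (w - h + fromℕ M * (h + h)) - sin (w - h + 0# * (h + h))
  Σcos-telescope M w h = trans (sym (Σ-*ˡ M (fromℕ 2 * sin h) (λ i → cos (w + fromℕ i * (h + h)))))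
    (trans (Σ-cong M λ i → trans (2sin*cos h (w + fromℕ i * (h + h)))
        (+-cong (sin-cong (step-up w h (fromℕ i))) (-‿cong (sin-cong (step-down w h (fromℕ i))))))
      (Σ-telescope M (λ i → sin (w - h + fromℕ i * (h + h)))))

  Σsin-telescope : ∀ M w h → fromℕ 2 * sin h * Σ< M (λ i → sin (w + fromℕ i * (h + h))) ≈
                   - cos (w - h + fromℕ M * (h + h)) - - cos (w - h + 0# * (h + h))
  Σsin-telescope M w h = trans (sym (Σ-*ˡ M (fromℕ 2 * sin h) (λ i → sin (w + fromℕ i * (h + h)))))
    (trans (Σ-cong M λ i → trans (2sin*sin h (w + fromℕ i * (h + h)))
        (+-cong (-‿cong (cos-cong (step-up w h (fromℕ i))))
          (-‿cong (-‿cong (cos-cong (step-down w h (fromℕ i)))))))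
      (Σ-telescope M (λ i → - cos (w - h + fromℕ i * (h + h)))))

  -- M times the Fejér kernel of order M.
  fejer : ℕ → ℝ → ℝ
  fejer M u = Σ< M λ m → Σ< M λ n → cos (2π * u * (fromℕ n - fromℕ m))

  module Modes = Energy fromℕ

  fejer≈ : ∀ M u → fejer M u ≈ Modes.∣S∣² (2π * u) M
  fejer≈ M u = Modes.exponential-sum (2π * u) M

  0≤fejer : ∀ M u → 0# ≤ fejer M u
  0≤fejer M u = ≤-respʳ (sym (fejer≈ M u)) (Modes.0≤∣S∣² (2π * u) M)

  fejer-cong : ∀ M {u v} → u ≈ v → fejer M u ≈ fejer M v
  fejer-cong M u≈v = Σ-cong M λ m → Σ-cong M λ n → cos-cong (*-congʳ (*-congˡ u≈v))

  -- The frequencies n - m are integers, so translation by k adds k(n - m) full periods to each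
  -- term.
  fejer-periodic : ∀ M k u → fejer M (u + fromℤ k) ≈ fejer M u
  fejer-periodic M k u = Σ-cong M λ m → Σ-cong M λ n → trans
    (cos-cong (trans
      (solve 4 (λ p u k d → p :* (u :+ k) :* d := p :* u :* d :+ k :* d :* p) refl 2π u (fromℤ k)
        (fromℕ n - fromℕ m))
      (+-congˡ (*-congʳ (sym (trans (fromℤ-* k (+ n ℤ.- + m))
        (*-congˡ (trans (fromℤ-+ (+ n) (ℤ.- + m)) (+-congˡ (fromℤ-neg (+ m)))))))))))
    (periodicℤ cos-cong cos-periodic (k ℤ.* (+ n ℤ.- + m)) (2π * u * (fromℕ n - fromℕ m)))

  -- Telescoping leaves two boundary terms, so 2 sin(πu) times the cosine sum or the sine sum is at
  -- most 2 in size, whatever M is. Squaring and adding gives 4 sin²(πu) D(u) ≤ 8.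
  fejer-bound : ∀ M u {a} → 0# ≤ a → a ≤ sin (π * u) → fejer M u * (a * a) ≤ fromℕ 2
  fejer-bound M u {a} 0≤a a≤sin = ≤-trans
    (*-monoˡ-≤ (fejer M u) (0≤fejer M u) (*-mono-≤ 0≤a 0≤a a≤sin a≤sin))
    (*-cancel-≤ (0<fromℕ 4) (≤-trans (≤-reflexive (trans (*-congˡ (*-congʳ (fejer≈ M u)))
        (solve 3 (λ c s e → ♯ 4 :* ((c :* c :+ s :* s) :* (e :* e)) := ♯ 2 :* e :* c :*
          (♯ 2 :* e :* c) :+ ♯ 2 :* e :* s :* (♯ 2 :* e :* s)) refl C S (sin h))))
      (≤-trans (+-mono-≤ (proj₂ (∣∣≤-* ∣2sC∣≤2 ∣2sC∣≤2)) (proj₂ (∣∣≤-* ∣2sS∣≤2 ∣2sS∣≤2)))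
        (≤-reflexive (solve 0 ((♯ 1 :+ ♯ 1) :* (♯ 1 :+ ♯ 1) :+ (♯ 1 :+ ♯ 1) :* (♯ 1 :+ ♯ 1) := ♯ 4
          :* ♯ 2) refl)))))
    where
    h = π * u
    C = Modes.Σcos (2π * u) M
    S = Modes.Σsin (2π * u) M
    angle : ∀ n → 2π * u * n ≈ 0# + n * (h + h)
    angle n = solve 3 (λ p u n → ♯ 2 :* p :* u :* n := ♯ 0 :+ n :* (p :* u :+ p :* u)) refl π u n
    ∣2sC∣≤2 : ∣ fromℕ 2 * sin h * C ∣≤ 1# + 1#
    ∣2sC∣≤2 = ∣∣≤-resp (sym (trans (*-congˡ (Σ-cong M λ i → cos-cong (angle (fromℕ i))))
      (Σcos-telescope M 0# h))) ≤-refl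
      (∣∣≤-+ (∣sin∣≤1 _) (∣∣≤-neg (∣sin∣≤1 _)))
    ∣2sS∣≤2 : ∣ fromℕ 2 * sin h * S ∣≤ 1# + 1#
    ∣2sS∣≤2 = ∣∣≤-resp (sym (trans (*-congˡ (Σ-cong M λ i → sin-cong (angle (fromℕ i))))
      (Σsin-telescope M 0# h))) ≤-refl
      (∣∣≤-+ (∣∣≤-neg (∣cos∣≤1 _)) (∣∣≤-neg (∣∣≤-neg (∣cos∣≤1 _))))

  -- Orthogonality of modes and the partition identity

  compare-elim : ∀ {P : ℕ → ℕ → Set} → (∀ {m n} → m ℕ.< n → P m n) → (∀ {m n} → n ℕ.< m → P m n) →
                 (∀ n → P n n) → ∀ m n → P m n
  compare-elim lt gt eq m n with ℕ.<-cmp m n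
  ... | tri< m<n _ _    = lt m<n
  ... | tri≈ _ ≡.refl _ = eq m
  ... | tri> _ _ n<m    = gt n<m

  δ : ℕ → ℕ → ℝ
  δ zero    zero    = 1#
  δ zero    (suc n) = 0#
  δ (suc m) zero    = 0#
  δ (suc m) (suc n) = δ m n

  δ-refl : ∀ n → δ n n ≈ 1#
  δ-refl zero    = refl
  δ-refl (suc n) = δ-refl n

  δ-< : ∀ {m n} → m ℕ.< n → δ m n ≈ 0# × δ n m ≈ 0#
  δ-< {zero}  {suc n} _           = refl , refl
  δ-< {suc m} {suc n} (ℕ.s≤s m<n) = δ-< m<n

  Σδ : ∀ {m M} → m ℕ.< M → Σ< M (δ m) ≈ 1#
  Σδ {zero}  {suc M} _           = trans (Σ-front M (δ 0))
    (trans (+-congˡ (Σ-0 M)) (+-identityʳ 1#))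
  Σδ {suc m} {suc M} (ℕ.s≤s m<M) = trans (Σ-front M (δ (suc m))) (trans (+-identityˡ _) (Σδ m<M))

  ΣΣδ : ∀ M → (Σ< M λ m → Σ< M (δ m)) ≈ fromℕ M
  ΣΣδ M = trans (Σ-cong< M λ m m<M → Σδ m<M) (trans (Σ-const M 1#) (*-identityʳ _))

  fromℕ-∸ : ∀ {m n} → m ℕ.< n → ∃ λ k → fromℕ n - fromℕ m ≈ fromℕ (suc k) × suc k ℕ.≤ n
  fromℕ-∸ {m} {n} m<n = n ℕ.∸ suc m ,
    trans (+-congʳ (trans (reflexive
      (≡.cong fromℕ (≡.trans (≡.sym (ℕ.m+[n∸m]≡n m<n)) (≡.sym (ℕ.+-suc m (n ℕ.∸ suc m))))))
      (fromℕ-+ m (suc (n ℕ.∸ suc m)))))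
      (solve 2 (λ m k → m :+ k :- m := k) refl (fromℕ m) (fromℕ (suc (n ℕ.∸ suc m)))) ,
    ℕ.≤-trans (ℕ.s≤s (ℕ.m≤n+m (n ℕ.∸ suc m) m)) (ℕ.≤-reflexive (ℕ.m+[n∸m]≡n m<n))

  cos-antisym : ∀ z m n → cos (z * (n - m)) ≈ cos (z * (m - n))
  cos-antisym z m n = trans (cos-cong
    (solve 3 (λ z m n → z :* (n :- m) := :- (z :* (m :- n))) refl z m n)) (cos-neg (z * (m - n)))

  -- With h = π(d + 1)/M the telescoped boundary terms differ by d + 1 full periods and cancel. As 0
  -- < d + 1 < M, h lies in (0, π), so sin h is nonzero and can be divided out.
  roots-of-unity : ∀ M .{{_ : NonZero M}} d → suc d ℕ.< M → ∀ w →
                   Σ< M (λ a → cos (w + fromℕ a / fromℕ M * (2π * fromℕ (suc d)))) ≈ 0#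
  roots-of-unity M d d<M w = *-cancelˡ (0<⇒≉0 (0<* 0<2 0<sin-h)) (trans
    (trans (*-congˡ (Σ-cong M λ a → cos-cong (+-congˡ
        (solve 4 (λ a i p d → a :* i :* (♯ 2 :* p :* d) := a :* (p :* (d :* i) :+ p :* (d :* i)))
          refl (fromℕ a) (fromℕ M ⁻¹) π (fromℕ (suc d))))))
      (Σcos-telescope M w h))
    (trans (trans (+-cong (trans (sin-cong (+-congˡ M2h≈))
      (periodicℕ sin-cong sin-periodic (suc d) (w - h)))
                          (-‿cong (sin-cong (trans (+-congˡ (zeroˡ _)) (+-identityʳ _)))))
        (-‿inverseʳ _)) (sym (zeroʳ _))))
    where
    h = π * (fromℕ (suc d) / fromℕ M)
    0<M = 0<fromℕ M
    0<sin-h : 0# < sin h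
    0<sin-h = 0<sin (0<* 0<π (0</ (0<fromℕ (suc d)) 0<M)) (<-respʳ (*-identityʳ π) (0<*-lt 0<π
      (<-respʳ (inverseʳ 0<M) (<-respˡ (*-comm _ _) (<-respʳ (*-comm _ _) (0<*-lt (0<⁻¹ 0<M)
        (<-≤-trans (diff-< 0<1 (solve 1 (λ n → ♯ 1 :+ n :- n := ♯ 1) refl (fromℕ (suc d))))
          (fromℕ-mono d<M))))))))
    M2h≈ : fromℕ M * (h + h) ≈ fromℕ (suc d) * 2π
    M2h≈ = trans (solve 4 (λ m p d i → m :* (p :* (d :* i) :+ p :* (d :* i)) := m :* i :*
      (d :* (♯ 2 :* p))) refl (fromℕ M) π (fromℕ (suc d)) (fromℕ M ⁻¹))
      (trans (*-congʳ (inverseʳ 0<M)) (*-identityˡ _))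

  -- Averaging over the translates kills every mode with m ≠ n; each of the M diagonal modes is 1
  -- and is counted M times.
  fejer-partition : ∀ M .{{_ : NonZero M}} v → Σ< M (λ a → fejer M (v - fromℕ a / fromℕ M)) ≈ fromℕ
    M * fromℕ M
  fejer-partition M v = begin
    Σ< M (λ a → Σ< M λ m → Σ< M λ n → g a m n)  ≈⟨ Σ-swap M M (λ a m → Σ< M (g a m)) ⟩
    Σ< M (λ m → Σ< M λ a → Σ< M λ n → g a m n)  ≈⟨ Σ-cong M (λ m → Σ-swap M M (λ a n → g a m n)) ⟩
    Σ< M (λ m → Σ< M λ n → G m n)               ≈⟨ Σ-cong< M
      (λ m m<M → Σ-cong< M λ n n<M → orthogonal m n m<M n<M) ⟩
    Σ< M (λ m → Σ< M λ n → fromℕ M * δ m n)     ≈⟨ Σ-cong M (λ m → Σ-*ˡ M (fromℕ M) (δ m)) ⟩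
    Σ< M (λ m → fromℕ M * Σ< M (δ m))           ≈⟨ Σ-*ˡ M (fromℕ M) (λ m → Σ< M (δ m)) ⟩
    fromℕ M * Σ< M (λ m → Σ< M (δ m))           ≈⟨ *-congˡ (ΣΣδ M) ⟩
    fromℕ M * fromℕ M                           ∎
    where
    open SetoidReasoning setoid
    g : ℕ → ℕ → ℕ → ℝ
    g a m n = cos (2π * (v - fromℕ a / fromℕ M) * (fromℕ n - fromℕ m))
    G : ℕ → ℕ → ℝ
    G m n = Σ< M λ a → g a m n
    G-sym : ∀ m n → G m n ≈ G n m
    G-sym m n = Σ-cong M λ a → cos-antisym (2π * (v - fromℕ a / fromℕ M)) (fromℕ m) (fromℕ n)
    G-> : ∀ {m n} → n ℕ.< m → m ℕ.< M → G m n ≈ 0#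
    G-> {m} {n} n<m m<M = let k , m-n≈ , k<m = fromℕ-∸ n<m in trans
      (Σ-cong M λ a → cos-cong (trans
        (solve 5 (λ p v b m n → p :* (v :- b) :* (n :- m) := p :* v :* (n :- m) :+ b :*
          (p :* (m :- n))) refl 2π v (fromℕ a / fromℕ M) (fromℕ m) (fromℕ n))
        (+-congˡ (*-congˡ (*-congˡ m-n≈)))))
      (roots-of-unity M k (ℕ.≤-<-trans k<m m<M) (2π * v * (fromℕ n - fromℕ m)))
    orthogonal : ∀ m n → m ℕ.< M → n ℕ.< M → G m n ≈ fromℕ M * δ m n
    orthogonal = compare-elim {λ m n → m ℕ.< M → n ℕ.< M → G m n ≈ fromℕ M * δ m n}
      (λ {m} {n} m<n _ n<M → trans (trans (G-sym m n) (G-> m<n n<M))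
        (sym (trans (*-congˡ (proj₁ (δ-< m<n))) (zeroʳ _))))
      (λ n<m m<M _ → trans (G-> n<m m<M) (sym (trans (*-congˡ (proj₂ (δ-< n<m))) (zeroʳ _))))
      (λ n _ _ → trans
        (Σ-cong M λ a → trans (cos-cong (trans (*-congˡ (-‿inverseʳ _)) (zeroʳ _))) cos-0)
        (trans (Σ-const M 1#) (*-congˡ (sym (δ-refl n)))))

  mean-Σ : ∀ K (f : ℕ → ℕ → ℝ) N → mean (λ i → Σ< K (λ j → f j i)) N ≈ Σ< K (λ j → mean (f j) N)
  mean-Σ K f N = trans (*-congʳ (Σ-swap N K (λ i j → f j i)))
    (sym (Σ-*ʳ K (fromℕ N ⁻¹) (λ j → Σ< N (f j))))

  mean-const : ∀ c → mean (λ _ → c) ⟶ c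
  mean-const c = ⟶-intro λ ε 0<ε → 1 , λ { N@(suc _) _ → ∣∣≤-resp
    (sym (trans (+-congʳ (trans (*-congʳ (Σ-const N c))
      (trans (*-assoc _ _ _) (*-/-cancel c (0<fromℕ N))))) (-‿inverseʳ c)))
    (<⇒≤ 0<ε) (0≤⇒∣∣≤ ≤-refl) }

  module FejerMean (y : ℕ → ℝ)
    (mean-cos : ∀ k → mean (λ i → cos (freq (suc k) * y i)) ⟶ 0#)
    (mean-sin : ∀ k → mean (λ i → sin (freq (suc k) * y i)) ⟶ 0#) where

    -- The translated mode is a fixed linear combination of the cosine and sine modes, so the means
    -- of both are used.
    mean-mode : ∀ k b → mean (λ i → cos (freq (suc k) * (y i - b))) ⟶ 0#
    mean-mode k b = ⟶-cong
      (λ N → trans (solve 5 (λ p q c s i → p :* (c :* i) :+ q :* (s :* i) := 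
          (p :* c :+ q :* s) :* i) refl
                      (cos (ω * b)) (sin (ω * b)) (Σ< N (λ i → cos (ω * y i)))
                        (Σ< N (λ i → sin (ω * y i))) (fromℕ N ⁻¹))
        (*-congʳ (sym (trans (Σ-cong N λ i → trans
          (cos-cong (solve 3 (λ w a b → w :* (a :- b) := w :* a :- w :* b) refl ω (y i) b))
          (cos-minus (ω * y i) (ω * b)))
          (trans (Σ-+ N (λ i → cos (ω * b) * cos (ω * y i)) (λ i → sin (ω * b) * sin (ω * y i)))
            (+-cong (Σ-*ˡ N (cos (ω * b)) (λ i → cos (ω * y i)))
            (Σ-*ˡ N (sin (ω * b)) (λ i → sin (ω * y i)))))))))
      (solve 2 (λ p q → p :* ♯ 0 :+ q :* ♯ 0 := ♯ 0) refl (cos (ω * b)) (sin (ω * b)))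
      (⟶-+ (⟶-*ˡ (cos (ω * b)) (mean-cos k)) (⟶-*ˡ (sin (ω * b)) (mean-sin k)))
      where ω = freq (suc k)

    mode : ℝ → ℕ → ℕ → ℕ → ℝ
    mode b m n i = cos (2π * (y i - b) * (fromℕ n - fromℕ m))

    mean-cong : ∀ {f g : ℕ → ℝ} → (∀ i → f i ≈ g i) → ∀ N → mean f N ≈ mean g N
    mean-cong f≈g N = *-congʳ (Σ-cong N f≈g)

    mean-mode-< : ∀ b {m n} → m ℕ.< n → mean (mode b m n) ⟶ 0#
    mean-mode-< b {m} {n} m<n = let k , n-m≈ , _ = fromℕ-∸ m<n in ⟶-cong
      (mean-cong λ i → cos-cong (trans
        (solve 3 (λ p k z → p :* k :* z := p :* z :* k) refl 2π (fromℕ (suc k)) (y i - b))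
          (*-congˡ (sym n-m≈))))
      refl (mean-mode k b)

    mean-modes : ∀ b m n → mean (mode b m n) ⟶ δ m n
    mean-modes b = compare-elim {λ m n → mean (mode b m n) ⟶ δ m n}
      (λ m<n → ⟶-cong (λ _ → refl) (sym (proj₁ (δ-< m<n))) (mean-mode-< b m<n))
      (λ {m} {n} n<m → ⟶-cong (mean-cong λ i → cos-antisym (2π * (y i - b)) (fromℕ n) (fromℕ m))
        (sym (proj₂ (δ-< n<m))) (mean-mode-< b n<m))
      (λ n → ⟶-cong (mean-cong λ i → sym
        (trans (cos-cong (trans (*-congˡ (-‿inverseʳ _)) (zeroʳ _))) cos-0)) (sym (δ-refl n))
        (mean-const 1#))

    -- Only the M diagonal modes have a nonzero limiting mean, namely 1 each.
    mean-fejer : ∀ M b → mean (λ i → fejer M (y i - b)) ⟶ fromℕ M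
    mean-fejer M b = ⟶-cong
      (λ N → sym (trans (mean-Σ M (λ m i → Σ< M (λ n → mode b m n i)) N)
        (Σ-cong M λ m → mean-Σ M (mode b m) N)))
      (ΣΣδ M) (⟶-Σ M λ m → ⟶-Σ M λ n → mean-modes b m n)

  -- Counting points in arcs

  indicator : Set → ℝ
  indicator P with em {P}
  ... | yes _ = 1#
  ... | no  _ = 0#

  0≤indicator : ∀ P → 0# ≤ indicator P
  0≤indicator P with em {P}
  ... | yes _ = 0≤1
  ... | no  _ = ≤-refl

  indicator-elim : ∀ {P : Set} (Q : ℝ → Set) → (P → Q 1#) → (¬ P → Q 0#) → Q (indicator P)
  indicator-elim {P} Q q₁ q₀ with em {P}
  ... | yes p = q₁ p
  ... | no ¬p = q₀ ¬p

  indicator-mono : ∀ {P Q : Set} → (P → Q) → indicator P ≤ indicator Q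
  indicator-mono {P} {Q} P⇒Q = indicator-elim (_≤ indicator Q)
    (λ p → indicator-elim (1# ≤_) (λ _ → ≤-refl) (λ ¬q → ⊥-elim (¬q (P⇒Q p))))
    (λ _ → 0≤indicator Q)

  indicator-disjoint : ∀ {P Q : Set} → (P → Q → ⊥) → indicator P + indicator Q ≤ 1#
  indicator-disjoint {P} {Q} disjoint = indicator-elim (λ i → i + indicator Q ≤ 1#)
    (λ p → indicator-elim (λ j → 1# + j ≤ 1#) (λ q → ⊥-elim (disjoint p q))
      (λ _ → ≤-reflexive (+-identityʳ 1#)))
    (λ _ → ≤-respˡ (sym (+-identityˡ _)) (indicator-elim (_≤ 1#) (λ _ → ≤-refl) (λ _ → 0≤1)))

  -- The enumeration f is arbitrary because the tail of `applyUpTo f` enumerates `f ∘ suc`; the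
  -- counting function is the case f = `suc`.
  count≈ : ∀ (P : ℕ → Set) (f : ℕ → ℕ) N →
           fromℕ (length (filter (λ i → em {P i}) (applyUpTo f N))) ≈ Σ< N
             (λ i → indicator (P (f i)))
  count≈ P f zero    = refl
  count≈ P f (suc N) = trans (cons (f 0) (applyUpTo (f ∘ suc) N))
    (trans (+-congˡ (count≈ P (f ∘ suc) N)) (sym (Σ-front N (λ i → indicator (P (f i))))))
    where
    cons : ∀ x xs → fromℕ (length (filter (λ i → em {P i}) (x ∷ xs))) ≈
                    indicator (P x) + fromℕ (length (filter (λ i → em {P i}) xs))
    cons x xs with em {P x}
    ... | yes _ = refl
    ... | no  _ = sym (+-identityˡ _)

  fromℕ-cancel-≤ : ∀ {m n} → fromℕ m ≤ fromℕ n → m ℕ.≤ n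
  fromℕ-cancel-≤ {m} {n} m≤n = ℕ.≮⇒≥ λ n<m → <⇒≱
    (<-≤-trans (diff-< 0<1 (solve 1 (λ n → ♯ 1 :+ n :- n := ♯ 1) refl (fromℕ n))) (fromℕ-mono n<m))
      m≤n

  no-integer-in-unit-interval : ∀ k → 0# < fromℤ k → fromℤ k < 1# → ⊥
  no-integer-in-unit-interval (+ zero)  0<k k<1 = <-irrefl 0<k
  no-integer-in-unit-interval (+ suc n) 0<k k<1 =
    <⇒≱ k<1 (diff-≤ (0≤fromℕ n) (solve 1 (λ n → ♯ 1 :+ n :- ♯ 1 := n) refl (fromℕ n)))
  no-integer-in-unit-interval -[1+ n ]  0<k k<1 = <⇒≱ 0<k
    (diff-≤ (0≤fromℕ (suc n)) (solve 1 (λ n → ♯ 0 :- :- n := n) refl (fromℕ (suc n))))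

  -- Some integer translate of x lies in (l, r). With bare endpoints, the open complement of an arc
  -- has the same form, namely (r, l + 1).
  InOpenArc : ℝ → ℝ → ℝ → Set
  InOpenArc l r x = ∃ λ k → l < x + fromℤ k × x + fromℤ k < r

  -- The centre b is at least δ inside the arc, so the fractional part u of x - b stays in
  -- [δ, 1 - δ] and sin(πu) ≥ sin(πδ). The bound involves neither M nor x.
  fejer-outside : ∀ {l r δ b x} M → 0# < δ → r ≤ l + 1# → l + δ ≤ b → b ≤ r - δ →
                  ¬ InOpenArc l r x →
                  fejer M (x - b) * (sin (π * δ) * sin (π * δ)) ≤ fromℕ 2
  fejer-outside {l} {r} {δ} {b} {x} M 0<δ r≤l+1 l+δ≤b b≤r-δ x∉ = ≤-trans
    (≤-reflexive (*-congʳ (trans (fejer-cong M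
      (solve 3 (λ x b k → x :- b := x :- b :- k :+ k) refl x b (fromℤ k))) (fejer-periodic M k u))))
    (fejer-bound M u 0≤sinπδ (sin-≥ (*-nonNeg (<⇒≤ 0<π) (<⇒≤ 0<δ)) (*-monoˡ-≤ π (<⇒≤ 0<π) δ≤u)
      (≤-respʳ (solve 2 (λ p d → p :* (♯ 1 :- d) := p :- p :* d) refl π δ)
        (*-monoˡ-≤ π (<⇒≤ 0<π) u≤1-δ))))
    where
    floor = floorℤ (x - b)
    k = proj₁ floor
    u = x - b - fromℤ k
    0≤u : 0# ≤ u
    0≤u = ≤⇒0≤ (proj₁ (proj₂ floor))
    u<1 : u < 1#
    u<1 = diff-< (<⇒0< (proj₂ (proj₂ floor)))
      (solve 3 (λ x b k → ♯ 1 :- (x :- b :- k) := k :+ ♯ 1 :- (x :- b)) refl x b (fromℤ k))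
    -- The points b + u and b + u - 1 are the representatives of x in [b, b + 1) and [b - 1, b).
    -- Neither may lie in (l, r), so the first is at least r and the second at most l.
    z≈ : x + fromℤ (ℤ.- k) ≈ b + u
    z≈ = trans (+-congˡ (fromℤ-neg k))
      (solve 3 (λ x b k → x :+ :- k := b :+ (x :- b :- k)) refl x b (fromℤ k))
    z-1≈ : x + fromℤ (ℤ.- k ℤ.+ -[1+ 0 ]) ≈ b + u - 1#
    z-1≈ = trans (+-congˡ (trans (fromℤ-+ (ℤ.- k) -[1+ 0 ]) (+-congʳ (fromℤ-neg k))))
      (solve 3 (λ x b k → x :+ (:- k :+ :- (♯ 1 :+ ♯ 0)) := b :+ (x :- b :- k) :- ♯ 1) refl x b
        (fromℤ k))
    l<b+u : l < b + u
    l<b+u = diff-< (0<+0≤ 0<δ (0≤+ (≤⇒0≤ l+δ≤b) 0≤u))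
      (solve 4 (λ l d b u → b :+ u :- l := d :+ (b :- (l :+ d) :+ u)) refl l δ b u)
    b+u-1<r : b + u - 1# < r
    b+u-1<r = diff-< (0<+0≤ 0<δ (0≤+ (≤⇒0≤ b≤r-δ) (<⇒≤ (<⇒0< u<1))))
      (solve 4 (λ r d b u → r :- (b :+ u :- ♯ 1) := d :+ (r :- d :- b :+ (♯ 1 :- u))) refl r δ b u)
    r≤b+u : r ≤ b + u
    r≤b+u = ≮⇒≥ λ b+u<r → x∉ (ℤ.- k , <-respʳ (sym z≈) l<b+u , <-respˡ (sym z≈) b+u<r)
    b+u-1≤l : b + u - 1# ≤ l
    b+u-1≤l = ≮⇒≥ λ l<b+u-1 → x∉ (ℤ.- k ℤ.+ -[1+ 0 ] , <-respʳ (sym z-1≈) l<b+u-1 , <-respˡ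
      (sym z-1≈) b+u-1<r)
    δ≤u : δ ≤ u
    δ≤u = diff-≤ (0≤+ (≤⇒0≤ r≤b+u) (≤⇒0≤ b≤r-δ))
      (solve 4 (λ r d b u → u :- d := b :+ u :- r :+ (r :- d :- b)) refl r δ b u)
    u≤1-δ : u ≤ 1# - δ
    u≤1-δ = diff-≤ (0≤+ (≤⇒0≤ b+u-1≤l) (≤⇒0≤ l+δ≤b))
      (solve 4 (λ l d b u → ♯ 1 :- d :- u := l :- (b :+ u :- ♯ 1) :+ (b :- (l :+ d))) refl l δ b u)
    δ<1 : δ < 1#
    δ<1 = ≤-<-trans δ≤u u<1
    0≤sinπδ : 0# ≤ sin (π * δ)
    0≤sinπδ = <⇒≤ (0<sin (0<* 0<π 0<δ) (<-respʳ (*-identityʳ π) (0<*-lt 0<π δ<1)))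

  mean-mono : ∀ {f g : ℕ → ℝ} → (∀ i → f i ≤ g i) → ∀ N → .{{NonZero N}} → mean f N ≤ mean g N
  mean-mono {f} {g} f≤g N = ≤-respˡ (*-comm (fromℕ N ⁻¹) (Σ< N f))
    (≤-respʳ (*-comm (fromℕ N ⁻¹) (Σ< N g))
    (*-monoˡ-≤ (fromℕ N ⁻¹) (<⇒≤ (0<⁻¹ (0<fromℕ N))) (Σ-mono N f≤g)))

  mean-affine : ∀ c d (f : ℕ → ℝ) N → .{{NonZero N}} → mean (λ i → c * f i + d) N ≈ c * mean f N + d
  mean-affine c d f N = trans (*-congʳ
    (trans (Σ-+ N (λ i → c * f i) (λ _ → d)) (+-cong (Σ-*ˡ N c f) (Σ-const N d))))
    (trans (solve 5 (λ c s n d i → (c :* s :+ n :* d) :* i := c :* (s :* i) :+ n :* i :* d) refl c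
      (Σ< N f) (fromℕ N) d (fromℕ N ⁻¹))
      (+-congˡ (trans (*-congʳ (inverseʳ (0<fromℕ N))) (*-identityˡ d))))

  -- V = Σ_{a<K} fejer M (· - b a), with the b a spaced by 1/M and filling [l + δ, r - δ], is at
  -- most M² everywhere and O(K) off (l, r), while its mean is K M ≈ M² (r - l).
  module LowerBound (y : ℕ → ℝ) (mean-fejer : ∀ M b → mean (λ i → fejer M (y i - b)) ⟶ fromℕ M)
    {l r : ℝ} (r≤l+1 : r ≤ l + 1#) {ε : ℝ} (0<ε : 0# < ε) (ε<r-l : ε < r - l) where

    -- A margin of ε/4 at each end leaves the length `ρ` = r - l - ε/2 for the centres; the other
    -- ε/2 pays for all remaining errors.
    δ′ = half (half ε)
    0<δ′ : 0# < δ′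
    0<δ′ = 0<half (0<half 0<ε)
    ρ = r - l - half ε
    0<ρ : 0# < ρ
    0<ρ = <⇒0< (<-trans (half<self 0<ε) ε<r-l)
    ρ≤1 : ρ ≤ 1#
    ρ≤1 = diff-≤ (0≤+ (≤⇒0≤ r≤l+1) (<⇒≤ (0<half 0<ε)))
      (solve 3 (λ r l e → ♯ 1 :- (r :- l :- e) := l :+ ♯ 1 :- r :+ e) refl r l (half ε))
    δ′<1 : δ′ < 1#
    δ′<1 = <-trans (half<self (0<half 0<ε)) (<-≤-trans (half<self 0<ε) (≤-trans (<⇒≤ ε<r-l)
      (diff-≤ (≤⇒0≤ r≤l+1) (solve 2 (λ r l → ♯ 1 :- (r :- l) := l :+ ♯ 1 :- r) refl r l))))
    s² = sin (π * δ′) * sin (π * δ′)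
    0<s² : 0# < s²
    0<s² = 0<* 0<s 0<s
      where
      0<s : 0# < sin (π * δ′)
      0<s = 0<sin (0<* 0<π 0<δ′) (<-respʳ (*-identityʳ π) (0<*-lt 0<π δ′<1))
    Q = fromℕ 2 / s²
    0≤Q : 0# ≤ Q
    0≤Q = 0≤/ (<⇒≤ 0<2) 0<s²

    abstract
      -- Measured in units of M, the errors are at most Q from the kernels off the arc, 1 from
      -- rounding K, and 1/M ≤ 1 from the tolerance on the mean of `V`: hence Q + 2.
      M-choice : ∃ λ M → NonZero M × Q + fromℕ 2 ≤ fromℕ M * half ε
      M-choice = let n , h = archimedean ((Q + fromℕ 2) / half ε) in suc n , _ ,
        ≤-respˡ (*-/-cancel (Q + fromℕ 2) (0<half 0<ε)) (≤-respʳ (*-comm (half ε) (fromℕ (suc n)))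
          (*-monoˡ-≤ (half ε) (<⇒≤ (0<half 0<ε)) (≤-trans (<⇒≤ h) (fromℕ-mono (ℕ.n≤1+n n)))))

    M = proj₁ M-choice
    instance
      M≢0 : NonZero M
      M≢0 = proj₁ (proj₂ M-choice)
    m = fromℕ M
    0<m : 0# < m
    0<m = 0<fromℕ M
    Q+2≤mε/2 : Q + fromℕ 2 ≤ m * half ε
    Q+2≤mε/2 = proj₂ (proj₂ M-choice)

    abstract
      -- Rounding down keeps every centre at most r - δ′ and loses less than one translate.
      K-floor : ∃ λ n → fromℕ n ≤ m * ρ × m * ρ < fromℕ n + 1#
      K-floor = floorℕ (m * ρ) (<⇒≤ (0<* 0<m 0<ρ))

    K = proj₁ K-floor
    κ = fromℕ K
    κ≤mρ : κ ≤ m * ρ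
    κ≤mρ = proj₁ (proj₂ K-floor)
    mρ≤κ+1 : m * ρ ≤ κ + 1#
    mρ≤κ+1 = <⇒≤ (proj₂ (proj₂ K-floor))
    κ≤m : κ ≤ m
    κ≤m = ≤-trans κ≤mρ (≤-respʳ (*-identityʳ m) (*-monoˡ-≤ m (<⇒≤ 0<m) ρ≤1))

    b : ℕ → ℝ
    b a = l + δ′ + fromℕ a / m

    V : ℝ → ℝ
    V x = Σ< K λ a → fejer M (x - b a)

    -- Since K ≤ M and the kernel is nonnegative, `V` can be completed to all M translates, whose
    -- sum is constant.
    V≤m² : ∀ x → V x ≤ m * m
    V≤m² x = ≤-trans (Σ-monoˡ {K} {M} (λ a → 0≤fejer M (x - b a)) (fromℕ-cancel-≤ {K} {M} κ≤m))
      (≤-reflexive (trans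
      (Σ-cong M λ a → fejer-cong M (solve 4 (λ x l d a → x :- (l :+ d :+ a) := x :- (l :+ d) :- a)
        refl x l δ′ (fromℕ a / m)))
      (fejer-partition M (x - (l + δ′)))))

    V-outside : ∀ x → ¬ InOpenArc l r x → V x ≤ κ * Q
    V-outside x x∉ = ≤-respʳ (Σ-const K Q) (Σ-mono< K λ a a<K → ≤-/ 0<s² (≤-respˡ (*-comm _ _)
      (fejer-outside M 0<δ′ r≤l+1 (l+δ≤b a) (b≤r-δ a a<K) x∉)))
      where
      l+δ≤b : ∀ a → l + δ′ ≤ b a
      l+δ≤b a = diff-≤ (0≤/ (0≤fromℕ a) 0<m)
        (solve 3 (λ l d a → l :+ d :+ a :- (l :+ d) := a) refl l δ′ (fromℕ a / m))
      b≤r-δ : ∀ a → a ℕ.< K → b a ≤ r - δ′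
      b≤r-δ a a<K = diff-≤ (≤⇒0≤ a/m≤ρ) (trans
        (solve 5 (λ r l d a h → r :- d :- (l :+ d :+ a) := r :- l :- (d :+ d) :- a) refl r l δ′
          (fromℕ a / m) (half ε))
        (+-congʳ (+-congˡ (-‿cong (half+half (half ε))))))
        where
        a/m≤ρ : fromℕ a / m ≤ ρ
        a/m≤ρ = /-≤ 0<m (≤-trans (fromℕ-mono (ℕ.<⇒≤ a<K)) κ≤mρ)

    ind : ℕ → ℝ
    ind i = indicator (InOpenArc l r (y i))

    V≤ : ∀ i → V (y i) ≤ m * m * ind i + κ * Q
    V≤ i = indicator-elim (λ p → V (y i) ≤ m * m * p + κ * Q)
      (λ _ → ≤-trans (V≤m² (y i)) (diff-≤ (*-nonNeg (0≤fromℕ K) 0≤Q)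
        (solve 2 (λ n q → n :* ♯ 1 :+ q :- n := q) refl (m * m) (κ * Q))))
      (λ y∉ → ≤-respʳ (solve 2 (λ n q → q := n :* ♯ 0 :+ q) refl (m * m) (κ * Q))
        (V-outside (y i) y∉))

    mean-V : mean (λ i → V (y i)) ⟶ κ * m
    mean-V = ⟶-cong (λ N → sym (mean-Σ K (λ a i → fejer M (y i - b a)) N)) (Σ-const K m)
      (⟶-Σ K λ a → mean-fejer M (b a))

    bound : ∃ λ N₀ → ∀ N → N₀ ℕ.≤ N → r - l - ε ≤ mean ind N
    -- Tolerance 1 suffices, because the mean of `V` is compared with quantities of order M².
    bound = let N₀ , close = ⟶-elim mean-V 1# 0<1 in
      suc N₀ , λ { N@(suc _) N₀<N → final N (proj₁ (close N (ℕ.<⇒≤ N₀<N))) }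
      where
      final : ∀ N → .{{NonZero N}} → - 1# ≤ mean (λ i → V (y i)) N - κ * m → r - l - ε ≤ mean ind N
      final N -1≤ = *-cancel-≤ (0<* 0<m 0<m) (diff-≤
        (0≤+ (≤⇒0≤ (≤-trans -1≤ (+-monoˡ-≤ (- (κ * m))
          (≤-trans (mean-mono V≤ N) (≤-reflexive (mean-affine (m * m) (κ * Q) ind N))))))
          (0≤+ (*-nonNeg (<⇒≤ 0<m) (≤⇒0≤ mρ≤κ+1))
            (0≤+ (*-nonNeg (≤⇒0≤ κ≤m) 0≤Q) (0≤+ (≤⇒0≤ (fromℕ-mono {1} {M} (ℕ.>-nonZero⁻¹ M)))
            (*-nonNeg (<⇒≤ 0<m) (≤⇒0≤ Q+2≤mε/2))))))
        (trans (+-congˡ (-‿cong (*-congˡ (+-congˡ (-‿cong (sym (half+half ε)))))))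
         (solve 7 (λ m i k q r l h →
           m :* m :* i :- m :* m :* (r :- l :- (h :+ h)) :=
           m :* m :* i :+ k :* q :- k :* m :- :- ♯ 1 :+
             (m :* (k :+ ♯ 1 :- m :* (r :- l :- h)) :+
             ((m :- k) :* q :+ (m :- (♯ 1 :+ ♯ 0) :+ m :* (m :* h :- (q :+ ♯ 2))))))
           refl m (mean ind N) κ Q r l (half ε))))

  -- For r - l ≤ ε the left side is not positive, while frequencies are nonnegative. This also
  -- covers degenerate arcs, which have no room for centres.
  arc-lower : ∀ (y : ℕ → ℝ) → (∀ M b → mean (λ i → fejer M (y i - b)) ⟶ fromℕ M) →
              ∀ {l r} → r ≤ l + 1# → ∀ ε → 0# < ε → ∃ λ N₀ → ∀ N → N₀ ℕ.≤ N →
              r - l - ε ≤ mean (λ i → indicator (InOpenArc l r (y i))) N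
  arc-lower y mean-fejer {l} {r} r≤l+1 ε 0<ε =
    [ trivial , LowerBound.bound y mean-fejer r≤l+1 0<ε ]′ (≤⊎> (r - l) ε)
    where
    trivial : r - l ≤ ε → ∃ λ N₀ → ∀ N → N₀ ℕ.≤ N →
              r - l - ε ≤ mean (λ i → indicator (InOpenArc l r (y i))) N
    trivial r-l≤ε = 1 , λ { N@(suc _) _ → ≤-trans
      (diff-≤ (≤⇒0≤ r-l≤ε) (solve 2 (λ a e → ♯ 0 :- (a :- e) := e :- a) refl (r - l) ε))
      (0≤/ (0≤Σ N λ i → 0≤indicator (InOpenArc l r (y i))) (0<fromℕ N)) }

  -- Arbitrary endpoints and the complementary arc

  below-< : ∀ κ {x y} → x < y → below κ x y
  below-< closed x<y = <⇒≤ x<y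
  below-< open′  x<y = x<y

  below-≤ : ∀ κ {x y} → below κ x y → x ≤ y
  below-≤ closed x≤y = x≤y
  below-≤ open′  x<y = <⇒≤ x<y

  interior⊆ : ∀ J {x} → InOpenArc (Arc.left J) (Arc.right J) x → x ∈ J
  interior⊆ J {x} (k , l<z , z<r) = x + fromℤ k , Setoid.sym 𝕋 (k , refl) ,
    below-< (Arc.leftKind J) l<z , below-< (Arc.rightKind J) z<r

  -- Representatives z in [l, r] and w in (r, l + 1) of one point would differ by an integer
  -- strictly between 0 and 1. Only the non-strict bounds on z enter, so every kind of endpoint is
  -- covered.
  exterior-disjoint : ∀ J {x} → x ∈ J → InOpenArc (Arc.right J) (Arc.left J + 1#) x → ⊥
  exterior-disjoint J {x} (z , (j , x≈) , l≤z , z≤r) (k , r<w , w<l+1) =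
    no-integer-in-unit-interval (j ℤ.+ k)
    (diff-< (0<+0≤ (<⇒0< r<w) (≤⇒0≤ (below-≤ (Arc.rightKind J) z≤r)))
      (trans (+-congʳ j+k≈) (solve 3 (λ w z r → w :- z :- ♯ 0 := w :- r :+ (r :- z)) refl w z r)))
    (diff-< (0<+0≤ (<⇒0< w<l+1) (≤⇒0≤ (below-≤ (Arc.leftKind J) l≤z)))
      (trans (+-congˡ (-‿cong j+k≈))
        (solve 3 (λ w z l → ♯ 1 :- (w :- z) := l :+ ♯ 1 :- w :+ (z :- l)) refl w z l)))
    where
    l = Arc.left J
    r = Arc.right J
    w = x + fromℤ k
    j+k≈ : fromℤ (j ℤ.+ k) ≈ w - z
    j+k≈ = trans (fromℤ-+ j k) (trans
      (solve 3 (λ j k z → j :+ k := z :+ j :+ k :- z) refl (fromℤ j) (fromℤ k) z)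
      (+-congʳ (+-congʳ (sym x≈))))

  uniformly-distributed : ∀ (x : ℕ → ℝ) → (∀ M b → mean (λ i → fejer M (x (suc i) - b)) ⟶ fromℕ M) →
    UniformlyDistributed x
  uniformly-distributed x mean-fejer J = ⟶-cong
    (λ N → *-congʳ (sym (count≈ (λ i → x i ∈ J) suc N))) refl
    (⟶-intro λ ε 0<ε →
      let N₁ , lower = arc-lower y mean-fejer (Arc.right≤left+1 J) ε 0<ε
          -- The complement (r, l + 1) has length 1 - (r - l). Its lower bound becomes the upper
          -- bound for J, since the two frequencies add up to at most 1.
          N₂ , upper = arc-lower y mean-fejer (+-monoˡ-≤ 1# (Arc.left≤right J)) ε 0<ε
      in suc (N₁ ℕ.⊔ N₂) , λ { N@(suc _) N₀<N →
        let N₀≤N = ℕ.<⇒≤ N₀<N in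
        diff-≤ (≤⇒0≤ (≤-trans (lower N (ℕ.≤-trans (ℕ.m≤m⊔n N₁ N₂) N₀≤N))
          (mean-mono (λ i → indicator-mono (interior⊆ J)) N)))
          (solve 4 (λ a r l e → a :- (r :- l) :- :- e := a :- (r :- l :- e)) refl (mean inJ N) r l
            ε) ,
        diff-≤ (0≤+ (≤⇒0≤ (upper N (ℕ.≤-trans (ℕ.m≤n⊔m N₁ N₂) N₀≤N))) (≤⇒0≤ (disjoint N)))
          (solve 5 (λ a b r l e → e :- (a :- (r :- l)) := b :- (l :+ ♯ 1 :- r :- e) :+
            (♯ 1 :- (a :+ b))) refl (mean inJ N) (mean outJ N) r l ε) })
    where
    l = Arc.left J
    r = Arc.right J
    y : ℕ → ℝ
    y i = x (suc i)
    inJ outJ : ℕ → ℝ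
    inJ i  = indicator (x (suc i) ∈ J)
    outJ i = indicator (InOpenArc r (l + 1#) (y i))
    disjoint : ∀ N → .{{NonZero N}} → mean inJ N + mean outJ N ≤ 1#
    disjoint N = ≤-respˡ (trans (*-congʳ (Σ-+ N inJ outJ)) (distribʳ _ _ _))
      (≤-trans (mean-mono {g = λ _ → 1#} (λ i → indicator-disjoint (exterior-disjoint J)) N)
        (≤-reflexive (trans (*-congʳ (trans (Σ-const N 1#) (*-identityʳ _)))
          (inverseʳ (0<fromℕ N)))))

  energy-criterion : ∀ (x t : ℕ → ℝ) → Positive t → BoundedAbove t →
    (λ N → sumTo N (λ m → sumTo N (λ n → θ (t N) (x n - x m))) / fromℕ N ^ 2) ⟶ 1# →
      UniformlyDistributed x
  energy-criterion x t 0<t t-bounded energy⟶1 =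
    uniformly-distributed x (FejerMean.mean-fejer y
      (ExponentialSums.mean-cos x t 0<t t-bounded energy⟶1)
      (ExponentialSums.mean-sin x t 0<t t-bounded energy⟶1))
    where
    y : ℕ → ℝ
    y i = x (suc i)

corollary1 : (em : ExcludedMiddle 0ℓ) (R : CompleteOrderedField) →
    let open RealAnalysis em R in
    (x : ℕ → Setoid.Carrier 𝕋) →
    (∃ λ (t : ℕ → ℝ) → Positive t × BoundedAbove t ×
    ((λ N → sumTo N (λ m → sumTo N (λ n → θ (t N) (x n - x m))) / fromℕ N ^ 2) ⟶ 1#)) →
    UniformlyDistributed x
corollary1 em R x (t , 0<t , t-bounded , energy⟶1) =
  Equidistribution.energy-criterion em R x t 0<t t-bounded energy⟶1
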